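{- Let $k\geq 0$ and $m\geq k+1$ be integers, and let $W$ be the Coxeter group of type $B_{m-k}$. For any Coxeter element $c$ of $W$, the multi-cluster complex $\Delta^k_c(W)$ is isomorphic to the simplicial complex $\Delta^{sym}_{m,k}$ of centrally symmetric $k$-triangulations of a regular convex $2m$-gon.
   Context: $\Delta^k_c(W)=\Delta(\mathbf{c}^k\mathbf{w}_\circ(\mathbf{c}),w_\circ)$, where $\mathbf{c}$ is a reduced word of the Coxeter element $c$ (product of all simple generators in some order), $w_\circ$ is the longest element, $\mathbf{w}_\circ(\mathbf{c})$ is the lexicographically first (as a sequence of positions) subword of $\mathbf{c}\mathbf{c}\mathbf{c}\cdots$ which is a reduced expression for $w_\circ$, and for a word $Q$ and $\pi\in W$ the subword complex $\Delta(Q,\pi)$ is the simplicial complex on the positions of $Q$ whose faces are the sets $P$ of positions such that deleting $P$ from $Q$ leaves a word containing a reduced expression for $\pi$ as a subword. Label the vertices of a regular convex $2m$-gon $0,\dots,2m-1$. A diagonal $[i,j]$ is $k$-relevant if there are at least $k$ vertices of the polygon strictly on each side of it. Central symmetry maps $[i,j]$ to $[i+m,j+m]$ (indices mod $2m$); a symmetric pair is an orbit $\{d,\bar d\}$ of a $k$-relevant diagonal under central symmetry (a single diagonal if $d$ is a diameter). A $(k+1)$-crossing is a set of $k+1$ pairwise crossing diagonals. $\Delta^{sym}_{m,k}$ is the simplicial complex whose vertices are the symmetric pairs of $k$-relevant diagonals and whose faces are the collections of such pairs whose diagonals together contain no $(k+1)$-crossing; its facets are the centrally symmetric $k$-triangulations.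 -}

module Defs where

open import Data.Nat using (ℕ; zero; suc; _+_; _*_; _∸_; _≤_; _<_; _≤ᵇ_; _<ᵇ_; _%_)
open import Data.Bool using (Bool; true; false; not; if_then_else_)
open import Data.Fin using (Fin; zero; suc; inject₁) renaming (_≟_ to _≟F_)
open import Data.Product using (Σ; _×_; _,_; proj₁; proj₂)
open import Data.Sum using (_⊎_)
open import Data.List using (List; []; _∷_; length; map; _++_; concat; replicate)
open import Data.List.Relation.Unary.Linked using (Linked)
open import Data.Maybe using (Maybe; just; nothing)
open import Data.Vec using (Vec; tabulate)
open import Relation.Binary.PropositionalEquality using (_≡_; _≢_)
open import Relation.Nullary using (¬_; does)
open import Function using (_∘_)
open import Function.Bundles using (_↔_; _⇔_; Inverse)

-- The Coxeter group of type B_n, realised as the group of signed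
-- permutations of {±1,…,±n}.  A point ±(i+1) is encoded as (b , i) with
-- b = true meaning "negative".  Simple generators are indexed by Fin n:
--   zero     ↦ s₀ : change the sign of the first coordinate,
--   suc j    ↦ s_{j+1} : the transposition of coordinates j and j+1.
-- (Coxeter diagram s₀ =4= s₁ — s₂ — … — s_{n-1}, i.e. type B_n.)

Point : ℕ → Set
Point n = Bool × Fin n

swapFin : ∀ {n} → Fin n → Fin n → Fin n → Fin n
swapFin a b x =
  if does (x ≟F a) then b else (if does (x ≟F b) then a else x)

gen : ∀ {n} → Fin n → Point n → Point n
gen {suc n} zero    (b , zero)  = (not b , zero)
gen {suc n} zero    (b , suc x) = (b , suc x)
gen {suc n} (suc j) (b , x)     = (b , swapFin (inject₁ j) (suc j) x)

Word : ℕ → Set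
Word n = List (Fin n)

act : ∀ {n} → Word n → Point n → Point n
act []      p = p
act (i ∷ w) p = gen i (act w p)

-- group elements: a signed permutation is determined by the images of
-- the positive points +1,…,+n
Elem : ℕ → Set
Elem n = Vec (Point n) n

elem : ∀ {n} → Word n → Elem n
elem w = tabulate (λ j → act w (false , j))

IsReduced : ∀ {n} → Word n → Set
IsReduced {n} w = ∀ (v : Word n) → elem v ≡ elem w → length w ≤ length v

ReducedExprFor : ∀ {n} → Elem n → Word n → Set
ReducedExprFor x w = elem w ≡ x × IsReduced w

HasLength : ∀ {n} → Elem n → ℕ → Set
HasLength {n} x l =
  Σ (Word n) (λ w → elem w ≡ x × length w ≡ l)
  × (∀ (v : Word n) → elem v ≡ x → l ≤ length v)

IsLongest : ∀ {n} → Elem n → Set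
IsLongest {n} x =
  Σ ℕ (λ l → HasLength x l × (∀ (y : Elem n) (l' : ℕ) → HasLength y l' → l' ≤ l))

nth : ∀ {A : Set} → List A → ℕ → Maybe A
nth []       _       = nothing
nth (x ∷ xs) zero    = just x
nth (x ∷ xs) (suc p) = nth xs p

infLetter : ∀ {A : Set} → List A → ℕ → Maybe A
infLetter []       p = nothing
infLetter (x ∷ xs) p = nth (x ∷ xs) (p % length (x ∷ xs))

data LexLeq : List ℕ → List ℕ → Set where
  lex-[] : ∀ {ys} → LexLeq [] ys
  lex-<  : ∀ {x y xs ys} → x < y → LexLeq (x ∷ xs) (y ∷ ys)
  lex-≡  : ∀ {x xs ys} → LexLeq xs ys → LexLeq (x ∷ xs) (x ∷ ys)

SubwordOfCinf : ∀ {n} → Word n → List ℕ → Word n → Set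
SubwordOfCinf c ps w = Linked _<_ ps × map (infLetter c) ps ≡ map just w

-- (ps , w): ps is the lexicographically first sequence of positions of
-- c c c ⋯ whose subword w is a reduced expression for x.  Then w = w∘(c)
-- when x = w∘.
IsLexFirstReduced : ∀ {n} → Word n → Elem n → List ℕ → Word n → Set
IsLexFirstReduced {n} c x ps w =
  SubwordOfCinf c ps w × ReducedExprFor x w
  × (∀ (ps' : List ℕ) (w' : Word n) →
       SubwordOfCinf c ps' w' → ReducedExprFor x w' → LexLeq ps ps')

record SComplex : Set₁ where
  field
    V    : Set
    Face : (V → Bool) → Set

open SComplex

_≅_ : SComplex → SComplex → Set
K ≅ L = Σ (V K ↔ V L) λ f →
  ∀ (T : V L → Bool) → Face K (T ∘ Inverse.to f) ⇔ Face L T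

restrict : ∀ {A : Set} (Q : List A) → (Fin (length Q) → Bool) → List A
restrict []      S = []
restrict (a ∷ Q) S with S zero
... | true  = a ∷ restrict Q (S ∘ suc)
... | false = restrict Q (S ∘ suc)

SubwordComplex : ∀ {n} → Word n → Elem n → SComplex
SubwordComplex Q π = record
  { V    = Fin (length Q)
  ; Face = λ P → Σ (Fin (length Q) → Bool) λ S →
             (∀ i → S i ≡ true → P i ≡ false)
             × ReducedExprFor π (restrict Q S)
  }

-- multi-cluster complex Δ^k_c(W) for Q = c^k w∘(c)
cPowThen : ∀ {n} → ℕ → Word n → Word n → Word n
cPowThen k c w = concat (replicate k c) ++ w

-- a segment [a,b] between vertices a < b of the 2m-gon (vertices 0..2m-1)
Seg : Set
Seg = ℕ × ℕ

IsSeg : ℕ → Seg → Set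
IsSeg m (a , b) = a < b × b < 2 * m

-- at least k polygon vertices strictly on each side
Relevant : ℕ → ℕ → Seg → Set
Relevant m k (a , b) = k + 1 ≤ b ∸ a × k + 1 ≤ 2 * m ∸ (b ∸ a)

rot : ℕ → ℕ → ℕ
rot m a = if a <ᵇ m then a + m else a ∸ m

mkSeg : ℕ → ℕ → Seg
mkSeg a b = if a ≤ᵇ b then (a , b) else (b , a)

symSeg : ℕ → Seg → Seg
symSeg m (a , b) = mkSeg (rot m a) (rot m b)

SegLeq : Seg → Seg → Set
SegLeq (a , b) (c , d) = a < c ⊎ (a ≡ c × b ≤ d)

-- symmetric pairs of k-relevant diagonals, each represented by the
-- lexicographically smaller member of the orbit
SymPair : ℕ → ℕ → Set
SymPair m k = Σ Seg λ d → IsSeg m d × Relevant m k d × SegLeq d (symSeg m d)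

InUnion : ∀ m k → (SymPair m k → Bool) → Seg → Set
InUnion m k T d =
  Σ (SymPair m k) λ v → T v ≡ true × (proj₁ v ≡ d ⊎ symSeg m (proj₁ v) ≡ d)

Cross : Seg → Seg → Set
Cross (a , b) (c , d) = (a < c × c < b × b < d) ⊎ (c < a × a < d × d < b)

HasCrossing : ∀ m k → (SymPair m k → Bool) → Set
HasCrossing m k T =
  Σ (Fin (suc k) → Seg) λ ds →
    (∀ i → InUnion m k T (ds i)) × (∀ i j → i ≢ j → Cross (ds i) (ds j))

SymComplex : ℕ → ℕ → SComplex
SymComplex m k = record
  { V    = SymPair m k
  ; Face = λ T → ¬ HasCrossing m k T
  }

{-# OPTIONS --safe #-}

-- In type B_n the longest element w∘ is -1, and cⁿ is a reduced word for it for
-- every Coxeter element c, so with n = m - k the word cᵏ w∘(c) is just cᵐ.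
--
-- A signed permutation is an antisymmetric arrangement of 2n labels on 2n sites,
-- and the letter i exchanges the contents across the boundaries n + i and n - i.
-- The boundary x carries the lattice points (a , b) with b - a = k + x, so the
-- letters of cᵐ become the diagonals [a , b] of the 2m-gon, lifted to the universal
-- cover and taken up to the central symmetry; processing cᵐ pushes a staircase of
-- such points forward by (m , m).
--
-- For a threshold θ let h x be the number of labels ≥ θ to the left of the boundary
-- x, and let (α , β) be the point of the initial staircase at the boundary θ.  When
-- the letters marked by a set T of diagonals are deleted, and the others are used
-- greedily to sort, b - β - h x obeys the recursion for the length of a longest
-- chain of T (increasing in both coordinates) between (α , β) and (a , b).  The
-- arrangement ends up reversed iff this length is at most k at (β , α + 2m) for all
-- θ.  Such a chain has all its a's in (α , β] and all its b's in (β , α + 2m], so it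
-- consists of pairwise crossing diagonals; conversely every crossing, read from a
-- suitable endpoint on, is such a chain.
module Submission where

open import Defs
open import Data.Bool using (Bool; true; false; not; _∧_; T)
open import Data.Bool.Properties using (T-∧)
open import Data.Empty using (⊥; ⊥-elim)
open import Data.Fin as Fin using (Fin; toℕ; inject₁; fromℕ<) renaming (_≟_ to _≟F_)
open import Data.Fin.Properties using (toℕ<n; toℕ-inject₁; toℕ-injective; toℕ-fromℕ<; any?)
open import Data.List using (List; []; _∷_; _++_; length; concat; replicate; map; foldr; tabulate; allFin)
import Data.List.Properties as ListP
open import Data.List.Properties using (length-++; map-++; length-map; ++-assoc; ++-identityʳ)
open import Data.List.Relation.Binary.Permutation.Propositional using (_↭_; prep; swap)
import Data.List.Relation.Binary.Permutation.Propositional as Perm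
open import Data.List.Relation.Binary.Permutation.Propositional.Properties using (↭-length)
open import Data.List.Relation.Unary.All as All using (All; []; _∷_)
import Data.List.Relation.Unary.All.Properties as AllP
open import Data.List.Relation.Unary.AllPairs using (AllPairs; []; _∷_)
import Data.List.Relation.Unary.AllPairs.Properties as AllPairsP
open import Data.List.Relation.Unary.Linked using (Linked; []; [-]; _∷_)
open import Data.Maybe using (Maybe; just)
open import Data.Maybe.Properties using (just-injective)
open import Data.Nat
open import Data.Nat.DivMod using (m<n⇒m%n≡m; [m+kn]%n≡m%n; m≡m%n+[m/n]*n; m%n<n; [m+n]%n≡m%n)
open import Data.Nat.Properties
open import Data.Product using (Σ; _×_; _,_; proj₁; proj₂)
open import Data.Sum using (_⊎_; inj₁; inj₂)
open import Data.Unit using (⊤; tt)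
import Data.Vec as Vec
open import Data.Vec.Properties using (lookup∘tabulate; tabulate-cong)
open import Function using (_∘_)
open import Function.Bundles using (Equivalence; _↔_; mk⇔; mk⤖)
open import Function.Properties.Bijection using (⤖⇒↔)
open import Relation.Binary.Definitions using (Tri; tri<; tri≈; tri>)
open import Relation.Binary.PropositionalEquality
open import Relation.Nullary using (¬_; Dec; yes; no)

-- Why the heights obey the chain recursion: a letter moves a corner (a , b) to (a + 1 , b + 1), and
-- a longest chain below the new corner is a longest one below a neighbour on the staircase, or, if
-- the new corner is marked, one below the old corner plus one point. Heights are monotone and grow
-- by at most one per site, so b - β - h at the new corner is at least its value at both neighbours,
-- whatever the subword does; a deleted letter leaves h alone, so there the value grows by exactly
-- one. This gives the lower bound for every subword that avoids the marks. Equality needs a choice: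
-- if the two labels at an unmarked corner end up in descending order, then for every θ at once one
-- of the two neighbour inequalities is sharp. Hence the upper bound is proved for the greedy
-- subword only. The obstacle is that one threshold sees only the chains that start at its own
-- staircase point. That some θ fits a given crossing is a discrete intermediate value argument:
-- along the staircase the number of endpoints in (a , b] changes by at most one per step and must
-- pass through k + 1.

-- Linear arithmetic over the naturals by certificates

module LinearArithmetic where

  infixl 8 _⊕_
  infixl 9 _⊛_
  infix 6 _≼_ _≺_ _≈_
  infixr 5 _⇒_

  data Expr : Set where
    ν   : ℕ → Expr
    κ   : ℕ → Expr
    ς   : Expr → Expr
    _⊕_ : Expr → Expr → Expr
    _⊛_ : ℕ → Expr → Expr

  data Claim : Set where
    _≼_ _≺_ _≈_ : Expr → Expr → Claim
    ↯           : Claim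
    _⇒_         : Claim → Claim → Claim

  Env : Set
  Env = List ℕ

  at : Env → ℕ → ℕ
  at []      i       = 0
  at (x ∷ ρ) zero    = x
  at (x ∷ ρ) (suc i) = at ρ i

  ⟦_⟧ : Expr → Env → ℕ
  ⟦ ν i ⟧   ρ = at ρ i
  ⟦ κ c ⟧   ρ = c
  ⟦ ς e ⟧   ρ = suc (⟦ e ⟧ ρ)
  ⟦ e ⊕ f ⟧ ρ = ⟦ e ⟧ ρ + ⟦ f ⟧ ρ
  ⟦ c ⊛ e ⟧ ρ = c * ⟦ e ⟧ ρ

  Holds : Env → Claim → Set
  Holds ρ (e ≼ f) = ⟦ e ⟧ ρ ≤ ⟦ f ⟧ ρ
  Holds ρ (e ≺ f) = ⟦ e ⟧ ρ < ⟦ f ⟧ ρ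
  Holds ρ (e ≈ f) = ⟦ e ⟧ ρ ≡ ⟦ f ⟧ ρ
  Holds ρ ↯       = ⊥
  Holds ρ (h ⇒ g) = Holds ρ h → Holds ρ g

  -- Linear forms: the head is the constant term.
  Form : Set
  Form = List ℕ

  dot : Form → Env → ℕ
  dot []       ρ       = 0
  dot (c ∷ cs) []      = 0
  dot (c ∷ cs) (x ∷ ρ) = c * x + dot cs ρ

  _⊞_ : Form → Form → Form
  []       ⊞ ds       = ds
  (c ∷ cs) ⊞ []       = c ∷ cs
  (c ∷ cs) ⊞ (d ∷ ds) = (c + d) ∷ (cs ⊞ ds)

  _⊠_ : ℕ → Form → Form
  l ⊠ []       = []
  l ⊠ (c ∷ cs) = l * c ∷ (l ⊠ cs)

  unit : ℕ → Form
  unit zero    = 1 ∷ []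
  unit (suc i) = 0 ∷ unit i

  form : Expr → Form
  form (ν i)   = unit (suc i)
  form (κ c)   = c ∷ []
  form (ς e)   = (1 ∷ []) ⊞ form e
  form (e ⊕ f) = form e ⊞ form f
  form (c ⊛ e) = c ⊠ form e

  dot-⊞ : ∀ cs ds ρ → dot (cs ⊞ ds) ρ ≡ dot cs ρ + dot ds ρ
  dot-⊞ []       ds       ρ       = refl
  dot-⊞ (c ∷ cs) []       ρ       = sym (+-identityʳ _)
  dot-⊞ (c ∷ cs) (d ∷ ds) []      = refl
  dot-⊞ (c ∷ cs) (d ∷ ds) (x ∷ ρ) = begin
    (c + d) * x + dot (cs ⊞ ds) ρ           ≡⟨ cong₂ _+_ (*-distribʳ-+ x c d) (dot-⊞ cs ds ρ) ⟩
    (c * x + d * x) + (dot cs ρ + dot ds ρ) ≡⟨ +-assoc (c * x) (d * x) _ ⟩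
    c * x + (d * x + (dot cs ρ + dot ds ρ)) ≡⟨ cong (c * x +_) (x∙yz≈y∙xz (d * x) (dot cs ρ) (dot ds ρ)) ⟩
    c * x + (dot cs ρ + (d * x + dot ds ρ)) ≡⟨ +-assoc (c * x) (dot cs ρ) _ ⟨
    (c * x + dot cs ρ) + (d * x + dot ds ρ) ∎
    where
    open ≡-Reasoning
    open import Algebra.Properties.CommutativeSemigroup +-commutativeSemigroup using (x∙yz≈y∙xz)

  dot-⊠ : ∀ l cs ρ → dot (l ⊠ cs) ρ ≡ l * dot cs ρ
  dot-⊠ l []       ρ       = sym (*-zeroʳ l)
  dot-⊠ l (c ∷ cs) []      = sym (*-zeroʳ l)
  dot-⊠ l (c ∷ cs) (x ∷ ρ) =
    trans (cong₂ _+_ (*-assoc l c x) (dot-⊠ l cs ρ)) (sym (*-distribˡ-+ l (c * x) (dot cs ρ)))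

  dot-unit : ∀ i ρ → dot (unit i) ρ ≡ at ρ i
  dot-unit zero    []      = refl
  dot-unit zero    (x ∷ ρ) = trans (+-identityʳ _) (*-identityˡ x)
  dot-unit (suc i) []      = refl
  dot-unit (suc i) (x ∷ ρ) = dot-unit i ρ

  dot-form : ∀ e ρ → dot (form e) (1 ∷ ρ) ≡ ⟦ e ⟧ ρ
  dot-form (ν i)   ρ = dot-unit i ρ
  dot-form (κ c)   ρ = trans (+-identityʳ _) (*-identityʳ c)
  dot-form (ς e)   ρ = trans (dot-⊞ (1 ∷ []) (form e) (1 ∷ ρ)) (cong suc (dot-form e ρ))
  dot-form (e ⊕ f) ρ = trans (dot-⊞ (form e) (form f) (1 ∷ ρ)) (cong₂ _+_ (dot-form e ρ) (dot-form f ρ))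
  dot-form (c ⊛ e) ρ = trans (dot-⊠ c (form e) (1 ∷ ρ)) (cong (c *_) (dot-form e ρ))

  Ineq : Set
  Ineq = Expr × Expr

  HoldAll : Env → List Ineq → Set
  HoldAll ρ []             = ⊤
  HoldAll ρ ((e , f) ∷ is) = ⟦ e ⟧ ρ ≤ ⟦ f ⟧ ρ × HoldAll ρ is

  -- The multipliers are the decimal digits of the certificate, lowest first.
  combine : ℕ → List Ineq → Form × Form
  combine c []             = [] , []
  combine c ((e , f) ∷ is) =
    ((c % 10) ⊠ form e) ⊞ proj₁ (combine (c / 10) is) , ((c % 10) ⊠ form f) ⊞ proj₂ (combine (c / 10) is)

  combine-sound : ∀ c is ρ → HoldAll ρ is →
    dot (proj₁ (combine c is)) (1 ∷ ρ) ≤ dot (proj₂ (combine c is)) (1 ∷ ρ)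
  combine-sound c []             ρ hs       = z≤n
  combine-sound c ((e , f) ∷ is) ρ (h , hs) = begin
    dot ((l ⊠ form e) ⊞ P) σ       ≡⟨ dot-⊞ (l ⊠ form e) P σ ⟩
    dot (l ⊠ form e) σ + dot P σ   ≤⟨ +-mono-≤ scaled (combine-sound (c / 10) is ρ hs) ⟩
    dot (l ⊠ form f) σ + dot R σ   ≡⟨ dot-⊞ (l ⊠ form f) R σ ⟨
    dot ((l ⊠ form f) ⊞ R) σ       ∎
    where
    open ≤-Reasoning
    l = c % 10
    σ = 1 ∷ ρ
    P = proj₁ (combine (c / 10) is)
    R = proj₂ (combine (c / 10) is)
    scaled : dot (l ⊠ form e) σ ≤ dot (l ⊠ form f) σ
    scaled = begin
      dot (l ⊠ form e) σ ≡⟨ dot-⊠ l (form e) σ ⟩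
      l * dot (form e) σ ≡⟨ cong (l *_) (dot-form e ρ) ⟩
      l * ⟦ e ⟧ ρ        ≤⟨ *-monoʳ-≤ l h ⟩
      l * ⟦ f ⟧ ρ        ≡⟨ cong (l *_) (dot-form f ρ) ⟨
      l * dot (form f) σ ≡⟨ dot-⊠ l (form f) σ ⟨
      dot (l ⊠ form f) σ ∎

  _⊑_ : Form → Form → Bool
  []       ⊑ ds       = true
  (c ∷ cs) ⊑ []       = (c ≤ᵇ 0) ∧ (cs ⊑ [])
  (c ∷ cs) ⊑ (d ∷ ds) = (c ≤ᵇ d) ∧ (cs ⊑ ds)

  ⊑-sound : ∀ cs ds ρ → T (cs ⊑ ds) → dot cs ρ ≤ dot ds ρ
  ⊑-sound []       ds       ρ       t = z≤n
  ⊑-sound (c ∷ cs) []       []      t = z≤n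
  ⊑-sound (c ∷ cs) []       (x ∷ ρ) t with Equivalence.to (T-∧ {c ≤ᵇ 0}) t
  ... | p , q = +-mono-≤ (*-monoˡ-≤ x (≤ᵇ⇒≤ c 0 p)) (⊑-sound cs [] ρ q)
  ⊑-sound (c ∷ cs) (d ∷ ds) []      t = z≤n
  ⊑-sound (c ∷ cs) (d ∷ ds) (x ∷ ρ) t with Equivalence.to (T-∧ {c ≤ᵇ d}) t
  ... | p , q = +-mono-≤ (*-monoˡ-≤ x (≤ᵇ⇒≤ c d p)) (⊑-sound cs ds ρ q)

  -- A Farkas certificate: the weighted sum of the inequalities reads P ≤ R while 1 + R ≤ P.
  -- Comparing the latter coefficient by coefficient is sound because the atoms are naturals, which
  -- also absorbs all constraints x ≥ 0.
  refutes : ℕ → List Ineq → Bool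
  refutes c is = ((1 ∷ []) ⊞ proj₂ (combine c is)) ⊑ proj₁ (combine c is)

  refute : ∀ c is ρ → T (refutes c is) → HoldAll ρ is → ⊥
  refute c is ρ t hs = <-irrefl refl (begin-strict
    dot R σ                <⟨ ≤-refl ⟩
    1 + dot R σ            ≡⟨ dot-⊞ (1 ∷ []) R σ ⟨
    dot ((1 ∷ []) ⊞ R) σ   ≤⟨ ⊑-sound ((1 ∷ []) ⊞ R) P σ t ⟩
    dot P σ                ≤⟨ combine-sound c is ρ hs ⟩
    dot R σ                ∎)
    where
    open ≤-Reasoning
    σ = 1 ∷ ρ
    P = proj₁ (combine c is)
    R = proj₂ (combine c is)

  assume : Claim → List Ineq → List Ineq
  assume (e ≼ f) is = (e , f) ∷ is
  assume (e ≺ f) is = (ς e , f) ∷ is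
  assume (e ≈ f) is = (e , f) ∷ (f , e) ∷ is
  assume ↯       is = is
  assume (h ⇒ g) is = is

  assume-sound : ∀ ρ h is → Holds ρ h → HoldAll ρ is → HoldAll ρ (assume h is)
  assume-sound ρ (e ≼ f) is p hs = p , hs
  assume-sound ρ (e ≺ f) is p hs = p , hs
  assume-sound ρ (e ≈ f) is p hs = ≤-reflexive p , ≤-reflexive (sym p) , hs
  assume-sound ρ ↯       is p hs = hs
  assume-sound ρ (h ⇒ g) is p hs = hs

  -- Two certificates because an equation is proved as two inequalities.  The
  -- multipliers belong to the negated conclusion and then to the hypotheses, the
  -- last one first.
  Valid : ℕ → ℕ → List Ineq → Claim → Bool
  Valid c d is (e ≼ f) = refutes c ((ς f , e) ∷ is)
  Valid c d is (e ≺ f) = refutes c ((f , e) ∷ is)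
  Valid c d is (e ≈ f) = refutes c ((ς f , e) ∷ is) ∧ refutes d ((ς e , f) ∷ is)
  Valid c d is ↯       = refutes c is
  Valid c d is (h ⇒ g) = Valid c d (assume h is) g

  valid-sound : ∀ c d is p ρ → T (Valid c d is p) → HoldAll ρ is → Holds ρ p
  valid-sound c d is (e ≼ f) ρ t hs = ≮⇒≥ (λ p → refute c ((ς f , e) ∷ is) ρ t (p , hs))
  valid-sound c d is (e ≺ f) ρ t hs = ≰⇒> (λ p → refute c ((f , e) ∷ is) ρ t (p , hs))
  valid-sound c d is (e ≈ f) ρ t hs
    with Equivalence.to (T-∧ {refutes c ((ς f , e) ∷ is)}) t
  ... | t₁ , t₂ = ≤-antisym (≮⇒≥ (λ p → refute c ((ς f , e) ∷ is) ρ t₁ (p , hs)))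
                            (≮⇒≥ (λ p → refute d ((ς e , f) ∷ is) ρ t₂ (p , hs)))
  valid-sound c d is ↯       ρ t hs = refute c is ρ t hs
  valid-sound c d is (h ⇒ g) ρ t hs p = valid-sound c d (assume h is) g ρ t (assume-sound ρ h is p hs)

  Schema : ℕ → Set
  Schema zero    = Claim
  Schema (suc n) = Expr → Schema n

  instantiate : ∀ n → ℕ → Schema n → Claim
  instantiate zero    i p = p
  instantiate (suc n) i f = instantiate n (suc i) (f (ν i))

  ForAll : ℕ → (Env → Set) → Set
  ForAll zero    P = P []
  ForAll (suc n) P = ∀ x → ForAll n (P ∘ (x ∷_))

  forAll : ∀ n P → (∀ ρ → P ρ) → ForAll n P
  forAll zero    P f = f []
  forAll (suc n) P f x = forAll n _ (λ ρ → f (x ∷ ρ))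

  -- On closed data the implicit argument has type `⊤` and is solved silently, so a use consists of
  -- the claim, the certificates and the values of the atoms. `d` is read only for equations.
  lin : ∀ n (f : Schema n) (c d : ℕ) → {_ : T (Valid c d [] (instantiate n 0 f))} →
    ForAll n (λ ρ → Holds ρ (instantiate n 0 f))
  lin n f c d {t} = forAll n _ (λ ρ → valid-sound c d [] (instantiate n 0 f) ρ t tt)

open LinearArithmetic using (lin; κ; ς; _⊕_; _⊛_; _≼_; _≺_; _≈_; ↯; _⇒_)

-- Adjacent transpositions, threshold heights and inversions

τ : ℕ → ℕ → ℕ
τ x y with y ≟ x
... | yes _ = suc x
... | no _ with y ≟ suc x
...   | yes _ = x
...   | no _  = y

τ-cases : ∀ x y → (y ≡ x × τ x y ≡ suc x) ⊎
  ((y ≡ suc x × τ x y ≡ x) ⊎ (y ≢ x × y ≢ suc x × τ x y ≡ y))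
τ-cases x y with y ≟ x
... | yes p = inj₁ (p , refl)
... | no p with y ≟ suc x
...   | yes q = inj₂ (inj₁ (q , refl))
...   | no q  = inj₂ (inj₂ (p , q , refl))

τ-fst : ∀ x → τ x x ≡ suc x
τ-fst x with τ-cases x x
... | inj₁ (_ , eq)                 = eq
... | inj₂ (inj₁ (p , _))           = ⊥-elim (1+n≢n (sym p))
... | inj₂ (inj₂ (p , _))           = ⊥-elim (p refl)

τ-snd : ∀ x → τ x (suc x) ≡ x
τ-snd x with τ-cases x (suc x)
... | inj₁ (p , _)                  = ⊥-elim (1+n≢n p)
... | inj₂ (inj₁ (_ , eq))          = eq
... | inj₂ (inj₂ (_ , p , _))       = ⊥-elim (p refl)

τ-other : ∀ x y → y ≢ x → y ≢ suc x → τ x y ≡ y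
τ-other x y p q with τ-cases x y
... | inj₁ (r , _)                  = ⊥-elim (p r)
... | inj₂ (inj₁ (r , _))           = ⊥-elim (q r)
... | inj₂ (inj₂ (_ , _ , eq))      = eq

τ-below : ∀ x y → y < x → τ x y ≡ y
τ-below x y p = τ-other x y (<⇒≢ p) (<⇒≢ (m≤n⇒m≤1+n p))

τ-above : ∀ x y → suc x < y → τ x y ≡ y
τ-above x y p = τ-other x y (≢-sym (<⇒≢ (<-trans (n<1+n x) p))) (≢-sym (<⇒≢ p))

τ-involutive : ∀ x y → τ x (τ x y) ≡ y
τ-involutive x y with τ-cases x y
... | inj₁ (refl , eq)              = trans (cong (τ x) eq) (τ-snd x)
... | inj₂ (inj₁ (refl , eq))       = trans (cong (τ x) eq) (τ-fst x)
... | inj₂ (inj₂ (p , q , eq))      = trans (cong (τ x) eq) eq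

𝟙 : ℕ → ℕ → ℕ
𝟙 θ v with θ ≤? v
... | yes _ = 1
... | no _  = 0

𝟙-yes : ∀ {θ v} → θ ≤ v → 𝟙 θ v ≡ 1
𝟙-yes {θ} {v} p with θ ≤? v
... | yes _ = refl
... | no q  = ⊥-elim (q p)

𝟙-no : ∀ {θ v} → v < θ → 𝟙 θ v ≡ 0
𝟙-no {θ} {v} p with θ ≤? v
... | yes q = ⊥-elim (<⇒≱ p q)
... | no _  = refl

𝟙≤1 : ∀ θ v → 𝟙 θ v ≤ 1
𝟙≤1 θ v with θ ≤? v
... | yes _ = ≤-refl
... | no _  = z≤n

height : (ℕ → ℕ) → ℕ → ℕ → ℕ
height B θ zero    = 0
height B θ (suc x) = 𝟙 θ (B x) + height B θ x

height-step : ∀ B θ x → height B θ x ≤ height B θ (suc x)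
height-step B θ x = m≤n+m _ _

height-step′ : ∀ B θ x → height B θ (suc x) ≤ suc (height B θ x)
height-step′ B θ x = +-monoˡ-≤ _ (𝟙≤1 θ (B x))

height≤ : ∀ B θ x → height B θ x ≤ x
height≤ B θ zero    = z≤n
height≤ B θ (suc x) = ≤-trans (height-step′ B θ x) (s≤s (height≤ B θ x))

height-cong : ∀ {B C} θ x → (∀ y → y < x → B y ≡ C y) → height B θ x ≡ height C θ x
height-cong θ zero    eq = refl
height-cong θ (suc x) eq =
  cong₂ _+_ (cong (𝟙 θ) (eq x ≤-refl)) (height-cong θ x (λ y p → eq y (m≤n⇒m≤1+n p)))

height-τ-below : ∀ B θ x y → y ≤ x → height (B ∘ τ x) θ y ≡ height B θ y
height-τ-below B θ x y p = height-cong θ y (λ z q → cong B (τ-below x z (<-≤-trans q p)))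

height-τ-above : ∀ B θ x d → height (B ∘ τ x) θ (d + suc (suc x)) ≡ height B θ (d + suc (suc x))
height-τ-above B θ x zero
  rewrite τ-fst x | τ-snd x | height-τ-below B θ x x ≤-refl
  = lin 3 (λ a b c → a ⊕ (b ⊕ c) ≈ b ⊕ (a ⊕ c)) 1 1 (𝟙 θ (B x)) (𝟙 θ (B (suc x))) (height B θ x)
height-τ-above B θ x (suc d) =
  cong₂ _+_ (cong (𝟙 θ ∘ B) (τ-above x (d + suc (suc x)) (m≤n+m _ d))) (height-τ-above B θ x d)

height-τ : ∀ B θ x y → y ≢ suc x → height (B ∘ τ x) θ y ≡ height B θ y
height-τ B θ x y p with y ≤? x
... | yes q = height-τ-below B θ x y q
... | no q  = subst (λ z → height (B ∘ τ x) θ z ≡ height B θ z) (m∸n+n≡m 2+x≤y)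
                (height-τ-above B θ x (y ∸ suc (suc x)))
  where
  2+x≤y : suc (suc x) ≤ y
  2+x≤y = ≤∧≢⇒< (≰⇒> q) (≢-sym p)

height-sorted : ∀ B θ x → B (suc x) ≤ B x →
  height B θ (suc x) ≡ suc (height B θ x) ⊎ height B θ (suc (suc x)) ≡ height B θ (suc x)
height-sorted B θ x p with θ ≤? B x
... | yes q = inj₁ refl
... | no q  = inj₂ (cong (_+ height B θ x) (𝟙-no (≤-<-trans p (≰⇒> q))))

height-id : ∀ θ x → height (λ y → y) θ x ≡ x ∸ θ
height-id θ zero = sym (0∸n≡0 θ)
height-id θ (suc x) with θ ≤? x
... | yes p = trans (cong suc (height-id θ x)) (sym (+-∸-assoc 1 p))
... | no p  = trans (height-id θ x) (trans (m≤n⇒m∸n≡0 (<⇒≤ (≰⇒> p))) (sym (m≤n⇒m∸n≡0 (≰⇒> p))))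

height-full : ∀ {B θ} x → (∀ y → y < x → θ ≤ B y) → height B θ x ≡ x
height-full zero    all = refl
height-full (suc x) all =
  cong₂ _+_ (𝟙-yes (all x ≤-refl)) (height-full x (λ y p → all y (m≤n⇒m≤1+n p)))

height-full⁻¹ : ∀ B θ x → suc x ≤ height B θ (suc x) → θ ≤ B x
height-full⁻¹ B θ x p with θ ≤? B x
... | yes q = q
... | no q  = ⊥-elim (<⇒≱ p (height≤ B θ x))

inversions : (ℕ → ℕ) → ℕ → ℕ
inversions B zero    = 0
inversions B (suc x) = height B (suc (B x)) x + inversions B x

inversions-cong : ∀ {B C} x → (∀ y → y < x → B y ≡ C y) → inversions B x ≡ inversions C x
inversions-cong zero eq = refl
inversions-cong {B} {C} (suc x) eq = cong₂ _+_
  (trans (cong (λ θ → height B (suc θ) x) (eq x ≤-refl)) (height-cong (suc (C x)) x eq′))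
  (inversions-cong x eq′)
  where
  eq′ : ∀ y → y < x → B y ≡ C y
  eq′ y p = eq y (m≤n⇒m≤1+n p)

inversions-τ-above : ∀ B x d → B x < B (suc x) →
  inversions (B ∘ τ x) (d + suc (suc x)) ≡ suc (inversions B (d + suc (suc x)))
inversions-τ-above B x zero p
  rewrite τ-fst x | τ-snd x
        | height-τ-below B (suc (B x)) x x ≤-refl
        | height-τ-below B (suc (B (suc x))) x x ≤-refl
        | 𝟙-yes p | 𝟙-no {suc (B (suc x))} {B x} (m≤n⇒m≤1+n p)
        | inversions-cong {B ∘ τ x} {B} x (λ y q → cong B (τ-below x y q))
  = lin 3 (λ a b c → ς (a ⊕ (b ⊕ c)) ≈ ς (b ⊕ (a ⊕ c))) 1 1 (height B (suc (B x)) x) (height B (suc (B (suc x)))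
    x) (inversions B x)
inversions-τ-above B x (suc d) p
  rewrite τ-above x (d + suc (suc x)) (m≤n+m _ d)
        | height-τ-above B (suc (B (d + suc (suc x)))) x d
        | inversions-τ-above B x d p
  = +-suc _ _

inversions-τ : ∀ B x y → suc x < y → B x < B (suc x) → inversions (B ∘ τ x) y ≡ suc (inversions B y)
inversions-τ B x y p q = subst (λ z → inversions (B ∘ τ x) z ≡ suc (inversions B z)) (m∸n+n≡m p)
  (inversions-τ-above B x (y ∸ suc (suc x)) q)

inversions-id : ∀ x → inversions (λ y → y) x ≡ 0
inversions-id zero    = refl
inversions-id (suc x) = cong₂ _+_ (trans (height-id (suc x) x) (m≤n⇒m∸n≡0 (n≤1+n x))) (inversions-id x)

inversions-reversed : ∀ {B} x → (∀ y z → y < z → z < x → B z < B y) →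
  inversions B x + inversions B x + x ≡ x * x
inversions-reversed zero dec = refl
inversions-reversed {B} (suc x) dec
  rewrite height-full {B} {suc (B x)} x (λ y p → dec y x p ≤-refl) | *-suc x x
  = lin 3 (λ a b c → a ⊕ a ⊕ b ≈ c ⇒ b ⊕ a ⊕ (b ⊕ a) ⊕ ς b ≈ ς (b ⊕ (b ⊕ c))) 11 101 _ _ _
    (inversions-reversed {B} x (λ y z p q → dec y z p (m≤n⇒m≤1+n q)))

-- Staircases and the two estimates between heights and chains

record IsHeight (N θ : ℕ) (h : ℕ → ℕ) : Set where
  field
    zero-at-0 : h 0 ≡ 0
    mono      : ∀ x → h x ≤ h (suc x)
    lipschitz : ∀ x → h (suc x) ≤ suc (h x)
    total     : h N + θ ≡ N

lipschitz-upto : ∀ {N θ h} → IsHeight N θ h → ∀ x d → h (d + x) ≤ d + h x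
lipschitz-upto ish x zero    = ≤-refl
lipschitz-upto ish x (suc d) = ≤-trans (IsHeight.lipschitz ish (d + x)) (s≤s (lipschitz-upto ish x d))

-- Going back from N, where the height is N - θ, to x loses at most N - x.
≤height+θ : ∀ {N θ h} → IsHeight N θ h → ∀ x → x ≤ N → x ≤ h x + θ
≤height+θ {N} {θ} {h} ish x x≤N =
  lin 6 (λ a b c d e f → a ≼ b ⊕ c ⇒ a ⊕ d ≈ e ⇒ b ⊕ f ≈ e ⇒ f ≼ c ⊕ d) 110011 0 _ _ _ _ _ _
    (subst (λ z → h z ≤ N ∸ x + h x) (m∸n+n≡m x≤N) (lipschitz-upto ish x (N ∸ x))) (IsHeight.total ish)
    (m∸n+n≡m x≤N)

-- At boundary x the frontier of processed letters is the lattice point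
-- (F x , F x + k + x); a letter at boundary suc y is available when that point
-- is a corner of the staircase.
Corner : ℕ → (ℕ → ℕ) → ℕ → Set
Corner N F y = (suc (suc y) < N → F (suc (suc y)) ≡ F (suc y)) × (0 < y → F y ≡ suc (F (suc y)))

record Bump (y : ℕ) (F F′ : ℕ → ℕ) : Set where
  field
    here  : F′ (suc y) ≡ suc (F (suc y))
    other : ∀ x → x ≢ suc y → F′ x ≡ F x

-- For the points (a , b) = (F x , F x + k + x) this says that a step to the next boundary either
-- raises b by one or lowers a by one.
record Staircase (N : ℕ) (F : ℕ → ℕ) : Set where
  field
    down  : ∀ x → 0 < x → suc x < N → F (suc x) ≤ F x
    gentle : ∀ x → 0 < x → suc x < N → F x ≤ suc (F (suc x))

staircase-after : ∀ {N F} → Staircase N F → ∀ d x → 0 < x → d + x < N → F (d + x) ≤ F x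
staircase-after st zero    x p q = ≤-refl
staircase-after st (suc d) x p q =
  ≤-trans (Staircase.down st (d + x) (≤-trans p (m≤n+m x d)) q) (staircase-after st d x p (<-trans (n<1+n _) q))

staircase-before : ∀ {N F} → Staircase N F → ∀ d x → 0 < x → d + x < N → F x + x ≤ F (d + x) + (d + x)
staircase-before st zero    x p q = ≤-refl
staircase-before {F = F} st (suc d) x p q =
  lin 5 (λ a b c d e → a ⊕ b ≼ c ⊕ (d ⊕ b) ⇒ c ≼ ς e ⇒ a ⊕ b ≼ e ⊕ (ς d ⊕ b)) 111 0 (F x) x _ d _
    (staircase-before st d x p (<-trans (n<1+n _) q)) (Staircase.gentle st (d + x) (≤-trans p (m≤n+m x d)) q)

-- On the staircase b is at most β before θ, and a is at most α from θ on. So b - β never exceeds x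
-- ∸ θ, and at the start only the empty chain has to be explained.
height-initial-≤ : ∀ {N F} → Staircase N F → ∀ k θ x r → 0 < x → x < N → 0 < θ → θ < N →
  (x ∸ θ) + r + (F θ + k + θ) ≤ F x + k + x → r ≡ 0
height-initial-≤ {N} {F} st k θ x r 0<x x<N 0<θ θ<N p with θ ≤? x
... | yes q =
  let eq = m∸n+n≡m q in
  lin 7 (λ a b c d e f g → a ≼ b ⇒ c ⊕ d ⊕ (b ⊕ e ⊕ f) ≼ a ⊕ e ⊕ g ⇒ c ⊕ f ≈ g ⇒ d ≈ κ 0) 11101 1 _ _ (x ∸ θ) _
    _ θ _ (subst (λ z → F z ≤ F θ) eq (staircase-after st (x ∸ θ) θ 0<θ (subst (_< N) (sym eq) x<N))) p eq
... | no q =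
  let eq = m∸n+n≡m (<⇒≤ (≰⇒> q)) in
  lin 7 (λ a b c d e f g → a ⊕ b ≼ c ⊕ d ⇒ e ⊕ f ⊕ (c ⊕ g ⊕ d) ≼ a ⊕ g ⊕ b ⇒ f ≈ κ 0) 111 1 (F x) x (F θ) θ
    (x ∸ θ) _ k (subst (λ z → F x + x ≤ F z + z) eq (staircase-before st (θ ∸ x) x 0<x
    (subst (_< N) (sym eq) θ<N))) p

module LowerBound (N k θ α β K : ℕ) (ga gb : ℕ → ℕ) where

  record IsChain : Set where
    field
      tip    : β ≡ α + k + θ
      start₁ : ga 0 ≡ α
      start₂ : gb 0 ≡ β
      inc₁   : ∀ r → r < K → ga r < ga (suc r)
      inc₂   : ∀ r → r < K → gb r < gb (suc r)

  ga≥ : IsChain → ∀ r → r ≤ K → α + r ≤ ga r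
  ga≥ ch zero    p = lin 2 (λ a b → a ≈ b ⇒ b ⊕ κ 0 ≼ a) 101 0 _ _ (IsChain.start₁ ch)
  ga≥ ch (suc r) p = lin 4 (λ a b c d → a ⊕ b ≼ c ⇒ c ≺ d ⇒ a ⊕ ς b ≼ d) 111 0 _ _ _ _ (ga≥ ch r (<⇒≤ p))
    (IsChain.inc₁ ch r p)

  gb≥ : IsChain → ∀ r → r ≤ K → β + r ≤ gb r
  gb≥ ch zero    p = lin 2 (λ a b → a ≈ b ⇒ b ⊕ κ 0 ≼ a) 101 0 _ _ (IsChain.start₂ ch)
  gb≥ ch (suc r) p = lin 4 (λ a b c d → a ⊕ b ≼ c ⇒ c ≺ d ⇒ a ⊕ ς b ≼ d) 111 0 _ _ _ _ (gb≥ ch r (<⇒≤ p))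
    (IsChain.inc₂ ch r p)

  -- For one fixed chain: b - β - h x is at least the number of chain points that fit below the
  -- frontier point. Written additively to avoid truncated subtraction.
  Delayed : (ℕ → ℕ) → (ℕ → ℕ) → Set
  Delayed F h = ∀ x r → 0 < x → x < N → r ≤ K →
    ga r ≤ F x → gb r ≤ F x + k + x → h x + r + β ≤ F x + k + x

  delayed-initial : IsChain → ∀ {F h} → Staircase N F → F θ ≡ α → 0 < θ → θ < N →
    (∀ x → h x ≡ x ∸ θ) → Delayed F h
  delayed-initial ch {F} {h} st Fθ 0<θ θ<N hyp x r 0<x x<N r≤K p q with θ ≤? x
  ... | yes θ≤x =
    let eq = m∸n+n≡m θ≤x in
    lin 10 (λ a b c d e f g h i j → a ≼ b ⇒ c ≈ d ⇒ e ⊕ f ≼ a ⇒ g ≈ e ⊕ h ⊕ i ⇒ d ⊕ i ≈ j ⇒ c ⊕ f ⊕ g ≼ b ⊕ h ⊕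
      j) 101101011 0 _ _ _ _ _ _ _ _ _ _ p (hyp x) (ga≥ ch r r≤K) (IsChain.tip ch) eq
  ... | no θ≰x =
    let eq = m∸n+n≡m (<⇒≤ (≰⇒> θ≰x)) in
    lin 8 (λ a b c d e f g h → a ≼ b ⊕ c ⊕ d ⇒ e ≈ f ⇒ f ≈ κ 0 ⇒ g ⊕ h ≼ a ⇒ e ⊕ h ⊕ g ≼ b ⊕ c ⊕ d) 1010111 0 _
      (F x) k x _ _ _ _ q (hyp x) (m≤n⇒m∸n≡0 (<⇒≤ (≰⇒> θ≰x))) (gb≥ ch r r≤K)

  delayed-step : IsChain → ∀ {y F F′ h h′} → suc y < N → Corner N F y → Bump y F F′ →
    IsHeight N θ h′ → (∀ x → x ≢ suc y → h′ x ≡ h x) → α ≤ F θ →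
    h′ (suc y) ≡ h (suc y) ⊎
      (∀ r → r < K → ga (suc r) ≡ suc (F (suc y)) → gb (suc r) ≡ suc (F (suc y)) + k + suc y → ⊥) →
    Delayed F h → Delayed F′ h′
  delayed-step ch {y} {F} {F′} {h} {h′} y<N (c₁ , c₂) bump ish off αFθ blocked del x r 0<x x<N r≤K p q
    with x ≟ suc y
  ... | no x≢ = lin 8 (λ a b c d e f g h → a ⊕ b ⊕ c ≼ d ⊕ e ⊕ f ⇒ g ≈ a ⇒ h ≈ d ⇒ g ⊕ b ⊕ c ≼ h ⊕ e ⊕ f) 101101
    0 _ _ _ _ _ _ _ _ (del x r 0<x x<N r≤K (≤-trans p (≤-reflexive eq)) (subst (λ z → gb r ≤ z + k + x) eq q))
    (off x x≢) eq
    where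
    eq : F′ x ≡ F x
    eq = Bump.other bump x x≢
  ... | yes refl = go
    where
    here = Bump.here bump
    open IsHeight ish
    go : h′ (suc y) + r + β ≤ F′ (suc y) + k + suc y
    go with ga r ≤? F (suc y)
    go | yes p′ with suc (suc y) <? N
    ... | yes y₂<N =
      lin 10 (λ a b c d e f g h i j → a ⊕ b ⊕ c ≼ d ⊕ e ⊕ ς (ς f) ⇒ d ≈ g ⇒ h ≈ ς g ⇒ i ≼ j ⇒ j ≈ a ⇒
        i ⊕ b ⊕ c ≼ h ⊕ e ⊕ ς f) 101101011 0 _ _ _ _ _ _ _ _ _ _ (del (suc (suc y)) r (s≤s z≤n) y₂<N r≤K
        (≤-trans p′ (≤-reflexive (sym (c₁ y₂<N)))) (lin 6 (λ a b c d e f → a ≼ b ⊕ c ⊕ ς d ⇒ b ≈ ς e ⇒ f ≈ e ⇒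
        a ≼ f ⊕ c ⊕ ς (ς d)) 101101 0 _ _ _ _ _ _ q here (c₁ y₂<N))) (c₁ y₂<N) here (mono (suc y))
        (off (suc (suc y)) 1+n≢n)
    -- Boundary N carries no frontier point. There the total N - θ and α + r ≤ `ga r` replace the
    -- induction hypothesis.
    ... | no y₂≮N =
      lin 12 (λ a b c d e f g h i j k l → a ⊕ b ≼ c ⇒ c ≼ d ⇒ e ≈ ς d ⇒ f ≈ a ⊕ g ⊕ h ⇒ i ⊕ h ≈ j ⇒ k ≼ i ⇒
        j ≼ ς (ς l) ⇒ k ⊕ b ⊕ f ≼ e ⊕ g ⊕ ς l) 11100101111 0 _ _ _ _ _ _ _ _ _ _ _ _ (ga≥ ch r r≤K) p′ here
        (IsChain.tip ch) total (subst (λ z → h′ (suc y) ≤ h′ z) (≤-antisym y<N (≮⇒≥ y₂≮N)) (mono (suc y)))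
        (≮⇒≥ y₂≮N)
    go | no p′ with gb r ≤? F (suc y) + k + suc y
    go | no p′ | yes q′ with 0 <? y
    ... | yes 0<y =
      lin 10 (λ a b c d e f g h i j → a ⊕ b ⊕ c ≼ d ⊕ e ⊕ f ⇒ d ≈ ς g ⇒ h ≈ ς g ⇒ i ≼ ς j ⇒ j ≈ a ⇒ i ⊕ b ⊕ c ≼
        h ⊕ e ⊕ ς f) 101101011 0 _ _ _ _ _ _ _ _ _ _ (del y r 0<y (<-trans (n<1+n y) y<N) r≤K
        (lin 4 (λ a b c d → a ≼ b ⇒ b ≈ ς c ⇒ d ≈ ς c ⇒ a ≼ d) 101101 0 _ _ _ _ p here (c₂ 0<y))
        (lin 5 (λ a b c d e → a ≼ b ⊕ c ⊕ ς d ⇒ e ≈ ς b ⇒ a ≼ e ⊕ c ⊕ d) 1101 0 _ _ _ _ _ q′ (c₂ 0<y))) (c₂ 0<y)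
        here (lipschitz y) (off y (≢-sym 1+n≢n))
    ... | no 0≮y with n≤0⇒n≡0 (≮⇒≥ 0≮y)
    ...   | refl = lin 8 (λ a b c d e f g h → a ⊕ b ≼ c ⇒ c ≼ d ⊕ e ⊕ ς (κ 0) ⇒ f ≈ ς d ⇒ g ≼ ς h ⇒ h ≈ κ 0 ⇒
      g ⊕ b ⊕ a ≼ f ⊕ e ⊕ ς (κ 0)) 11101011 0 _ _ _ _ _ _ _ _ (gb≥ ch r r≤K) q′ here (lipschitz 0) zero-at-0
    go | no p′ | no q′ = reached r r≤K (lin 3 (λ a b c → a ≼ b ⇒ c ≺ a ⇒ b ≈ ς c ⇒ a ≈ ς c) 10011 1001 _ _ _ p
      (≰⇒> p′) here) (lin 5 (λ a b c d e → a ≼ b ⊕ c ⊕ ς d ⇒ e ⊕ c ⊕ ς d ≺ a ⇒ b ≈ ς e ⇒ a ≈ ς e ⊕ c ⊕ ς d)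
      10011 1001 _ _ _ _ _ q (≰⇒> q′) here) blocked
      where
      reached : ∀ r → r ≤ K → ga r ≡ suc (F (suc y)) → gb r ≡ suc (F (suc y)) + k + suc y →
        h′ (suc y) ≡ h (suc y) ⊎
          (∀ r → r < K → ga (suc r) ≡ suc (F (suc y)) → gb (suc r) ≡ suc (F (suc y)) + k + suc y → ⊥) →
        h′ (suc y) + r + β ≤ F′ (suc y) + k + suc y
      -- The origin (α , β) of the chain lies over boundary θ, where the frontier is already at α or
      -- beyond, so it cannot be a new corner.
      reached zero r≤K e₁ e₂ b =
        ⊥-elim (lin 3 (λ a b c → a ≼ b ⇒ c ≈ ς b ⇒ c ≈ a ⇒ ↯) 11001 0 _ _ _ (subst (λ z → α ≤ F z) θ≡ αFθ) e₁
          (IsChain.start₁ ch))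
        where
        θ≡ : θ ≡ suc y
        θ≡ = lin 8 (λ a b c d e f g h → a ≈ ς b ⇒ c ≈ ς b ⊕ d ⊕ ς e ⇒ a ≈ f ⇒ c ≈ g ⇒ g ≈ f ⊕ d ⊕ h ⇒ h ≈ ς e)
          10010110101 1101001011 _ _ _ _ _ _ _ _ e₁ e₂ (IsChain.start₁ ch) (IsChain.start₂ ch) (IsChain.tip ch)
      reached (suc r) r<K e₁ e₂ (inj₂ b) = ⊥-elim (b r r<K e₁ e₂)
      reached (suc r) r<K e₁ e₂ (inj₁ b) =
        lin 8 (λ a b c d e f g h → a ⊕ b ⊕ c ≼ d ⊕ e ⊕ ς f ⇒ g ≈ a ⇒ h ≈ ς d ⇒ g ⊕ ς b ⊕ c ≼ h ⊕ e ⊕ ς f) 101101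
          0 _ _ _ _ _ _ _ _ (del (suc y) r (s≤s z≤n) y<N (<⇒≤ r<K) (lin 3 (λ a b c → a ≺ b ⇒ b ≈ ς c ⇒ a ≼ c)
          1011 0 _ _ _ (IsChain.inc₁ ch r r<K) e₁) (lin 5 (λ a b c d e → a ≺ b ⇒ b ≈ ς c ⊕ d ⊕ ς e ⇒ a ≼ c ⊕ d ⊕
          ς e) 1011 0 _ _ (F (suc y)) k _ (IsChain.inc₂ ch r r<K) e₂)) b here

module UpperBound (N k θ α β K : ℕ) (Mark : ℕ → ℕ → Set) where

  data Chain : ℕ → ℕ → ℕ → Set where
    none : ∀ {a b} → Chain 0 a b
    snoc : ∀ {r a b} a′ b′ → suc a′ ≤ a → suc b′ ≤ b → Mark (suc a′) (suc b′) →
           α ≤ a′ → β ≤ b′ → Chain r a′ b′ → Chain (suc r) a b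

  weaken : ∀ {r a b a′ b′} → Chain r a b → a ≤ a′ → b ≤ b′ → Chain r a′ b′
  weaken none p q = none
  weaken (snoc a b s t mk u v ch) p q = snoc a b (≤-trans s p) (≤-trans t q) mk u v ch

  -- The side conditions keep the trace away from the two ends of the array,
  -- where a full height does not come from marked points.
  Explained : (ℕ → ℕ) → (ℕ → ℕ) → Set
  Explained F h = ∀ x r s → 0 < x → x < N → r + s ≡ K →
    F x + s ≤ β → F x + k + x + s ≤ α + N + k + k →
    h x + r + β ≤ F x + k + x → Chain r (F x) (F x + k + x)

  explained-initial : ∀ {F h} → Staircase N F → F θ ≡ α → β ≡ α + k + θ → 0 < θ → θ < N →
    (∀ x → h x ≡ x ∸ θ) → Explained F h
  explained-initial {F} {h} st Fθ tip 0<θ θ<N hyp x r s 0<x x<N eq p q t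
    with height-initial-≤ st k θ x r 0<x x<N 0<θ θ<N (lin 10 (λ a b c d e f g h i j → a ⊕ b ⊕ c ≼ d ⊕ e ⊕ f ⇒
      a ≈ g ⇒ c ≈ h ⊕ e ⊕ i ⇒ j ≈ h ⇒ g ⊕ b ⊕ (j ⊕ e ⊕ i) ≼ d ⊕ e ⊕ f) 11010011 0 _ _ _ (F x) _ x _ _ _ _ t
      (hyp x) tip Fθ)
  ... | refl = none

  -- The argument `how` names the term of the recursion that is attained: the old corner plus its
  -- mark, or, when the two labels are in descending order, one of the neighbours, whose chain is
  -- then reused by `weaken`.
  explained-step : β ≡ α + k + θ → K ≡ suc k → ∀ {y F F′ h h′} → suc y < N → Corner N F y → Bump y F F′ →
    IsHeight N θ h′ → (∀ x → x ≢ suc y → h′ x ≡ h x) →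
    (h′ (suc y) ≡ h (suc y) × Mark (suc (F (suc y))) (suc (F (suc y)) + k + suc y)) ⊎
      (h′ (suc y) ≡ suc (h′ y) ⊎ h′ (suc (suc y)) ≡ h′ (suc y)) →
    Explained F h → Explained F′ h′
  explained-step tip K≡ {y} {F} {F′} {h} {h′} y<N (c₁ , c₂) bump ish off how ex x r s 0<x x<N r+s p q t
    with x ≟ suc y
  ... | no x≢ = subst (λ z → Chain r z (z + k + x)) (sym eq)
        (ex x r s 0<x x<N r+s (lin 4 (λ a b c d → a ⊕ b ≼ c ⇒ a ≈ d ⇒ d ⊕ b ≼ c) 1101 0 _ _ _ _ p eq)
          (lin 7 (λ a b c d e f g → a ⊕ b ⊕ c ⊕ d ≼ e ⊕ f ⊕ b ⊕ b ⇒ a ≈ g ⇒ g ⊕ b ⊕ c ⊕ d ≼ e ⊕ f ⊕ b ⊕ b) 1101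
          0 _ _ _ _ α N _ q eq) (lin 8 (λ a b c d e f g h → a ⊕ b ⊕ c ≼ d ⊕ e ⊕ f ⇒ d ≈ g ⇒ a ≈ h ⇒ h ⊕ b ⊕ c ≼
          g ⊕ e ⊕ f) 101101 0 _ _ _ _ _ _ _ _ t eq (off x x≢)))
    where
    eq : F′ x ≡ F x
    eq = Bump.other bump x x≢
  ... | yes refl = go how
    where
    here = Bump.here bump
    open IsHeight ish
    go : (h′ (suc y) ≡ h (suc y) × Mark (suc (F (suc y))) (suc (F (suc y)) + k + suc y)) ⊎
      (h′ (suc y) ≡ suc (h′ y) ⊎ h′ (suc (suc y)) ≡ h′ (suc y)) → Chain r (F′ (suc y)) (F′ (suc y) + k + suc y)
    go (inj₁ (same , mk)) = marked r r+s t
      where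
      marked : ∀ r → r + s ≡ K → h′ (suc y) + r + β ≤ F′ (suc y) + k + suc y →
        Chain r (F′ (suc y)) (F′ (suc y) + k + suc y)
      marked zero    eq t′ = none
      marked (suc r) eq t′ = snoc (F (suc y)) (F (suc y) + k + suc y)
        (lin 2 (λ a b → a ≈ ς b ⇒ b ≺ a) 101 0 _ _ here) (lin 4 (λ a b c d → a ≈ ς b ⇒ b ⊕ c ⊕ ς d ≺ a ⊕ c ⊕ ς
          d) 101 0 _ _ _ _ here) mk
        (lin 9 (λ a b c d e f g h i → a ⊕ ς b ⊕ c ≼ d ⊕ e ⊕ ς f ⇒ d ≈ ς g ⇒ c ≈ h ⊕ e ⊕ i ⇒ f ≺ a ⊕ i ⇒ h ≼ g)
          1011011 0 _ _ _ _ _ _ _ _ _ t′ here tip (≤height+θ ish (suc y) (<⇒≤ y<N)))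
        (lin 7 (λ a b c d e f g → a ⊕ ς b ⊕ c ≼ d ⊕ e ⊕ ς f ⇒ d ≈ ς g ⇒ c ≼ g ⊕ e ⊕ ς f) 1011 0 _ _ _ _ _ _ _ t′
          here)
        -- The chain loses a point and both coordinates drop by one; raising the slack `s` by one
        -- keeps the two side conditions intact.
        (ex (suc y) r (suc s) (s≤s z≤n) y<N (trans (+-suc r s) eq)
          (lin 4 (λ a b c d → a ⊕ b ≼ c ⇒ a ≈ ς d ⇒ d ⊕ ς b ≼ c) 1101 0 _ _ _ _ p here)
            (lin 7 (λ a b c d e f g → a ⊕ b ⊕ ς c ⊕ d ≼ e ⊕ f ⊕ b ⊕ b ⇒ a ≈ ς g ⇒ g ⊕ b ⊕ ς c ⊕ ς d ≼ e ⊕ f ⊕ b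
            ⊕ b) 1101 0 _ _ _ _ α N _ q here) (lin 8 (λ a b c d e f g h → a ⊕ ς b ⊕ c ≼ d ⊕ e ⊕ ς f ⇒ a ≈ g ⇒
            d ≈ ς h ⇒ g ⊕ b ⊕ c ≼ h ⊕ e ⊕ ς f) 110011 0 _ _ _ _ _ _ _ _ t′ same here))
    go (inj₂ (inj₁ eq)) with 0 <? y
    ... | yes 0<y =
      weaken
        (ex y r s 0<y (<-trans (n<1+n y) y<N) r+s
          (lin 5 (λ a b c d e → a ⊕ b ≼ c ⇒ d ≈ ς e ⇒ a ≈ ς e ⇒ d ⊕ b ≼ c) 101101 0 _ _ _ _ _ p (c₂ 0<y) here)
            (lin 8 (λ a b c d e f g h → a ⊕ b ⊕ ς c ⊕ d ≼ e ⊕ f ⊕ b ⊕ b ⇒ g ≈ ς h ⇒ a ≈ ς h ⇒ g ⊕ b ⊕ c ⊕ d ≼ e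
            ⊕ f ⊕ b ⊕ b) 101101 0 _ _ _ _ α N _ _ q (c₂ 0<y) here)
          (lin 10 (λ a b c d e f g h i j → a ⊕ b ⊕ c ≼ d ⊕ e ⊕ ς f ⇒ a ≈ ς g ⇒ g ≈ h ⇒ i ≈ ς j ⇒ d ≈ ς j ⇒
            h ⊕ b ⊕ c ≼ i ⊕ e ⊕ f) 1101010011 0 _ _ _ _ _ _ _ _ _ _ t eq (off y (≢-sym 1+n≢n)) (c₂ 0<y) here))
        (lin 3 (λ a b c → a ≈ ς b ⇒ c ≈ ς b ⇒ a ≼ c) 1101 0 _ _ _ (c₂ 0<y) here)
          (lin 5 (λ a b c d e → a ≈ ς b ⇒ c ≈ ς b ⇒ a ⊕ d ⊕ e ≼ c ⊕ d ⊕ ς e) 1101 0 _ _ _ _ _ (c₂ 0<y) here)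
    ... | no 0≮y with n≤0⇒n≡0 (≮⇒≥ 0≮y)
    -- At boundary 1 the left neighbour is the end of the array. The side condition on a then forces
    -- r + s ≤ k, against r + s = k + 1.
    ...   | refl = ⊥-elim (lin 8 (λ a b c d e f g h → a ⊕ b ⊕ c ≼ d ⊕ e ⊕ ς (κ 0) ⇒ a ≈ ς f ⇒ d ⊕ g ≼ c ⇒
      b ⊕ g ≈ h ⇒ h ≈ ς e ⇒ ↯) 11011010 0 _ _ _ _ _ _ _ _ t eq p r+s K≡)
    go (inj₂ (inj₂ eq)) with suc (suc y) <? N
    ... | yes y₂<N =
      weaken
        (ex (suc (suc y)) r s (s≤s z≤n) y₂<N r+s
          (lin 5 (λ a b c d e → a ⊕ b ≼ c ⇒ d ≈ e ⇒ a ≈ ς e ⇒ d ⊕ b ≼ c) 101101 0 _ _ _ _ _ p (c₁ y₂<N) here)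
            (lin 8 (λ a b c d e f g h → a ⊕ b ⊕ ς c ⊕ d ≼ e ⊕ f ⊕ b ⊕ b ⇒ g ≈ h ⇒ a ≈ ς h ⇒ g ⊕ b ⊕ ς (ς c) ⊕ d
            ≼ e ⊕ f ⊕ b ⊕ b) 101101 0 _ _ _ _ α N _ _ q (c₁ y₂<N) here)
          (lin 10 (λ a b c d e f g h i j → a ⊕ b ⊕ c ≼ d ⊕ e ⊕ ς f ⇒ g ≈ a ⇒ g ≈ h ⇒ i ≈ j ⇒ d ≈ ς j ⇒
            h ⊕ b ⊕ c ≼ i ⊕ e ⊕ ς (ς f)) 1011010011 0 _ _ _ _ _ _ _ _ _ _ t eq (off (suc (suc y)) 1+n≢n)
            (c₁ y₂<N) here))
        (lin 3 (λ a b c → a ≈ b ⇒ c ≈ ς b ⇒ a ≼ c) 1101 0 _ _ _ (c₁ y₂<N) here)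
          (lin 5 (λ a b c d e → a ≈ b ⇒ c ≈ ς b ⇒ a ⊕ d ⊕ ς (ς e) ≼ c ⊕ d ⊕ ς e) 1101 0 _ _ _ _ _ (c₁ y₂<N)
          here)
    -- The other end of the array: the total N - θ and the side condition on b again give r + s ≤ k.
    ... | no y₂≮N = ⊥-elim (lin 12 (λ a b c d e f g h i j k l → a ⊕ b ⊕ c ≼ d ⊕ e ⊕ ς f ⇒ g ≈ a ⇒
      g ⊕ h ≈ ς (ς f) ⇒ d ⊕ e ⊕ ς f ⊕ i ≼ j ⊕ k ⊕ e ⊕ e ⇒ b ⊕ i ≈ l ⇒ l ≈ ς e ⇒ c ≈ j ⊕ e ⊕ h ⇒ k ≼ ς (ς f) ⇒ ↯)
      1011011010101 0 _ _ _ _ _ _ _ _ _ _ _ _ t eq (subst (λ z → h′ z + θ ≡ z) (sym (≤-antisym y<N (≮⇒≥ y₂≮N)))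
      total) q r+s K≡ tip (≮⇒≥ y₂≮N))

-- Type B as antisymmetric arrays: length, sorting, the longest element

τ-comm : ∀ {a b} → suc a < b → ∀ y → τ a (τ b y) ≡ τ b (τ a y)
τ-comm {a} {b} p y with y ≤? suc a
... | yes q = trans (cong (τ a) (τ-below b y (≤-<-trans q p))) (sym (τ-below b (τ a y) (≤-<-trans τ≤ p)))
  where
  τ≤ : τ a y ≤ suc a
  τ≤ with τ-cases a y
  ... | inj₁ (_ , eq)             = ≤-reflexive eq
  ... | inj₂ (inj₁ (_ , eq))      = lin 2 (λ a b → a ≈ b ⇒ a ≼ ς b) 11 0 _ _ eq
  ... | inj₂ (inj₂ (_ , _ , eq))  = lin 3 (λ a b c → a ≈ b ⇒ b ≼ ς c ⇒ a ≼ ς c) 111 0 _ _ _ eq q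
... | no q = trans (τ-above a (τ b y) τ>) (sym (cong (τ b) (τ-above a y (≰⇒> q))))
  where
  τ> : suc a < τ b y
  τ> with τ-cases b y
  ... | inj₁ (_ , eq)             = lin 3 (λ a b c → a ≈ ς b ⇒ ς c ≺ b ⇒ ς c ≺ a) 1011 0 _ _ _ eq p
  ... | inj₂ (inj₁ (_ , eq))      = lin 3 (λ a b c → a ≈ b ⇒ ς c ≺ b ⇒ ς c ≺ a) 1011 0 _ _ _ eq p
  ... | inj₂ (inj₂ (_ , _ , eq))  = lin 3 (λ a b c → a ≈ b ⇒ ς c ≺ b ⇒ ς c ≺ a) 1011 0 _ _ _ eq (≰⇒> q)

-- The reflection y ↦ M - 1 - y exchanges the pairs {a , a + 1} and {a′ , a′ + 1} and reverses their
-- order; the mixed cases are impossible.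
τ-mirror : ∀ {M a a′} → suc (suc (a + a′)) ≡ M → ∀ y y′ → suc (y + y′) ≡ M → suc (τ a y + τ a′ y′) ≡ M
τ-mirror {M} {a} {a′} p y y′ q with τ-cases a y | τ-cases a′ y′
... | inj₁ (r , eq)            | inj₁ (s , eq′)            = ⊥-elim (lin 5 (λ a b c d e → ς (ς (a ⊕ b)) ≈ c ⇒
  ς (d ⊕ e) ≈ c ⇒ d ≈ a ⇒ e ≈ b ⇒ ↯) 1100101 0 _ _ _ _ _ p q r s)
... | inj₁ (r , eq)            | inj₂ (inj₁ (s , eq′))     = lin 5 (λ a b c d e → a ≈ ς b ⇒ c ≈ d ⇒
  ς (ς (b ⊕ d)) ≈ e ⇒ ς (a ⊕ c) ≈ e) 101011 1010101 _ _ _ _ _ eq eq′ p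
... | inj₁ (r , eq)            | inj₂ (inj₂ (_ , s , eq′)) = ⊥-elim
  (s (lin 5 (λ a b c d e → ς (ς (a ⊕ b)) ≈ c ⇒ ς (d ⊕ e) ≈ c ⇒ d ≈ a ⇒ e ≈ ς b) 1001101 110011 _ _ _ _ _ p q r))
... | inj₂ (inj₁ (r , eq))     | inj₁ (s , eq′)            = lin 5 (λ a b c d e → a ≈ b ⇒ c ≈ ς d ⇒
  ς (ς (b ⊕ d)) ≈ e ⇒ ς (a ⊕ c) ≈ e) 101011 1010101 _ _ _ _ _ eq eq′ p
... | inj₂ (inj₁ (r , eq))     | inj₂ (inj₁ (s , eq′))     = ⊥-elim (lin 5 (λ a b c d e → ς (ς (a ⊕ b)) ≈ c ⇒
  ς (d ⊕ e) ≈ c ⇒ d ≈ ς a ⇒ e ≈ ς b ⇒ ↯) 10011010 0 _ _ _ _ _ p q r s)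
... | inj₂ (inj₁ (r , eq))     | inj₂ (inj₂ (s , _ , eq′)) = ⊥-elim
  (s (lin 5 (λ a b c d e → ς (ς (a ⊕ b)) ≈ c ⇒ ς (d ⊕ e) ≈ c ⇒ d ≈ ς a ⇒ e ≈ b) 1001101 110011 _ _ _ _ _ p q r))
... | inj₂ (inj₂ (_ , r , eq)) | inj₁ (s , eq′)            = ⊥-elim
  (r (lin 5 (λ a b c d e → ς (ς (a ⊕ b)) ≈ c ⇒ ς (d ⊕ e) ≈ c ⇒ e ≈ b ⇒ d ≈ ς a) 1001101 110011 _ _ _ _ _ p q s))
... | inj₂ (inj₂ (r , _ , eq)) | inj₂ (inj₁ (s , eq′))     = ⊥-elim
  (r (lin 5 (λ a b c d e → ς (ς (a ⊕ b)) ≈ c ⇒ ς (d ⊕ e) ≈ c ⇒ e ≈ ς b ⇒ d ≈ a) 1001101 110011 _ _ _ _ _ p q s))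
... | inj₂ (inj₂ (_ , _ , eq)) | inj₂ (inj₂ (_ , _ , eq′)) = lin 5 (λ a b c d e → a ≈ b ⇒ c ≈ d ⇒ ς (b ⊕ d) ≈ e
  ⇒ ς (a ⊕ c) ≈ e) 101011 1010101 _ _ _ _ _ eq eq′ q

module SignedArrays (n′ : ℕ) where

  n : ℕ
  n = suc n′

  -- The points -n < … < -1 < 1 < … < n become the sites 0 , … , 2n - 1.
  code : Point n → ℕ
  code (false , i) = n + toℕ i
  code (true  , i) = n ∸ suc (toℕ i)

  sw : ℕ → ℕ → ℕ
  sw zero    y = τ n′ y
  sw (suc i) y = τ (n′ ∸ suc i) (τ (n′ + suc i) y)

  actN : Word n → ℕ → ℕ
  actN []      y = y
  actN (i ∷ w) y = sw (toℕ i) (actN w y)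

  swapFin-cases : ∀ (j : Fin n′) x →
    (x ≡ inject₁ j × swapFin (inject₁ j) (Fin.suc j) x ≡ Fin.suc j) ⊎
    ((x ≡ Fin.suc j × swapFin (inject₁ j) (Fin.suc j) x ≡ inject₁ j) ⊎
     (toℕ x ≢ toℕ j × toℕ x ≢ suc (toℕ j) × swapFin (inject₁ j) (Fin.suc j) x ≡ x))
  swapFin-cases j x with x ≟F inject₁ j
  ... | yes p = inj₁ (p , refl)
  ... | no p with x ≟F Fin.suc j
  ...   | yes q = inj₂ (inj₁ (q , refl))
  ...   | no q  = inj₂ (inj₂ ((λ r → p (toℕ-injective (trans r (sym (toℕ-inject₁ j))))) ,
    (λ r → q (toℕ-injective r)) , refl))

  -- For every letter but 0 the two mirror transpositions have disjoint supports.
  far : ∀ {i} → suc i ≤ n′ → suc (n′ ∸ suc i) < n′ + suc i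
  far {i} p = lin 3 (λ a b c → a ⊕ ς b ≈ c ⇒ ς a ≺ c ⊕ ς b) 11 0 _ _ _ (m∸n+n≡m p)

  sw-high₁ : ∀ i → i ≤ n′ → sw i (n′ + i) ≡ suc (n′ + i)
  sw-high₁ zero    p = subst (λ z → τ n′ z ≡ suc z) (sym (+-identityʳ n′)) (τ-fst n′)
  sw-high₁ (suc i) p = trans (cong (τ (n′ ∸ suc i)) (τ-fst (n′ + suc i))) (τ-above _ _ (m<n⇒m<1+n (far p)))

  sw-high₂ : ∀ i → i ≤ n′ → sw i (suc (n′ + i)) ≡ n′ + i
  sw-high₂ zero    p = subst (λ z → τ n′ (suc z) ≡ z) (sym (+-identityʳ n′)) (τ-snd n′)
  sw-high₂ (suc i) p = trans (cong (τ (n′ ∸ suc i)) (τ-snd (n′ + suc i))) (τ-above _ _ (far p))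

  sw-low₁ : ∀ i → sw (suc i) (n′ ∸ suc i) ≡ suc (n′ ∸ suc i)
  sw-low₁ i = trans (cong (τ (n′ ∸ suc i)) (τ-below _ _ (≤-<-trans (m∸n≤m n′ (suc i)) (m<m+n n′ (s≤s z≤n)))))
    (τ-fst _)

  sw-low₂ : ∀ i → suc i ≤ n′ → sw (suc i) (suc (n′ ∸ suc i)) ≡ n′ ∸ suc i
  sw-low₂ i p = trans (cong (τ (n′ ∸ suc i)) (τ-below _ _ (far p))) (τ-snd _)

  sw-other : ∀ i y → y ≢ n′ + suc i → y ≢ suc (n′ + suc i) → y ≢ n′ ∸ suc i → y ≢ suc (n′ ∸ suc i) →
    sw (suc i) y ≡ y
  sw-other i y p q r s = trans (cong (τ (n′ ∸ suc i)) (τ-other _ y p q)) (τ-other _ y r s)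

  site-high : ∀ (j : Fin n′) → n + toℕ (inject₁ j) ≡ n′ + suc (toℕ j)
  site-high j = lin 3 (λ a b c → a ≈ b ⇒ ς c ⊕ a ≈ c ⊕ ς b) 11 101 _ _ _ (toℕ-inject₁ j)

  site-low : ∀ (j : Fin n′) → n′ ∸ toℕ (inject₁ j) ≡ suc (n′ ∸ suc (toℕ j))
  site-low j = trans (cong (n′ ∸_) (toℕ-inject₁ j)) (lin 4 (λ a b c d → a ⊕ ς b ≈ c ⇒ d ⊕ b ≈ c ⇒ d ≈ ς a) 10011
    1101 _ _ _ _ (m∸n+n≡m (toℕ<n j)) (m∸n+n≡m (<⇒≤ (toℕ<n j))))

  code-gen : ∀ i p → code (gen i p) ≡ sw (toℕ i) (code p)
  code-gen Fin.zero (false , Fin.zero)  = trans (sym (τ-snd n′)) (cong (τ n′) (sym (+-identityʳ n)))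
  code-gen Fin.zero (true  , Fin.zero)  = trans (+-identityʳ n) (sym (τ-fst n′))
  code-gen Fin.zero (false , Fin.suc x) = sym (τ-above n′ (n + suc (toℕ x)) (lin 2 (λ a b → ς a ≺ ς a ⊕ ς b) 1 0
    _ _))
  code-gen Fin.zero (true  , Fin.suc x) =
    sym (τ-below n′ (n′ ∸ suc (toℕ x)) (∸-monoʳ-< {n′} {suc (toℕ x)} {0} (s≤s z≤n) (toℕ<n x)))
  code-gen (Fin.suc j) (false , x) with swapFin-cases j x
  ... | inj₁ (x≡ , eq) = trans (cong (λ z → n + toℕ z) eq)
    (sym (trans (cong (sw (suc (toℕ j))) (trans (cong (λ z → n + toℕ z) x≡) (site-high j)))
      (sw-high₁ _ (toℕ<n j))))
  ... | inj₂ (inj₁ (x≡ , eq)) = trans (cong (λ z → n + toℕ z) eq)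
    (sym (trans (cong (sw (suc (toℕ j))) (cong (λ z → n + toℕ z) x≡)) (trans (sw-high₂ _ (toℕ<n j))
      (sym (site-high j)))))
  ... | inj₂ (inj₂ (p , q , eq)) = trans (cong (λ z → n + toℕ z) eq)
    (sym (sw-other (toℕ j) (n + toℕ x)
      (λ r → p (lin 3 (λ a b c → ς a ⊕ b ≈ a ⊕ ς c ⇒ b ≈ c) 11 101 _ _ _ r))
        (λ r → q (lin 3 (λ a b c → ς a ⊕ b ≈ ς (a ⊕ ς c) ⇒ b ≈ ς c) 11 101 _ _ _ r))
      (λ r → lin 4 (λ a b c d → ς a ⊕ b ≈ c ⇒ c ⊕ ς d ≈ a ⇒ ↯) 101 0 _ _ _ _ r (m∸n+n≡m (toℕ<n j)))
      (λ r → lin 4 (λ a b c d → ς a ⊕ b ≈ ς c ⇒ c ⊕ ς d ≈ a ⇒ ↯) 101 0 _ _ _ _ r (m∸n+n≡m (toℕ<n j)))))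
  code-gen (Fin.suc j) (true , x) with swapFin-cases j x
  ... | inj₁ (x≡ , eq) = trans (cong (λ z → n′ ∸ toℕ z) eq)
    (sym (trans (cong (sw (suc (toℕ j))) (trans (cong (λ z → n′ ∸ toℕ z) x≡) (site-low j)))
      (sw-low₂ _ (toℕ<n j))))
  ... | inj₂ (inj₁ (x≡ , eq)) = trans (cong (λ z → n′ ∸ toℕ z) eq) (trans (site-low j)
    (sym (trans (cong (sw (suc (toℕ j))) (cong (λ z → n′ ∸ toℕ z) x≡)) (sw-low₁ _))))
  ... | inj₂ (inj₂ (p , q , eq)) = trans (cong (λ z → n′ ∸ toℕ z) eq)
    (sym (sw-other (toℕ j) (n′ ∸ toℕ x)
      (λ r → lin 3 (λ a b c → a ≈ b ⊕ ς c ⇒ a ≼ b ⇒ ↯) 101 0 _ _ _ r (m∸n≤m n′ (toℕ x)))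
      (λ r → lin 3 (λ a b c → a ≈ ς (b ⊕ ς c) ⇒ a ≼ b ⇒ ↯) 101 0 _ _ _ r (m∸n≤m n′ (toℕ x)))
      (λ r → q (lin 5 (λ a b c d e → a ≈ b ⇒ b ⊕ ς c ≈ d ⇒ a ⊕ e ≈ d ⇒ e ≈ ς c) 1010011 101101 _ _ _ _ _ r
        (m∸n+n≡m (toℕ<n j)) (m∸n+n≡m (s≤s⁻¹ (toℕ<n x)))))
      (λ r → p (lin 5 (λ a b c d e → a ≈ ς b ⇒ b ⊕ ς c ≈ d ⇒ a ⊕ e ≈ d ⇒ e ≈ c) 1010011 101101 _ _ _ _ _ r
        (m∸n+n≡m (toℕ<n j)) (m∸n+n≡m (s≤s⁻¹ (toℕ<n x)))))))

  code-act : ∀ w p → code (act w p) ≡ actN w (code p)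
  code-act []      p = refl
  code-act (i ∷ w) p = trans (code-gen i (act w p)) (cong (sw (toℕ i)) (code-act w p))

  sign-disjoint : ∀ i j → n + i ≡ n′ ∸ j → ⊥
  sign-disjoint i j eq = lin 3 (λ a b c → ς a ⊕ b ≈ c ⇒ c ≼ a ⇒ ↯) 11 0 _ _ _ eq (m∸n≤m n′ j)

  code-injective : ∀ p q → code p ≡ code q → p ≡ q
  code-injective (false , i) (false , j) eq = cong (false ,_) (toℕ-injective (+-cancelˡ-≡ n _ _ eq))
  code-injective (true  , i) (true  , j) eq = cong (true ,_) (toℕ-injective
    (lin 5 (λ a b c d e → a ≈ b ⇒ a ⊕ c ≈ d ⇒ b ⊕ e ≈ d ⇒ c ≈ e) 1001101 110011 _ _ _ _ _ eq
      (m∸n+n≡m (s≤s⁻¹ (toℕ<n i))) (m∸n+n≡m (s≤s⁻¹ (toℕ<n j)))))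
  code-injective (false , i) (true  , j) eq = ⊥-elim (sign-disjoint (toℕ i) (toℕ j) eq)
  code-injective (true  , i) (false , j) eq = ⊥-elim (sign-disjoint (toℕ j) (toℕ i) (sym eq))

  sw-involutive : ∀ i y → i ≤ n′ → sw i (sw i y) ≡ y
  sw-involutive zero    y p = τ-involutive n′ y
  sw-involutive (suc i) y p =
    trans (cong (λ z → τ (n′ ∸ suc i) z) (sym (τ-comm (far p) (τ (n′ + suc i) y))))
     (trans (τ-involutive (n′ ∸ suc i) _) (τ-involutive (n′ + suc i) y)) 

  Mirror : (ℕ → ℕ) → Set
  Mirror B = ∀ y y′ → suc (y + y′) ≡ n + n → suc (B y + B y′) ≡ n + n

  record Signed (B : ℕ → ℕ) : Set where
    field
      mirror    : Mirror B
      injective : ∀ y z → B y ≡ B z → y ≡ z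
  open Signed public

  signed-id : Signed (λ y → y)
  signed-id = record { mirror = λ _ _ p → p ; injective = λ _ _ p → p }

  sw-mirror : ∀ i → i ≤ n′ → ∀ y y′ → suc (y + y′) ≡ n + n → suc (sw i y + sw i y′) ≡ n + n
  sw-mirror zero    p y y′ q = τ-mirror {n + n} {n′} {n′} (lin 1 (λ a → ς (ς (a ⊕ a)) ≈ ς a ⊕ ς a) 1 1 _) y y′ q
  sw-mirror (suc i) p y y′ q = subst (λ z → suc (sw (suc i) y + z) ≡ n + n) (sym (τ-comm (far p) y′))
    (τ-mirror {n + n} {n′ ∸ suc i} {n′ + suc i} (lin 3 (λ a b c → a ⊕ ς b ≈ c ⇒ ς (ς (a ⊕ (c ⊕ ς b))) ≈ ς c ⊕ ς
      c) 11 101 _ _ _ (m∸n+n≡m p)) (τ (n′ + suc i) y) (τ (n′ ∸ suc i) y′)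
      (τ-mirror {n + n} {n′ + suc i} {n′ ∸ suc i} (lin 3 (λ a b c → a ⊕ ς b ≈ c ⇒ ς (ς (c ⊕ ς b ⊕ a)) ≈ ς c ⊕ ς
        c) 11 101 _ _ _ (m∸n+n≡m p)) y y′ q))

  signed-sw : ∀ {B} i → i ≤ n′ → Signed B → Signed (B ∘ sw i)
  signed-sw {B} i p s = record
    { mirror    = λ y y′ q → mirror s (sw i y) (sw i y′) (sw-mirror i p y y′ q)
    ; injective = λ y z q → trans (sym (sw-involutive i y p))
        (trans (cong (sw i) (injective s (sw i y) (sw i z) q)) (sw-involutive i z p))
    }

  letter≤ : ∀ (i : Fin n) → toℕ i ≤ n′
  letter≤ i = s≤s⁻¹ (toℕ<n i)

  signed-∘actN : ∀ {B} w → Signed B → Signed (B ∘ actN w)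
  signed-∘actN []      s = s
  signed-∘actN (i ∷ w) s = signed-∘actN w (signed-sw (toℕ i) (letter≤ i) s)

  signed-actN : ∀ w → Signed (actN w)
  signed-actN w = signed-∘actN w signed-id

  signed-< : ∀ {B} → Signed B → ∀ {y} → y < n + n → B y < n + n
  signed-< {B} s {y} p = lin 3 (λ a b c → ς (a ⊕ b) ≈ ς c ⊕ ς c ⇒ a ≺ ς c ⊕ ς c) 22 0 _ _ _
    (mirror s y (n + n ∸ suc y) (lin 3 (λ a b c → a ⊕ ς b ≈ ς c ⊕ ς c ⇒ ς (b ⊕ a) ≈ ς c ⊕ ς c) 22 202 _ _ _
    (m∸n+n≡m p)))

  opaque
    -- Twice the Coxeter length. A letter other than 0 used at an ascent creates two mirror
    -- inversions. The letter 0 creates only one, but also brings one label ≥ n into the left half,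
    -- which the second summand counts; so every letter weighs two.
    stat : (ℕ → ℕ) → ℕ
    stat B = inversions B (n + n) + height B n n

  opaque
    unfolding stat

    stat-cong : ∀ {B C} → (∀ y → y < n + n → B y ≡ C y) → stat B ≡ stat C
    stat-cong eq = cong₂ _+_ (inversions-cong (n + n) eq) (height-cong n n
      (λ y p → eq y (≤-trans p (m≤m+n n n))))

  Ascent : (ℕ → ℕ) → ℕ → Set
  Ascent B i = B (n′ + i) < B (suc (n′ + i))

  ascent-mirror : ∀ {B i} → Mirror B → i ≤ n′ → Ascent B i → B (n′ ∸ i) < B (suc (n′ ∸ i))
  ascent-mirror {B} {i} s p a =
    lin 5 (λ a b c d e → a ≺ b ⇒ ς (c ⊕ b) ≈ ς d ⊕ ς d ⇒ ς (e ⊕ a) ≈ ς d ⊕ ς d ⇒ c ≺ e) 101101 0 _ _ _ _ _ a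
      (s (n′ ∸ i) (suc (n′ + i)) (lin 3 (λ a b c → a ⊕ b ≈ c ⇒ ς (a ⊕ ς (c ⊕ b)) ≈ ς c ⊕ ς c) 11 101 _ _ _
      (m∸n+n≡m p))) (s (suc (n′ ∸ i)) (n′ + i) (lin 3 (λ a b c → a ⊕ b ≈ c ⇒ ς (ς a ⊕ (c ⊕ b)) ≈ ς c ⊕ ς c) 11
      101 (n′ ∸ i) i _ (m∸n+n≡m p)))

  opaque
    unfolding stat

    stat-ascent : ∀ {B} → Signed B → ∀ i → i ≤ n′ → Ascent B i → stat (B ∘ sw i) ≡ 2 + stat B
    stat-ascent {B} s zero p a
      rewrite +-identityʳ n′
            | inversions-τ B n′ (n + n) (lin 1 (λ a → ς a ≺ ς a ⊕ ς a) 1 0 _) a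
            | τ-fst n′
            | height-τ-below B n n′ n′ ≤-refl
            | 𝟙-yes {n} {B n} (lin 3 (λ a b c → a ≺ b ⇒ ς (a ⊕ b) ≈ ς c ⊕ ς c ⇒ ς c ≼ b) 1102 0 _ _ _ a
              (mirror s n′ n (lin 1 (λ a → ς (a ⊕ ς a) ≈ ς a ⊕ ς a) 1 1 _)))
            | 𝟙-no {n} {B n′} (lin 3 (λ a b c → a ≺ b ⇒ ς (a ⊕ b) ≈ ς c ⊕ ς c ⇒ a ≺ ς c) 1012 0 _ _ _ a
              (mirror s n′ n (lin 1 (λ a → ς (a ⊕ ς a) ≈ ς a ⊕ ς a) 1 1 _)))
      = lin 3 (λ a b c → ς (a ⊕ b ⊕ ς c) ≈ ς (ς (a ⊕ b ⊕ (κ 0 ⊕ c)))) 1 1 (height B (suc (B (n′ + suc n′)))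
        (n′ + suc n′)) (inversions B (n′ + suc n′)) _
    stat-ascent {B} s (suc i) p a
      rewrite inversions-τ (B ∘ τ (n′ ∸ suc i)) (n′ + suc i) (n + n)
        (lin 2 (λ a b → a ≺ b ⇒ ς (b ⊕ ς a) ≺ ς b ⊕ ς b) 11 0 _ _ p)
                (subst₂ (λ u v → B u < B v) (sym (τ-above (n′ ∸ suc i) (n′ + suc i) (far p)))
                   (sym (τ-above (n′ ∸ suc i) (suc (n′ + suc i)) (m<n⇒m<1+n (far p)))) a)
            | inversions-τ B (n′ ∸ suc i) (n + n) (lin 3 (λ a b c → a ⊕ ς b ≈ c ⇒ ς a ≺ ς c ⊕ ς c) 21 0 _ _ _
              (m∸n+n≡m p)) (ascent-mirror {B} (mirror s) p a)
            | height-τ (B ∘ τ (n′ ∸ suc i)) n (n′ + suc i) n (λ q → lin 2 (λ a b → ς a ≈ ς (a ⊕ ς b) ⇒ ↯) 10 0 _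
              _ q)
            | height-τ B n (n′ ∸ suc i) n (λ q → lin 3 (λ a b c → ς a ≈ ς b ⇒ b ⊕ ς c ≈ a ⇒ ↯) 101 0 _ _ _ q
              (m∸n+n≡m p))
      = refl

  stat-descent : ∀ {B} → Signed B → ∀ i → i ≤ n′ → B (suc (n′ + i)) < B (n′ + i) → 2 + stat (B ∘ sw i) ≡ stat B
  stat-descent {B} s i p d = trans (sym (stat-ascent (signed-sw i p s) i p asc))
    (stat-cong (λ y _ → cong B (sw-involutive i y p)))
    where
    asc : Ascent (B ∘ sw i) i
    asc = subst₂ (λ u v → B u < B v) (sym (sw-high₁ i p)) (sym (sw-high₂ i p)) d

  stat-sw≤ : ∀ {B} → Signed B → ∀ i → i ≤ n′ → stat (B ∘ sw i) ≤ 2 + stat B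
  stat-sw≤ {B} s i p = step (<-cmp (B (n′ + i)) (B (suc (n′ + i))))
    where
    step : Tri (B (n′ + i) < B (suc (n′ + i))) (B (n′ + i) ≡ B (suc (n′ + i))) (B (suc (n′ + i)) < B (n′ + i)) →
      stat (B ∘ sw i) ≤ 2 + stat B
    step (tri< a _ _) = ≤-reflexive (stat-ascent s i p a)
    step (tri≈ _ e _) = ⊥-elim (1+n≢n (sym (injective s _ _ e)))
    step (tri> _ _ d) = lin 2 (λ a b → κ 2 ⊕ a ≈ b ⇒ a ≼ κ 2 ⊕ b) 11 0 _ _ (stat-descent s i p d)

  stat-actN≤ : ∀ {B} w → Signed B → stat (B ∘ actN w) ≤ length w + length w + stat B
  stat-actN≤ []      s = ≤-refl
  stat-actN≤ {B} (i ∷ w) s =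
    lin 4 (λ a b c d → a ≼ b ⊕ b ⊕ c ⇒ c ≼ κ 2 ⊕ d ⇒ a ≼ ς b ⊕ ς b ⊕ d) 111 0 _ _ _ _
      (stat-actN≤ w (signed-sw (toℕ i) (letter≤ i) s)) (stat-sw≤ s (toℕ i) (letter≤ i))

  opaque
    unfolding stat

    stat-id : stat (λ y → y) ≡ 0
    stat-id = cong₂ _+_ (inversions-id (n + n)) (trans (height-id n n) (n∸n≡0 n))

  -- An `Elem` records the images of the positive points, that is of the upper sites; antisymmetry
  -- supplies the lower ones.
  elem⇒actN : ∀ u v → elem u ≡ elem v → ∀ y → y < n + n → actN u y ≡ actN v y
  elem⇒actN u v eq = everywhere
    where
    upper : ∀ y → y < n + n → n ≤ y → actN u y ≡ actN v y
    upper y p q = subst (λ z → actN u z ≡ actN v z) site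
      (trans (sym (code-act u (false , j))) (trans (cong code pt) (code-act v (false , j))))
      where
      y∸n<n : y ∸ n < n
      y∸n<n = lin 3 (λ a b c → a ⊕ ς b ≈ c ⇒ c ≺ ς b ⊕ ς b ⇒ a ≺ ς b) 111 0 _ _ _ (m∸n+n≡m q) p
      j = fromℕ< y∸n<n
      site : n + toℕ j ≡ y
      site = trans (cong (n +_) (toℕ-fromℕ< y∸n<n)) (m+[n∸m]≡n q)
      pt : act u (false , j) ≡ act v (false , j)
      pt = trans (sym (lookup∘tabulate (λ j → act u (false , j)) j))
             (trans (cong (λ t → Vec.lookup t j) eq) (lookup∘tabulate (λ j → act v (false , j)) j))
    everywhere : ∀ y → y < n + n → actN u y ≡ actN v y
    everywhere y p with n ≤? y
    ... | yes q = upper y p q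
    ... | no q  = lin 5 (λ a b c d e → ς (a ⊕ b) ≈ ς c ⊕ ς c ⇒ ς (d ⊕ e) ≈ ς c ⊕ ς c ⇒ b ≈ e ⇒ a ≈ d) 110101
      1001011 _ _ _ _ _ (mirror (signed-actN u) y y′ mir) (mirror (signed-actN v) y y′ mir)
      (upper y′ (lin 3 (λ a b c → ς (a ⊕ b) ≈ ς c ⊕ ς c ⇒ b ≺ ς c ⊕ ς c) 22 0 _ _ _ mir)
      (lin 3 (λ a b c → ς (a ⊕ b) ≈ ς c ⊕ ς c ⇒ a ≺ ς c ⇒ ς c ≼ b) 1011 0 _ _ _ mir (≰⇒> q)))
      where
      y′ = n + n ∸ suc y
      mir : suc (y + y′) ≡ n + n
      mir = lin 3 (λ a b c → a ⊕ ς b ≈ ς (c ⊕ ς c) ⇒ ς (b ⊕ a) ≈ ς c ⊕ ς c) 22 202 _ _ _ (m∸n+n≡m p)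

  actN⇒elem : ∀ u v → (∀ y → y < n + n → actN u y ≡ actN v y) → elem u ≡ elem v
  actN⇒elem u v eq = tabulate-cong (λ j → code-injective (act u (false , j)) (act v (false , j))
    (trans (code-act u (false , j)) (trans (eq (n + toℕ j) (+-monoʳ-< n (toℕ<n j)))
      (sym (code-act v (false , j))))))

  actN-++ : ∀ u v y → actN (u ++ v) y ≡ actN u (actN v y)
  actN-++ []      v y = refl
  actN-++ (i ∷ u) v y = cong (sw (toℕ i)) (actN-++ u v y)

  reduced : ∀ w → length w + length w ≡ stat (actN w) → IsReduced w
  reduced w eq v el = lin 5 (λ a b c d e → a ⊕ a ≈ b ⇒ c ≈ b ⇒ c ≼ d ⊕ d ⊕ e ⇒ e ≈ κ 0 ⇒ a ≼ d) 1101012 0 _ _ _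
    _ _ eq (stat-cong (elem⇒actN v w el)) (stat-actN≤ v signed-id) stat-id

  -- Strict growth gives y ≤ B y. The same bound holds at the mirror site, and by antisymmetry the
  -- two excesses add up to zero.
  increasing⇒id : ∀ {B} → Mirror B → (∀ y → suc y < n + n → B y < B (suc y)) → ∀ y → y < n + n → B y ≡ y
  increasing⇒id {B} s inc y p =
    lin 5 (λ a b c d e → ς (a ⊕ b) ≈ ς c ⊕ ς c ⇒ d ≼ a ⇒ e ≼ b ⇒ ς (d ⊕ e) ≈ ς c ⊕ ς c ⇒ a ≈ d) 101101 10001 _ _
      _ _ _ (s y y′ mir) (ge y p) (ge y′ (lin 3 (λ a b c → ς (a ⊕ b) ≈ ς c ⊕ ς c ⇒ b ≺ ς c ⊕ ς c) 22 0 _ _ _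
      mir)) mir
    where
    y′ = n + n ∸ suc y
    mir : suc (y + y′) ≡ n + n
    mir = lin 3 (λ a b c → a ⊕ ς b ≈ ς c ⊕ ς c ⇒ ς (b ⊕ a) ≈ ς c ⊕ ς c) 22 202 _ _ _ (m∸n+n≡m p)
    ge : ∀ y → y < n + n → y ≤ B y
    ge zero    p = z≤n
    ge (suc y) p = ≤-trans (s≤s (ge y (<-trans (n<1+n y) p))) (inc y p)

  all-sites : ∀ {B} → Mirror B → (∀ (i : Fin n) → Ascent B (toℕ i)) → ∀ y → suc y < n + n → B y < B (suc y)
  all-sites {B} s asc y p with n′ ≤? y
  ... | yes q = subst (λ z → B z < B (suc z)) eq (asc (fromℕ< r))
    where
    r : y ∸ n′ < n
    r = lin 3 (λ a b c → ς a ≺ ς (b ⊕ ς b) ⇒ c ⊕ b ≈ a ⇒ c ≺ ς b) 1011 0 _ _ _ p (m∸n+n≡m q)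
    eq : n′ + toℕ (fromℕ< r) ≡ y
    eq = trans (cong (n′ +_) (toℕ-fromℕ< r)) (m+[n∸m]≡n q)
  ... | no q = subst (λ z → B z < B (suc z)) eq (ascent-mirror {B} s (letter≤ (fromℕ< r)) (asc (fromℕ< r)))
    where
    r : n′ ∸ y < n
    r = s≤s (m∸n≤m n′ y)
    eq : n′ ∸ toℕ (fromℕ< r) ≡ y
    eq = trans (cong (n′ ∸_) (toℕ-fromℕ< r)) (m∸[m∸n]≡n (<⇒≤ (≰⇒> q)))

  no-descent⇒id : ∀ {B} → Signed B → (∀ (i : Fin n) → ¬ (B (suc (n′ + toℕ i)) < B (n′ + toℕ i))) →
    ∀ y → y < n + n → B y ≡ y
  no-descent⇒id {B} s nd = increasing⇒id {B} (mirror s) (all-sites {B} (mirror s) (λ i →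
    ≤∧≢⇒< (≮⇒≥ (nd i)) (λ e → 1+n≢n (sym (injective s _ _ e)))))

  no-ascent⇒reversed : ∀ {B} → Signed B → (∀ (i : Fin n) → ¬ Ascent B (toℕ i)) →
    ∀ y → y < n + n → suc (B y + y) ≡ n + n
  no-ascent⇒reversed {B} s na y p = lin 4 (λ a b c d → ς (a ⊕ b) ≈ ς c ⊕ ς c ⇒ b ≈ d ⇒ ς (a ⊕ d) ≈ ς c ⊕ ς c)
    2202 20022 _ _ _ _ (eqn y p) (increasing⇒id {C} s′ (all-sites {C} s′ asc) y p)
    where
    C : ℕ → ℕ
    C z = B (n + n ∸ suc z)
    flip : ∀ z → z < n + n → suc (z + (n + n ∸ suc z)) ≡ n + n
    flip z q = lin 3 (λ a b c → a ⊕ ς b ≈ ς c ⊕ ς c ⇒ ς (b ⊕ a) ≈ ς c ⊕ ς c) 22 202 _ _ _ (m∸n+n≡m q)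
    eqn : ∀ z → z < n + n → suc (B z + C z) ≡ n + n
    eqn z q = mirror s z (n + n ∸ suc z) (flip z q)
    s′ : Mirror C
    s′ z z′ q = lin 5 (λ a b c d e → ς (a ⊕ b) ≈ ς c ⊕ ς c ⇒ ς (d ⊕ e) ≈ ς c ⊕ ς c ⇒ ς (a ⊕ d) ≈ ς c ⊕ ς c ⇒
      ς (b ⊕ e) ≈ ς c ⊕ ς c) 101101 1010011 (B z) (C z) _ (B z′) (C z′)
      (eqn z (lin 3 (λ a b c → ς (a ⊕ b) ≈ ς c ⊕ ς c ⇒ a ≺ ς c ⊕ ς c) 22 0 _ _ _ q))
      (eqn z′ (lin 3 (λ a b c → ς (a ⊕ b) ≈ ς c ⊕ ς c ⇒ b ≺ ς c ⊕ ς c) 22 0 _ _ _ q)) (mirror s z z′ q)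
    asc : ∀ (i : Fin n) → Ascent C (toℕ i)
    asc i = lin 5 (λ a b c d e → ς (a ⊕ b) ≈ ς c ⊕ ς c ⇒ ς (d ⊕ e) ≈ ς c ⊕ ς c ⇒ d ≺ a ⇒ b ≺ e) 11011 0 _ _ _ _
      _ (eqn (n′ + toℕ i) (lin 2 (λ a b → a ≼ b ⇒ b ⊕ a ≺ ς b ⊕ ς b) 11 0 _ _ (letter≤ i)))
      (eqn (suc (n′ + toℕ i)) (lin 2 (λ a b → a ≼ b ⇒ ς (b ⊕ a) ≺ ς b ⊕ ς b) 11 0 _ _ (letter≤ i)))
      (≤∧≢⇒< (≮⇒≥ (na i)) (λ e → 1+n≢n (injective s _ _ e)))

  -- Bubble sort with fuel `l`. Each removed descent costs one letter and lowers `stat` by two, so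
  -- the word attains the lower bound on length given by `stat-actN≤`.
  sorted : ∀ l {B} → Signed B → stat B ≤ l →
    Σ (Word n) λ v → (∀ y → y < n + n → actN v y ≡ B y) × length v + length v ≡ stat B
  sorted l {B} s p with any? (λ i → B (suc (n′ + toℕ i)) <? B (n′ + toℕ i))
  ... | no nd = [] , (λ y q → sym (isId y q)) , trans (sym stat-id) (sym (stat-cong isId))
    where
    isId : ∀ y → y < n + n → B y ≡ y
    isId = no-descent⇒id s (λ i d → nd (i , d))
  sorted zero    {B} s p | yes (i , d) = ⊥-elim (lin 2 (λ a b → a ≼ κ 0 ⇒ κ 2 ⊕ b ≈ a ⇒ ↯) 101 0 _ _ p
    (stat-descent s (toℕ i) (letter≤ i) d))
  sorted (suc l) {B} s p | yes (i , d)
    with sorted l (signed-sw (toℕ i) (letter≤ i) s) (lin 3 (λ a b c → a ≼ ς b ⇒ κ 2 ⊕ c ≈ a ⇒ c ≼ b) 1011 0 _ _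
      _ p (stat-descent s (toℕ i) (letter≤ i) d))
  ... | v , eq , len = v ++ i ∷ []
      , (λ y q → trans (actN-++ v (i ∷ []) y)
          (trans (eq (sw (toℕ i) y) (signed-< (signed-actN (i ∷ [])) q))
            (cong B (sw-involutive (toℕ i) y (letter≤ i)))))
      , lin 4 (λ a b c d → a ≈ b ⊕ κ 1 ⇒ b ⊕ b ≈ c ⇒ κ 2 ⊕ c ≈ d ⇒ a ⊕ a ≈ d) 201011 2010101 _ _ _ _
        (length-++ v {i ∷ []}) len (stat-descent s (toℕ i) (letter≤ i) d)

  hasLength : ∀ u → Σ ℕ λ l → HasLength (elem u) l × l + l ≡ stat (actN u)
  hasLength u with sorted (stat (actN u)) (signed-actN u) ≤-refl
  ... | v , eq , len = length v , ((v , el , refl) , λ w e → rd w (trans e (sym el))) , len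
    where
    el : elem v ≡ elem u
    el = actN⇒elem v u eq
    rd : IsReduced v
    rd = reduced v (trans len (sym (stat-cong eq)))

  Reversed : (ℕ → ℕ) → Set
  Reversed B = ∀ y → y < n + n → suc (B y + y) ≡ n + n

  -- If a longest element had an ascent, appending that letter would give a longer one.
  longest : ∀ w∘ → IsLongest w∘ → Σ (Word n) λ u → elem u ≡ w∘ × Reversed (actN u)
  longest _ (l , ((u , refl , len) , low) , max) = u , refl , no-ascent⇒reversed (signed-actN u) noAsc
    where
    noAsc : ∀ (i : Fin n) → ¬ Ascent (actN u) (toℕ i)
    noAsc i a = too-long (hasLength (u ++ i ∷ [])) (hasLength u)
      where
      step : stat (actN (u ++ i ∷ [])) ≡ 2 + stat (actN u)
      step = trans (stat-cong (λ y _ → actN-++ u (i ∷ []) y)) (stat-ascent (signed-actN u) (toℕ i) (letter≤ i)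
        a)
      too-long : (Σ ℕ λ l → HasLength (elem (u ++ i ∷ [])) l × l + l ≡ stat (actN (u ++ i ∷ []))) →
        (Σ ℕ λ l → HasLength (elem u) l × l + l ≡ stat (actN u)) → ⊥
      too-long (l₁ , hl₁ , eq₁) (l₂ , ((v , el , refl) , _) , eq₂) =
        lin 4 (λ a b c d → a ≼ b ⇒ b ≼ c ⇒ a ⊕ a ≈ κ 2 ⊕ d ⇒ c ⊕ c ≈ d ⇒ ↯) 221001 0 _ _ _ _ (max _ l₁ hl₁)
          (low v el) (trans eq₁ step) eq₂

  reversed-unique : ∀ u v → Reversed (actN u) → Reversed (actN v) → elem u ≡ elem v
  reversed-unique u v p q = actN⇒elem u v (λ y r → lin 4 (λ a b c d → ς (a ⊕ b) ≈ ς c ⊕ ς c ⇒ ς (d ⊕ b) ≈ ς c ⊕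
    ς c ⇒ a ≈ d) 2202 10011 _ _ _ _ (p y r) (q y r))

  opaque
    unfolding stat

    stat-reversed : ∀ {B} → Reversed B → stat B ≡ n * n + n * n
    stat-reversed {B} rev = unfolded
      where
      sq : (n + n) * (n + n) ≡ n * n + n * n + (n * n + n * n)
      sq = trans (*-distribʳ-+ (n + n) n n) (cong₂ _+_ (*-distribˡ-+ n n n) (*-distribˡ-+ n n n))
      unfolded : inversions B (n + n) + height B n n ≡ n * n + n * n
      unfolded = lin 5 (λ a b c d e → a ⊕ a ⊕ (ς b ⊕ ς b) ≈ c ⇒ d ≈ ς b ⇒ c ≈ e ⊕ e ⊕ (e ⊕ e) ⇒ a ⊕ d ≈ e ⊕ e)
        408048 4080408 (inversions B (n + n)) _ _ _ (n * n) (inversions-reversed {B} (n + n)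
        (λ y z p q → lin 5 (λ a b c d e → ς (a ⊕ b) ≈ ς c ⊕ ς c ⇒ ς (d ⊕ e) ≈ ς c ⊕ ς c ⇒ b ≺ e ⇒ d ≺ a) 100111
        0 _ _ _ _ _ (rev y (<-trans p q)) (rev z q) p)) (height-full {B} {n} n
        (λ y p → lin 3 (λ a b c → ς (a ⊕ b) ≈ ς c ⊕ ς c ⇒ b ≺ ς c ⇒ ς c ≼ a) 1011 0 _ _ _
        (rev y (≤-trans p (m≤m+n n n))) p)) sq

-- Words as motions of a staircase; the initial staircase of a Coxeter element

bump₁ : ℕ → (ℕ → ℕ) → ℕ → ℕ
bump₁ y F x with x ≟ suc y
... | yes _ = suc (F x)
... | no _  = F x

bump₁-here : ∀ y F → bump₁ y F (suc y) ≡ suc (F (suc y))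
bump₁-here y F with suc y ≟ suc y
... | yes _ = refl
... | no p  = ⊥-elim (p refl)

bump₁-other : ∀ y F x → x ≢ suc y → bump₁ y F x ≡ F x
bump₁-other y F x p with x ≟ suc y
... | yes q = ⊥-elim (p q)
... | no _  = refl

bump₁-Bump : ∀ y F → Bump y F (bump₁ y F)
bump₁-Bump y F = record { here = bump₁-here y F ; other = bump₁-other y F }

bump₁-≤ : ∀ y F x → F x ≤ bump₁ y F x
bump₁-≤ y F x with x ≟ suc y
... | yes _ = n≤1+n (F x)
... | no _  = ≤-refl

⌊_⌋ : Bool → ℕ
⌊ true ⌋  = 1
⌊ false ⌋ = 0

δ : ℕ → ℕ → ℕ
δ i j with i ≟ j
... | yes _ = 1
... | no _  = 0

δ-yes : ∀ {i j} → i ≡ j → δ i j ≡ 1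
δ-yes {i} {j} p with i ≟ j
... | yes _ = refl
... | no q  = ⊥-elim (q p)

δ-no : ∀ {i j} → i ≢ j → δ i j ≡ 0
δ-no {i} {j} p with i ≟ j
... | yes q = ⊥-elim (p q)
... | no _  = refl

module Frontiers (n′ : ℕ) where
  open SignedArrays n′

  N : ℕ
  N = n + n

  low high : ℕ → ℕ
  low i  = suc (n′ ∸ i)
  high i = suc (n′ + i)

  -- The letter 0 has a single boundary, `low 0` and `high 0` being equal, and is therefore bumped
  -- once.
  bump : ℕ → (ℕ → ℕ) → ℕ → ℕ
  bump zero    F = bump₁ n′ F
  bump (suc i) F = bump₁ (n′ + suc i) (bump₁ (n′ ∸ suc i) F)

  bump-low : ∀ j i F → j ≤ n′ → i ≤ n′ → bump j F (low i) ≡ δ j i + F (low i)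
  bump-low zero zero F p q = bump₁-here n′ F
  bump-low zero (suc i) F p q = bump₁-other n′ F (low (suc i))
    (λ e → lin 3 (λ a b c → ς a ≈ ς b ⇒ a ⊕ ς c ≈ b ⇒ ↯) 1001 0 _ _ _ e (m∸n+n≡m q))
  bump-low (suc j) i F p q = trans (bump₁-other _ _ (low i) (λ e → lin 3 (λ a b c → ς a ≈ ς (b ⊕ ς c) ⇒ a ≼ b ⇒
    ↯) 101 0 _ _ _ e (m∸n≤m n′ i))) inner
    where
    inner : bump₁ (n′ ∸ suc j) F (low i) ≡ δ (suc j) i + F (low i)
    inner with suc j ≟ i
    ... | yes refl = bump₁-here (n′ ∸ suc j) F
    ... | no r     = bump₁-other _ F (low i)
      (λ e → r (lin 5 (λ a b c d e → ς a ≈ ς b ⇒ b ⊕ ς c ≈ d ⇒ a ⊕ e ≈ d ⇒ ς c ≈ e) 101101 1010011 _ _ _ _ _ e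
      (m∸n+n≡m p) (m∸n+n≡m q)))

  bump-high : ∀ j i F → j ≤ n′ → i ≤ n′ → bump j F (high i) ≡ δ j i + F (high i)
  bump-high zero zero F p q = subst (λ z → bump₁ n′ F (suc z) ≡ suc (F (suc z))) (sym (+-identityʳ n′))
    (bump₁-here n′ F)
  bump-high zero (suc i) F p q = bump₁-other n′ F (high (suc i)) (λ e → lin 2 (λ a b → ς (a ⊕ ς b) ≈ ς a ⇒ ↯) 1
    0 _ _ e)
  bump-high (suc j) i F p q = outer (suc j ≟ i)
    where
    inner : bump₁ (n′ ∸ suc j) F (high i) ≡ F (high i)
    inner = bump₁-other _ F (high i) (λ e → lin 4 (λ a b c d → ς (a ⊕ b) ≈ ς c ⇒ c ⊕ ς d ≈ a ⇒ ↯) 101 0 _ _ _ _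
      e (m∸n+n≡m p))
    outer : _ → bump (suc j) F (high i) ≡ δ (suc j) i + F (high i)
    outer (yes refl) = trans (bump₁-here (n′ + suc j) (bump₁ (n′ ∸ suc j) F))
      (trans (cong suc inner) (cong (_+ F (high i)) (sym (δ-yes refl))))
    outer (no r)     = trans (bump₁-other (n′ + suc j) (bump₁ (n′ ∸ suc j) F) (high i)
      (λ e → r (lin 3 (λ a b c → ς (a ⊕ b) ≈ ς (a ⊕ ς c) ⇒ ς c ≈ b) 101 11 _ _ _ e)))
      (trans inner (cong (_+ F (high i)) (sym (δ-no r))))

  bump-≤ : ∀ j F x → F x ≤ bump j F x
  bump-≤ zero    F x = bump₁-≤ n′ F x
  bump-≤ (suc j) F x = ≤-trans (bump₁-≤ _ F x) (bump₁-≤ _ _ x)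

  boundary : ∀ x → 0 < x → x < N → Σ ℕ λ i → i ≤ n′ × (x ≡ low i ⊎ x ≡ high i)
  boundary x 0<x x<N with x ≤? n
  ... | yes p = n ∸ x , lin 3 (λ a b c → a ⊕ b ≈ ς c ⇒ κ 1 ≼ b ⇒ a ≼ c) 111 0 _ _ _ (m∸n+n≡m p) 0<x
      , inj₁ (lin 4 (λ a b c d → a ⊕ b ≈ c ⇒ b ⊕ d ≈ ς c ⇒ d ≈ ς a) 10011 1101 _ _ _ _
        (m∸n+n≡m {n′} {n ∸ x} (lin 3 (λ a b c → a ⊕ b ≈ ς c ⇒ κ 1 ≼ b ⇒ a ≼ c) 111 0 _ _ _ (m∸n+n≡m p) 0<x))
        (m∸n+n≡m p))
  ... | no p = x ∸ n , lin 3 (λ a b c → a ⊕ ς b ≈ c ⇒ c ≺ ς (b ⊕ ς b) ⇒ a ≼ b) 111 0 _ _ _ (m∸n+n≡m (≰⇒≥ p)) x<N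
    , inj₂ (lin 3 (λ a b c → a ⊕ ς b ≈ c ⇒ c ≈ ς (b ⊕ a)) 101 11 _ _ _ (m∸n+n≡m (≰⇒≥ p)))

  run : (ℕ → ℕ) → Word n → ℕ → ℕ
  run F []      = F
  run F (i ∷ Q) = run (bump (toℕ i) F) Q

  count : ℕ → Word n → ℕ
  count i []      = 0
  count i (j ∷ Q) = δ (toℕ j) i + count i Q

  run-low : ∀ Q i F → i ≤ n′ → run F Q (low i) ≡ count i Q + F (low i)
  run-low []      i F p = refl
  run-low (j ∷ Q) i F p = trans (run-low Q i (bump (toℕ j) F) p)
    (lin 4 (λ a b c d → a ≈ b ⊕ c ⇒ d ⊕ a ≈ b ⊕ d ⊕ c) 11 101 _ (δ (toℕ j) i) (F (low i)) _
      (bump-low (toℕ j) i F (letter≤ j) p))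

  run-high : ∀ Q i F → i ≤ n′ → run F Q (high i) ≡ count i Q + F (high i)
  run-high []      i F p = refl
  run-high (j ∷ Q) i F p = trans (run-high Q i (bump (toℕ j) F) p)
    (lin 4 (λ a b c d → a ≈ b ⊕ c ⇒ d ⊕ a ≈ b ⊕ d ⊕ c) 11 101 _ (δ (toℕ j) i) (F (high i)) _
      (bump-high (toℕ j) i F (letter≤ j) p))

  -- The second component is the first coordinate of the point that this letter reaches over its low
  -- boundary; with the letter it determines the diagonal.
  label : (F : ℕ → ℕ) (Q : Word n) → Fin (length Q) → Fin n × ℕ
  label F (i ∷ Q) Fin.zero    = i , suc (F (low (toℕ i)))
  label F (i ∷ Q) (Fin.suc p) = label (bump (toℕ i) F) Q p

  label-range : ∀ Q F p → let (i , y) = label F Q p in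
    F (low (toℕ i)) < y × y ≤ count (toℕ i) Q + F (low (toℕ i))
  label-range (j ∷ Q) F Fin.zero = ≤-refl , first
    where
    first : suc (F (low (toℕ j))) ≤ count (toℕ j) (j ∷ Q) + F (low (toℕ j))
    first = lin 3 (λ a b c → a ≈ κ 1 ⇒ b ≺ a ⊕ c ⊕ b) 101 0 _ _ _ (δ-yes {toℕ j} refl)
  label-range (j ∷ Q) F (Fin.suc p) with label (bump (toℕ j) F) Q p | label-range Q (bump (toℕ j) F) p
  ... | i , y | lo , hi = ≤-<-trans (bump-≤ (toℕ j) F (low (toℕ i))) lo
      , lin 5 (λ a b c d e → a ≼ b ⊕ c ⇒ c ≈ d ⊕ e ⇒ a ≼ d ⊕ b ⊕ e) 1011 0 _ _ _ (δ (toℕ j) (toℕ i))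
        (F (low (toℕ i))) hi (bump-low (toℕ j) (toℕ i) F (letter≤ j) (letter≤ i))

  label-fresh : ∀ Q j F q → label (bump (toℕ j) F) Q q ≡ (j , suc (F (low (toℕ j)))) → ⊥
  label-fresh Q j F q e with label (bump (toℕ j) F) Q q | label-range Q (bump (toℕ j) F) q
  label-fresh Q j F q refl | _ | lo , _ =
    lin 3 (λ a b c → a ≺ ς b ⇒ a ≈ c ⊕ b ⇒ c ≈ κ 1 ⇒ ↯) 11010 0 _ _ _ lo (bump-low (toℕ j) (toℕ j) F (letter≤ j)
      (letter≤ j)) (δ-yes {toℕ j} refl)

  label-injective : ∀ Q F p q → label F Q p ≡ label F Q q → p ≡ q
  label-injective (j ∷ Q) F Fin.zero    Fin.zero    e = refl
  label-injective (j ∷ Q) F Fin.zero    (Fin.suc q) e = ⊥-elim (label-fresh Q j F q (sym e))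
  label-injective (j ∷ Q) F (Fin.suc p) Fin.zero    e = ⊥-elim (label-fresh Q j F p e)
  label-injective (j ∷ Q) F (Fin.suc p) (Fin.suc q) e = cong Fin.suc (label-injective Q (bump (toℕ j) F) p q e)

  label-surjective : ∀ Q F (i : Fin n) y → F (low (toℕ i)) < y → y ≤ count (toℕ i) Q + F (low (toℕ i)) →
    Σ (Fin (length Q)) λ p → label F Q p ≡ (i , y)
  label-surjective [] F i y lo hi = ⊥-elim (<⇒≱ lo hi)
  label-surjective (j ∷ Q) F i y lo hi with toℕ j ≟ toℕ i | bump-low (toℕ j) (toℕ i) F (letter≤ j) (letter≤ i)
  ... | no r  | b = later (label-surjective Q (bump (toℕ j) F) i y (subst (_< y) (sym b) lo)
    (subst (λ z → y ≤ count (toℕ i) Q + z) (sym b) hi))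
    where
    later : _ → _
    later (p , e) = Fin.suc p , e
  ... | yes r | b with y ≟ suc (F (low (toℕ i)))
  ...   | yes e = Fin.zero , cong₂ _,_ (toℕ-injective r) (trans (cong (suc ∘ F ∘ low) r) (sym e))
  ...   | no e  = later (label-surjective Q (bump (toℕ j) F) i y (subst (_< y) (sym b) (≤∧≢⇒< lo (≢-sym e)))
    (lin 4 (λ a b c d → a ≼ ς (b ⊕ c) ⇒ d ≈ ς c ⇒ a ≼ b ⊕ d) 1101 0 _ _ _ _ hi b))
    where
    later : _ → _
    later (p , e) = Fin.suc p , e

  Admissible : (ℕ → ℕ) → Word n → Set
  Admissible F []      = ⊤
  Admissible F (i ∷ Q) =
    Corner N F (n′ + toℕ i) × Corner N F (n′ ∸ toℕ i) × Admissible (bump (toℕ i) F) Q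

  -- Central symmetry of the frontier: if the point over `low i` is (a , a + m - i), the one over
  -- `high i` is (a - i , a + m), its half-turn with the ends exchanged.
  Balanced : (ℕ → ℕ) → Set
  Balanced F = ∀ i → i ≤ n′ → F (high i) + i ≡ F (low i)

  balanced-bump : ∀ j {F} → j ≤ n′ → Balanced F → Balanced (bump j F)
  balanced-bump j {F} p bal i q = lin 6 (λ a b c d e f → a ≈ b ⊕ c ⇒ d ≈ b ⊕ e ⇒ e ⊕ f ≈ c ⇒ d ⊕ f ≈ a) 1001011
    110101 _ _ _ _ _ _ (bump-low j i F p q) (bump-high j i F p q) (bal i q)

  -- The flag says that i comes before i + 1.
  data Alternating (i : ℕ) : Bool → Word n → Set where
    []    : ∀ {b} → Alternating i b []
    lower : ∀ {j Q} → toℕ j ≡ i → Alternating i false Q → Alternating i true (j ∷ Q)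
    upper : ∀ {j Q} → toℕ j ≡ suc i → Alternating i true Q → Alternating i false (j ∷ Q)
    skip  : ∀ {b j Q} → toℕ j ≢ i → toℕ j ≢ suc i → Alternating i b Q → Alternating i b (j ∷ Q)

  -- The slope of the frontier between neighbouring boundaries records which of the letters i and i
  -- + 1 comes next. This is the only trace of the choice of Coxeter element.
  Slopes : (ℕ → ℕ) → Word n → Set
  Slopes F Q = ∀ i → suc i ≤ n′ → Σ Bool λ b → Alternating i b Q ×
    F (low (suc i)) ≡ ⌊ b ⌋ + F (low i) × F (high i) ≡ ⌊ not b ⌋ + F (high (suc i))

  slopes-lower : ∀ {F j Q} → Slopes F (j ∷ Q) → suc (toℕ j) ≤ n′ →
    F (low (suc (toℕ j))) ≡ suc (F (low (toℕ j))) × F (high (toℕ j)) ≡ F (high (suc (toℕ j)))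
  slopes-lower {F} {j} sl p with sl (toℕ j) p
  ... | true  , _ , e₁ , e₂ = e₁ , e₂
  ... | false , upper e _ , _ = ⊥-elim (1+n≢n (sym e))
  ... | false , skip e _ _ , _ = ⊥-elim (e refl)

  slopes-upper : ∀ {F j Q i} → Slopes F (j ∷ Q) → toℕ j ≡ suc i → suc i ≤ n′ →
    F (low (suc i)) ≡ F (low i) × F (high i) ≡ suc (F (high (suc i)))
  slopes-upper {F} {j} {i = i} sl e p with sl i p
  ... | false , _ , e₁ , e₂ = e₁ , e₂
  ... | true , lower e′ _ , _ = ⊥-elim (1+n≢n (trans (sym e) e′))
  ... | true , skip _ e′ _ , _ = ⊥-elim (e′ e)

  low-suc : ∀ {i} → suc i ≤ n′ → suc (low (suc i)) ≡ low i
  low-suc {i} p = lin 4 (λ a b c d → a ⊕ ς b ≈ c ⇒ d ⊕ b ≈ c ⇒ ς (ς a) ≈ ς d) 1101 10011 _ _ _ _ (m∸n+n≡m p)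
    (m∸n+n≡m (<⇒≤ p))

  high-suc : ∀ i → high (suc i) ≡ suc (high i)
  high-suc i = cong suc (+-suc n′ i)

  -- The head letter comes before both neighbouring letters, which fixes the slopes on both sides of
  -- its boundary. For the letter 0 the left neighbour of boundary n is `low 1`, so the low half of
  -- `Slopes` is used there.
  corner-high : ∀ {F j Q} → Slopes F (j ∷ Q) → Corner N F (n′ + toℕ j)
  corner-high {F} {j} sl = right , left (toℕ j) refl
    where
    right : suc (suc (n′ + toℕ j)) < N → F (suc (suc (n′ + toℕ j))) ≡ F (suc (n′ + toℕ j))
    right p = trans (cong F (sym (high-suc (toℕ j))))
      (sym (proj₂ (slopes-lower {F} {j} sl (lin 2 (λ a b → ς (ς (a ⊕ b)) ≺ ς (a ⊕ ς a) ⇒ b ≺ a) 11 0 _ _ p))))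
    left : ∀ i → toℕ j ≡ i → 0 < n′ + toℕ j → F (n′ + toℕ j) ≡ suc (F (suc (n′ + toℕ j)))
    left zero e p = trans (cong F site₀)
      (trans (proj₁ (slopes-lower {F} {j} sl (lin 2 (λ a b → a ≈ κ 0 ⇒ κ 0 ≺ b ⊕ a ⇒ a ≺ b) 211 0 _ _ e p)))
      (cong (suc ∘ F) site₁))
      where
      site₀ : n′ + toℕ j ≡ low (suc (toℕ j))
      site₀ = lin 3 (λ a b c → a ⊕ ς b ≈ c ⇒ b ≈ κ 0 ⇒ c ⊕ b ≈ ς a) 10021 1001 _ _ _ (m∸n+n≡m {n′} {suc (toℕ j)}
        (lin 2 (λ a b → a ≈ κ 0 ⇒ κ 0 ≺ b ⊕ a ⇒ a ≺ b) 211 0 _ _ e p)) e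
      site₁ : low (toℕ j) ≡ suc (n′ + toℕ j)
      site₁ = lin 3 (λ a b c → a ⊕ b ≈ c ⇒ b ≈ κ 0 ⇒ ς a ≈ ς (c ⊕ b)) 1001 10021 _ _ _ (m∸n+n≡m (letter≤ j)) e
    left (suc i) e p = trans (cong F site₀)
      (trans (proj₂ (slopes-upper {F} {j} sl e (subst (_≤ n′) e (letter≤ j)))) (cong (λ z → suc (F (high z)))
      (sym e)))
      where
      site₀ : n′ + toℕ j ≡ high i
      site₀ = lin 3 (λ a b c → a ≈ ς b ⇒ c ⊕ a ≈ ς (c ⊕ b)) 11 101 _ _ _ e

  corner-low : ∀ {F j Q} → Slopes F (j ∷ Q) → Corner N F (n′ ∸ toℕ j)
  corner-low {F} {j} sl = right (toℕ j) refl , left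
    where
    right : ∀ i → toℕ j ≡ i → suc (suc (n′ ∸ toℕ j)) < N → F (suc (suc (n′ ∸ toℕ j))) ≡ F (suc (n′ ∸ toℕ j))
    right zero e p = trans (cong F site₀)
      (trans (sym (proj₂ (slopes-lower {F} {j} sl (lin 3 (λ a b c → ς (ς a) ≺ ς (b ⊕ ς b) ⇒ c ≈ κ 0 ⇒ c ≺ b)
      1022 0 _ _ _ p e)))) (cong F site₁))
      where
      site₀ : suc (suc (n′ ∸ toℕ j)) ≡ high (suc (toℕ j))
      site₀ = lin 3 (λ a b c → a ⊕ b ≈ c ⇒ b ≈ κ 0 ⇒ ς (ς a) ≈ ς (c ⊕ ς b)) 1001 10021 _ _ _
        (m∸n+n≡m (letter≤ j)) e
      site₁ : high (toℕ j) ≡ suc (n′ ∸ toℕ j)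
      site₁ = lin 3 (λ a b c → a ⊕ b ≈ c ⇒ b ≈ κ 0 ⇒ ς (c ⊕ b) ≈ ς a) 10021 1001 _ _ _ (m∸n+n≡m (letter≤ j)) e
    right (suc i) e p = trans (cong F site₀) (trans (sym (proj₁ (slopes-upper {F} {j} sl e i≤)))
      (cong (λ z → F (low z)) (sym e)))
      where
      i≤ : suc i ≤ n′
      i≤ = subst (_≤ n′) e (letter≤ j)
      site₀ : suc (suc (n′ ∸ toℕ j)) ≡ low i
      site₀ = trans (cong (λ z → suc (low z)) e) (low-suc i≤)
    left : 0 < n′ ∸ toℕ j → F (n′ ∸ toℕ j) ≡ suc (F (suc (n′ ∸ toℕ j)))
    left p = trans (cong F site₀) (proj₁ (slopes-lower {F} {j} sl j<))
      where
      j< : suc (toℕ j) ≤ n′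
      j< = lin 3 (λ a b c → κ 0 ≺ a ⇒ a ⊕ b ≈ c ⇒ b ≺ c) 1011 0 _ _ _ p (m∸n+n≡m (letter≤ j))
      site₀ : n′ ∸ toℕ j ≡ low (suc (toℕ j))
      site₀ = suc-injective (sym (low-suc j<))

  slopes-bump : ∀ {F j Q} → Slopes F (j ∷ Q) → Slopes (bump (toℕ j) F) Q
  slopes-bump {F} {j} {Q} sl i p = go (sl i p)
    where
    bl : ∀ i → i ≤ n′ → bump (toℕ j) F (low i) ≡ δ (toℕ j) i + F (low i)
    bl i = bump-low (toℕ j) i F (letter≤ j)
    bh : ∀ i → i ≤ n′ → bump (toℕ j) F (high i) ≡ δ (toℕ j) i + F (high i)
    bh i = bump-high (toℕ j) i F (letter≤ j)
    go : (Σ Bool λ b → Alternating i b (j ∷ Q) × F (low (suc i)) ≡ ⌊ b ⌋ + F (low i) × F (high i) ≡ ⌊ not b ⌋ +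
      F (high (suc i))) →
      Σ Bool λ b → Alternating i b Q × bump (toℕ j) F (low (suc i)) ≡ ⌊ b ⌋ + bump (toℕ j) F (low i) ×
        bump (toℕ j) F (high i) ≡ ⌊ not b ⌋ + bump (toℕ j) F (high (suc i))
    go (true , lower e alt , e₁ , e₂) = false , alt
      , lin 6 (λ a b c d e f → a ≈ b ⊕ c ⇒ d ≈ e ⊕ f ⇒ c ≈ κ 1 ⊕ f ⇒ e ≈ κ 1 ⇒ b ≈ κ 0 ⇒ a ≈ κ 0 ⊕ d) 1100110011
        10011001001 _ _ _ _ _ _ (bl (suc i) p) (bl i (<⇒≤ p)) e₁ (δ-yes e)
        (δ-no (λ q → 1+n≢n (trans (sym q) e)))
      , lin 6 (λ a b c d e f → a ≈ b ⊕ c ⇒ d ≈ e ⊕ f ⇒ f ≈ κ 0 ⊕ c ⇒ e ≈ κ 1 ⇒ b ≈ κ 0 ⇒ d ≈ κ 1 ⊕ a)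
        10010101001 1101010011 _ _ _ _ _ _ (bh (suc i) p) (bh i (<⇒≤ p)) e₂ (δ-yes e)
        (δ-no (λ q → 1+n≢n (trans (sym q) e)))
    go (false , upper e alt , e₁ , e₂) = true , alt
      , lin 6 (λ a b c d e f → a ≈ b ⊕ c ⇒ d ≈ e ⊕ f ⇒ c ≈ κ 0 ⊕ f ⇒ b ≈ κ 1 ⇒ e ≈ κ 0 ⇒ a ≈ κ 1 ⊕ d) 1100101101
        10011010011 _ _ _ _ _ _ (bl (suc i) p) (bl i (<⇒≤ p)) e₁ (δ-yes e)
        (δ-no (λ q → 1+n≢n (trans (sym e) q)))
      , lin 6 (λ a b c d e f → a ≈ b ⊕ c ⇒ d ≈ e ⊕ f ⇒ f ≈ κ 1 ⊕ c ⇒ b ≈ κ 1 ⇒ e ≈ κ 0 ⇒ d ≈ κ 0 ⊕ a)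
        10010110011 1101001101 _ _ _ _ _ _ (bh (suc i) p) (bh i (<⇒≤ p)) e₂ (δ-yes e)
        (δ-no (λ q → 1+n≢n (trans (sym e) q)))
    go (b , skip x y alt , e₁ , e₂) = b , alt
      , lin 7 (λ a b c d e f g → a ≈ b ⊕ c ⇒ d ≈ e ⊕ f ⇒ c ≈ g ⊕ f ⇒ e ≈ κ 0 ⇒ b ≈ κ 0 ⇒ a ≈ g ⊕ d) 1100100011
        10011001001 _ _ _ _ _ _ _ (bl (suc i) p) (bl i (<⇒≤ p)) e₁ (δ-no x) (δ-no y)
      , lin 7 (λ a b c d e f g → a ≈ b ⊕ c ⇒ d ≈ e ⊕ f ⇒ f ≈ g ⊕ c ⇒ e ≈ κ 0 ⇒ b ≈ κ 0 ⇒ d ≈ g ⊕ a) 10010101001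
        1101000011 _ _ _ _ _ _ _ (bh (suc i) p) (bh i (<⇒≤ p)) e₂ (δ-no x) (δ-no y)

  slopes⇒admissible : ∀ Q {F} → Slopes F Q → Admissible F Q
  slopes⇒admissible []      sl = tt
  slopes⇒admissible (j ∷ Q) {F} sl =
    corner-high {F} {j} {Q} sl , corner-low {F} {j} {Q} sl , slopes⇒admissible Q (slopes-bump {F} {j} {Q} sl)

  before : ℕ → Word n → Bool
  before i []      = true
  before i (j ∷ Q) with toℕ j ≟ i
  ... | yes _ = true
  ... | no _ with toℕ j ≟ suc i
  ...   | yes _ = false
  ...   | no _  = before i Q

  alternating-none : ∀ {i b} Q R → count i Q ≡ 0 → count (suc i) Q ≡ 0 → Alternating i b R → Alternating i b
    (Q ++ R)
  alternating-none []      R p q alt = alt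
  alternating-none {i} (j ∷ Q) R p q alt with toℕ j ≟ i | toℕ j ≟ suc i
  ... | no x | no y = skip x y (alternating-none Q R p q alt)

  alternating-upper : ∀ {i} Q R → count i Q ≡ 0 → count (suc i) Q ≡ 1 → Alternating i true R → Alternating i
    false (Q ++ R)
  alternating-upper {i} (j ∷ Q) R p q alt with toℕ j ≟ i | toℕ j ≟ suc i
  ... | no x | yes y = upper y (alternating-none Q R p (suc-injective q) alt)
  ... | no x | no y  = skip x y (alternating-upper Q R p q alt)

  alternating-lower : ∀ {i} Q R → count i Q ≡ 1 → count (suc i) Q ≡ 0 → Alternating i false R → Alternating i
    true (Q ++ R)
  alternating-lower {i} (j ∷ Q) R p q alt with toℕ j ≟ i | toℕ j ≟ suc i
  ... | yes x | no y = lower x (alternating-none Q R (suc-injective p) q alt)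
  ... | no x | no y  = skip x y (alternating-lower Q R p q alt)

  alternating-both : ∀ {i} Q R → count i Q ≡ 1 → count (suc i) Q ≡ 1 → Alternating i (before i Q) R →
    Alternating i (before i Q) (Q ++ R)
  alternating-both {i} (j ∷ Q) R p q alt with toℕ j ≟ i
  ... | yes x with toℕ j ≟ suc i
  ...   | no y = lower x (alternating-upper Q R (suc-injective p) q alt)
  ...   | yes y = ⊥-elim (1+n≢n (trans (sym y) x))
  alternating-both {i} (j ∷ Q) R p q alt | no x with toℕ j ≟ suc i
  ...   | yes y = upper y (alternating-lower Q R p (suc-injective q) alt)
  ...   | no y  = skip x y (alternating-both Q R p q alt)

  alternating-power : ∀ {i} c t → count i c ≡ 1 → count (suc i) c ≡ 1 →
    Alternating i (before i c) (concat (replicate t c))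
  alternating-power c zero    p q = []
  alternating-power c (suc t) p q = alternating-both c _ p q (alternating-power c t p q)

  count-↭ : ∀ i {P Q : Word n} → P ↭ Q → count i P ≡ count i Q
  count-↭ i Perm.refl         = refl
  count-↭ i (prep x p)        = cong (δ (toℕ x) i +_) (count-↭ i p)
  count-↭ i (swap {P} {Q} x y p) = lin 4 (λ a b c d → a ≈ b ⇒ c ⊕ (d ⊕ a) ≈ d ⊕ (c ⊕ b)) 11 101 _ _
    (δ (toℕ x) i) (δ (toℕ y) i) (count-↭ i p)
  count-↭ i (Perm.trans p q)  = trans (count-↭ i p) (count-↭ i q)

  count-tabulate : ∀ {l} (f : Fin l → Fin n) s i → (∀ j → toℕ (f j) ≡ s + toℕ j) → s ≤ i → i < s + l →
    count i (tabulate f) ≡ 1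
  count-tabulate-none : ∀ {l} (f : Fin l → Fin n) s i → (∀ j → toℕ (f j) ≡ s + toℕ j) → i < s →
    count i (tabulate f) ≡ 0
  count-tabulate {zero}  f s i eq p q = ⊥-elim (lin 2 (λ a b → a ≼ b ⇒ b ≺ a ⊕ κ 0 ⇒ ↯) 11 0 _ _ p q)
  count-tabulate {suc l} f s i eq p q with toℕ (f Fin.zero) ≟ i
  ... | yes r = cong suc (count-tabulate-none (f ∘ Fin.suc) (suc s) i
    (λ j → trans (eq (Fin.suc j)) (+-suc s (toℕ j)))
                  (lin 3 (λ a b c → a ≈ b ⇒ a ≈ c ⇒ b ≺ ς c) 10011 0 _ _ _ r
                    (trans (eq Fin.zero) (+-identityʳ s))))
  ... | no r  = count-tabulate (f ∘ Fin.suc) (suc s) i (λ j → trans (eq (Fin.suc j)) (+-suc s (toℕ j)))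
                  (≤∧≢⇒< p (λ e → r (trans (eq Fin.zero) (trans (+-identityʳ s) e))))
                    (lin 3 (λ a b c → a ≺ b ⊕ ς c ⇒ a ≺ ς b ⊕ c) 11 0 _ _ _ q)
  count-tabulate-none {zero}  f s i eq p = refl
  count-tabulate-none {suc l} f s i eq p = cong₂ _+_ (δ-no (λ e → lin 3 (λ a b c → a ≈ b ⇒ a ≈ c ⇒ b ≺ c ⇒ ↯)
    1101 0 _ _ _ e (trans (eq Fin.zero) (+-identityʳ s)) p))
    (count-tabulate-none (f ∘ Fin.suc) (suc s) i (λ j → trans (eq (Fin.suc j)) (+-suc s (toℕ j))) (m≤n⇒m≤1+n p))

  count-coxeter : ∀ {c : Word n} → c ↭ allFin n → ∀ i → i ≤ n′ → count i c ≡ 1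
  count-coxeter p i q = trans (count-↭ i p) (count-tabulate (λ j → j) 0 i (λ _ → refl) z≤n (s≤s q))

  count-++ : ∀ i P Q → count i (P ++ Q) ≡ count i P + count i Q
  count-++ i []      Q = refl
  count-++ i (j ∷ P) Q = trans (cong (δ (toℕ j) i +_) (count-++ i P Q)) (sym (+-assoc (δ (toℕ j) i) _ _))

  count-power : ∀ i c t → count i c ≡ 1 → count i (concat (replicate t c)) ≡ t
  count-power i c zero    p = refl
  count-power i c (suc t) p = trans (count-++ i c _) (cong₂ _+_ p (count-power i c t p))

  module Start (base : ℕ) (n≤base : n ≤ base) (c : Word n) (once : ∀ i → i ≤ n′ → count i c ≡ 1) where

    offset : ℕ → ℕ
    offset zero    = base
    offset (suc i) = ⌊ before i c ⌋ + offset i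

    base≤offset : ∀ i → base ≤ offset i
    base≤offset zero    = ≤-refl
    base≤offset (suc i) = ≤-trans (base≤offset i) (m≤n+m _ _)

    -- The argument of `offset` is the distance from x to the centre n, hence the letter with
    -- boundary x; to the right of the centre that letter is subtracted, as `Balanced` demands. The
    -- bound n ≤ `base` keeps the subtraction exact.
    start : ℕ → ℕ
    start x = offset ((n ∸ x) + (x ∸ n)) ∸ (x ∸ n)

    start-low : ∀ i → i ≤ n′ → start (low i) ≡ offset i
    start-low i p = trans (cong (λ z → offset ((n ∸ low i) + z) ∸ z) (m≤n⇒m∸n≡0 (s≤s (m∸n≤m n′ i))))
      (cong offset (trans (+-identityʳ _) (m∸[m∸n]≡n p)))

    start-high : ∀ i → i ≤ n′ → start (high i) + i ≡ offset i
    start-high i p = trans (cong₂ (λ u v → offset (u + v) ∸ v + i) (m≤n⇒m∸n≡0 {n} {high i} (s≤s (m≤m+n n′ i)))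
      (m+n∸m≡n n i))
      (m∸n+n≡m (≤-trans (≤-trans p (n≤1+n n′)) (≤-trans n≤base (base≤offset i))))

    start-balanced : Balanced start
    start-balanced i p = trans (start-high i p) (sym (start-low i p))

    start-≥ : ∀ x → 0 < x → x < N → base ≤ start x + n
    start-≥ x p q with boundary x p q
    ... | i , i≤ , inj₁ refl = lin 4 (λ a b c d → a ≈ b ⇒ c ≼ b ⇒ c ≼ a ⊕ ς d) 1011 0 _ _ _ _ (start-low i i≤)
      (base≤offset i)
    ... | i , i≤ , inj₂ refl = lin 5 (λ a b c d e → a ⊕ b ≈ c ⇒ d ≼ c ⇒ b ≼ e ⇒ d ≼ a ⊕ ς e) 10111 0 _ _ _ _ _
      (start-high i i≤) (base≤offset i) i≤

    slope-low : ∀ i → suc i ≤ n′ → start (low (suc i)) ≡ ⌊ before i c ⌋ + start (low i)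
    slope-low i p = trans (start-low (suc i) p) (cong (⌊ before i c ⌋ +_) (sym (start-low i (<⇒≤ p))))

    slope-high : ∀ i → suc i ≤ n′ → start (high i) ≡ ⌊ not (before i c) ⌋ + start (high (suc i))
    slope-high i p = lin 6 (λ a b c d e f → a ⊕ b ≈ c ⇒ d ⊕ ς b ≈ e ⊕ c ⇒ e ⊕ f ≈ κ 1 ⇒ a ≈ f ⊕ d) 110101
      1001011 _ _ _ _ _ _ (start-high i (<⇒≤ p)) (start-high (suc i) p) (complement (before i c))
      where
      complement : ∀ b → ⌊ b ⌋ + ⌊ not b ⌋ ≡ 1
      complement true  = refl
      complement false = refl

    start-staircase : Staircase N start
    start-staircase = record { down = λ x p q → proj₁ (both x p q) ; gentle = λ x p q → proj₂ (both x p q) }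
      where
      ⌊⌋≤1 : ∀ b → ⌊ b ⌋ ≤ 1
      ⌊⌋≤1 true  = ≤-refl
      ⌊⌋≤1 false = z≤n
      both : ∀ x → 0 < x → suc x < N → start (suc x) ≤ start x × start x ≤ suc (start (suc x))
      both x p q with x <? n
      ... | yes x<n = subst (λ z → start z ≤ start x × start x ≤ suc (start z)) nxt
            (subst (λ z → start (low i) ≤ start z × start z ≤ suc (start (low i))) here
              (lin 3 (λ a b c → a ≈ b ⊕ c ⇒ c ≼ a) 101 0 _ _ _ (slope-low i i<) , lin 3
                (λ a b c → a ≈ b ⊕ c ⇒ b ≼ κ 1 ⇒ a ≼ ς c) 111 0 _ _ _ (slope-low i i<) (⌊⌋≤1 (before i c))))
        where
        i = n′ ∸ x
        eq : n′ ∸ x + x ≡ n′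
        eq = m∸n+n≡m (s≤s⁻¹ x<n)
        i< : suc i ≤ n′
        i< = lin 3 (λ a b c → a ⊕ b ≈ c ⇒ κ 1 ≼ b ⇒ a ≺ c) 111 0 _ _ _ eq p
        here : low (suc i) ≡ x
        here = lin 4 (λ a b c d → a ⊕ ς b ≈ c ⇒ b ⊕ d ≈ c ⇒ ς a ≈ d) 1101 10011 _ _ _ _ (m∸n+n≡m i<) eq
        nxt : low i ≡ suc x
        nxt = trans (sym (low-suc i<)) (cong suc here)
      ... | no x≮n = subst (λ z → start z ≤ start x × start x ≤ suc (start z)) nxt
            (subst (λ z → start (high (suc i)) ≤ start z × start z ≤ suc (start (high (suc i)))) here
              (lin 3 (λ a b c → a ≈ b ⊕ c ⇒ c ≼ a) 101 0 _ _ _ (slope-high i i<) , lin 3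
                (λ a b c → a ≈ b ⊕ c ⇒ b ≼ κ 1 ⇒ a ≼ ς c) 111 0 _ _ _ (slope-high i i<)
                (⌊⌋≤1 (not (before i c)))))
        where
        i = x ∸ n
        eq : x ∸ n + n ≡ x
        eq = m∸n+n≡m (≮⇒≥ x≮n)
        i< : suc i ≤ n′
        i< = lin 3 (λ a b c → a ⊕ ς b ≈ c ⇒ ς c ≺ ς (b ⊕ ς b) ⇒ a ≺ b) 111 0 _ _ _ eq q
        here : high i ≡ x
        here = lin 3 (λ a b c → a ⊕ ς b ≈ c ⇒ ς (b ⊕ a) ≈ c) 11 101 _ _ _ eq
        nxt : high (suc i) ≡ suc x
        nxt = trans (high-suc i) (cong suc here)

    start-slopes : ∀ t → Slopes start (concat (replicate t c))
    start-slopes t i p = before i c , alternating-power c t (once i (<⇒≤ p)) (once (suc i) p) , slope-low i p ,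
      slope-high i p

    start-admissible : ∀ t → Admissible start (concat (replicate t c))
    start-admissible t = slopes⇒admissible _ (start-slopes t)

    run-start : ∀ t x → 0 < x → x < N → run start (concat (replicate t c)) x ≡ t + start x
    run-start t x p q with boundary x p q
    ... | i , i≤ , inj₁ refl = trans (run-low (concat (replicate t c)) i start i≤)
      (cong (_+ start (low i)) (count-power i c t (once i i≤)))
    ... | i , i≤ , inj₂ refl = trans (run-high (concat (replicate t c)) i start i≤) (cong (_+ start (high i))
      (count-power i c t (once i i≤)))

    start-mirror : ∀ x y → 0 < x → x < N → x + y ≡ N → start x + x ≡ start y + n
    start-mirror x y p q e with boundary x p q
    ... | i , i≤ , inj₁ refl = subst (λ z → start (low i) + low i ≡ start z + n) site
          (lin 5 (λ a b c d e → a ⊕ b ≈ c ⇒ d ⊕ b ≈ e ⇒ c ⊕ ς d ≈ a ⊕ ς e) 10011 1101 _ _ _ _ _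
            (start-balanced i i≤) (m∸n+n≡m i≤))
      where
      site : high i ≡ y
      site = lin 4 (λ a b c d → ς a ⊕ b ≈ ς (c ⊕ ς c) ⇒ a ⊕ d ≈ c ⇒ ς (c ⊕ d) ≈ b) 10011 1101 _ _ _ _ e
        (m∸n+n≡m i≤)
    ... | i , i≤ , inj₂ refl = subst (λ z → start (high i) + high i ≡ start z + n) site
          (lin 4 (λ a b c d → a ⊕ b ≈ c ⇒ a ⊕ ς (d ⊕ b) ≈ c ⊕ ς d) 11 101 _ _ _ _ (start-balanced i i≤))
      where
      site : low i ≡ y
      site = lin 4 (λ a b c d → ς (a ⊕ b) ⊕ c ≈ ς (a ⊕ ς a) ⇒ d ⊕ b ≈ a ⇒ ς d ≈ c) 10011 1101 _ _ _ _ e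
        (m∸n+n≡m i≤)

-- Heights along a word: arbitrary subwords and the greedy subword

module Evolution (n′ k : ℕ) (U : Fin (suc n′) → ℕ → Bool) where
  open SignedArrays n′
  open Frontiers n′

  m : ℕ
  m = n + k

  -- The letter i processed at frontier value y is the pair of diagonals
  -- [y , y + m - i] and [y - i , y + m].
  data Mark (a b : ℕ) : Set where
    low-mark  : ∀ i y → U i y ≡ true → a ≡ y → b + toℕ i ≡ y + m → Mark a b
    high-mark : ∀ i y → U i y ≡ true → a + toℕ i ≡ y → b ≡ y + m → Mark a b

  U-cong : ∀ i j y z → toℕ i ≡ toℕ j → y ≡ z → U i y ≡ true → U j z ≡ true
  U-cong i j y z p refl u = subst (λ l → U l y ≡ true) (toℕ-injective p) u

  mark-at-low : ∀ {a b} i → Mark a b → b + toℕ i ≡ a + m → U i a ≡ true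
  mark-at-low {a} i (low-mark j y u e₁ e₂) p = U-cong j i y a
    (lin 7 (λ a b c d e f g → a ≈ b ⇒ c ⊕ d ≈ b ⊕ ς (e ⊕ f) ⇒ c ⊕ g ≈ a ⊕ ς (e ⊕ f) ⇒ d ≈ g) 1001101 110011 _ _
    _ _ n′ k _ e₁ e₂ p) (sym e₁) u
  mark-at-low {a} i (high-mark j y u e₁ e₂) p = U-cong j i y a
    (lin 7 (λ a b c d e f g → a ⊕ b ≈ c ⇒ d ≈ c ⊕ ς (e ⊕ f) ⇒ d ⊕ g ≈ a ⊕ ς (e ⊕ f) ⇒ b ≈ g) 110121 110011 _ _ _
    _ n′ k _ e₁ e₂ p) (lin 7 (λ a b c d e f g → a ⊕ b ≈ c ⇒ d ≈ c ⊕ ς (e ⊕ f) ⇒ d ⊕ g ≈ a ⊕ ς (e ⊕ f) ⇒ c ≈ a)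
    10011 100001 _ _ _ _ n′ k _ e₁ e₂ p) u

  mark-at-high : ∀ {a b y} i → Mark a b → a + toℕ i ≡ y → b ≡ y + m → U i y ≡ true
  mark-at-high {y = z} i (low-mark j y u e₁ e₂) p q = U-cong j i y z
    (lin 8 (λ a b c d e f g h → a ≈ b ⇒ c ⊕ d ≈ b ⊕ ς (e ⊕ f) ⇒ a ⊕ g ≈ h ⇒ c ≈ h ⊕ ς (e ⊕ f) ⇒ d ≈ g) 100101101
    100101101 _ _ _ _ n′ k _ _ e₁ e₂ p q) (lin 8 (λ a b c d e f g h → a ≈ b ⇒ c ⊕ d ≈ b ⊕ ς (e ⊕ f) ⇒
    a ⊕ g ≈ h ⇒ c ≈ h ⊕ ς (e ⊕ f) ⇒ b ≈ h) 100001001 100101 _ _ _ _ n′ k _ _ e₁ e₂ p q) u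
  mark-at-high {y = z} i (high-mark j y u e₁ e₂) p q = U-cong j i y z
    (lin 8 (λ a b c d e f g h → a ⊕ b ≈ c ⇒ d ≈ c ⊕ ς (e ⊕ f) ⇒ a ⊕ g ≈ h ⇒ d ≈ h ⊕ ς (e ⊕ f) ⇒ b ≈ g) 11010011
    100101101 _ _ _ _ n′ k _ _ e₁ e₂ p q) (lin 5 (λ a b c d e → a ≈ b ⊕ ς (c ⊕ d) ⇒ a ≈ e ⊕ ς (c ⊕ d) ⇒ b ≈ e)
    10011 1101 _ _ n′ k _ e₂ q) u

  marked : Fin n × ℕ → Bool
  marked (i , y) = U i y

  Total : ℕ → (ℕ → ℕ) → Set
  Total θ B = height B θ N + θ ≡ N

  total-id : ∀ {θ} → θ ≤ N → Total θ (λ y → y)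
  total-id {θ} p = trans (cong (_+ θ) (height-id θ N)) (m∸n+n≡m p)

  total-τ : ∀ {θ B} y → suc y < N → Total θ B → Total θ (B ∘ τ y)
  total-τ {θ} {B} y p t = trans (cong (_+ θ) (height-τ B θ y N (λ e → <-irrefl (sym e) p))) t

  low<N : ∀ i → low i < N
  low<N i = lin 2 (λ a b → a ≼ b ⇒ ς a ≺ ς (b ⊕ ς b)) 21 0 _ _ (m∸n≤m n′ i)

  high<N : ∀ {i} → i ≤ n′ → high i < N
  high<N p = lin 2 (λ a b → a ≼ b ⇒ ς (b ⊕ a) ≺ ς (b ⊕ ς b)) 11 0 _ _ p

  total-sw : ∀ {θ B} i → i ≤ n′ → Total θ B → Total θ (B ∘ sw i)
  total-sw {θ} {B} zero p t = total-τ {θ} {B} n′ (low<N 0) t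
  total-sw {θ} {B} (suc i) p t =
    total-τ {θ} {B ∘ τ (n′ ∸ suc i)} (n′ + suc i) (high<N p) (total-τ {θ} {B} (n′ ∸ suc i) (low<N (suc i)) t)

  isHeight : ∀ {θ B} → Total θ B → IsHeight N θ (height B θ)
  isHeight {θ} {B} t = record
    { zero-at-0 = refl
    ; mono      = height-step B θ
    ; lipschitz = height-step′ B θ
    ; total     = t
    }

  -- A letter is one elementary move of the staircase if it is 0, and otherwise two, the low one
  -- first. The invariant is abstract so that the lower and the upper estimate share this
  -- bookkeeping; `Ok` is the local condition that each needs.
  module Letter (θ : ℕ) (Inv : (ℕ → ℕ) → (ℕ → ℕ) → Set) (Ok : (ℕ → ℕ) → ℕ → (ℕ → ℕ) → (ℕ → ℕ) → Set)
    (step : ∀ {y F F′ h h′} → suc y < N → Corner N F y → Bump y F F′ → IsHeight N θ h′ →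
      (∀ x → x ≢ suc y → h′ x ≡ h x) → Ok F y h h′ → Inv F h → Inv F′ h′) where

    corner-after : ∀ {i F} → suc i ≤ n′ → Corner N F (n′ + suc i) → Corner N (bump₁ (n′ ∸ suc i) F) (n′ + suc i)
    corner-after {i} {F} p (c₁ , c₂) =
      (λ q → trans (same (suc (suc (n′ + suc i))) (n≤1+n _))
        (trans (c₁ q) (sym (same (suc (n′ + suc i)) ≤-refl)))) ,
      (λ q → trans (bump₁-other _ F (n′ + suc i) (λ e → <-irrefl (sym e) (far p)))
        (trans (c₂ q) (cong suc (sym (same _ ≤-refl)))))
      where
      same : ∀ x → suc (n′ + suc i) ≤ x → bump₁ (n′ ∸ suc i) F x ≡ F x
      same x q = bump₁-other _ F x (λ e → lin 4 (λ a b c d → a ≈ ς b ⇒ c ⊕ ς d ≺ a ⇒ b ≼ c ⇒ ↯) 111 0 _ _ _ _ e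
        q (m∸n≤m n′ (suc i)))

    keep : ∀ i {F B} → i ≤ n′ → Corner N F (n′ + i) → Corner N F (n′ ∸ i) → Total θ B →
      Ok F (n′ ∸ i) (height B θ) (height B θ) →
      (0 < i → Ok (bump₁ (n′ ∸ i) F) (n′ + i) (height B θ) (height B θ)) →
      Inv F (height B θ) → Inv (bump i F) (height B θ)
    keep zero    {F} {B} p ch cl t ok₁ ok₂ inv =
      step (low<N 0) cl (bump₁-Bump n′ F) (isHeight {θ} {B} t) (λ _ _ → refl) ok₁ inv
    keep (suc i) {F} {B} p ch cl t ok₁ ok₂ inv =
      step (high<N p) (corner-after p ch) (bump₁-Bump _ _) (isHeight {θ} {B} t) (λ _ _ → refl) (ok₂ (s≤s z≤n))
        (step (low<N (suc i)) cl (bump₁-Bump _ F) (isHeight {θ} {B} t) (λ _ _ → refl) ok₁ inv)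

    swapped : ∀ i {F B} → i ≤ n′ → Corner N F (n′ + i) → Corner N F (n′ ∸ i) → Total θ B →
      Ok F (n′ ∸ i) (height B θ) (height (B ∘ τ (n′ ∸ i)) θ) →
      (0 < i → Ok (bump₁ (n′ ∸ i) F) (n′ + i) (height (B ∘ τ (n′ ∸ i)) θ) (height (B ∘ τ (n′ ∸ i) ∘ τ (n′ + i))
        θ)) →
      Inv F (height B θ) → Inv (bump i F) (height (B ∘ sw i) θ)
    swapped zero    {F} {B} p ch cl t ok₁ ok₂ inv =
      step (low<N 0) cl (bump₁-Bump n′ F) (isHeight {θ} {B ∘ τ n′} (total-τ {θ} {B} n′ (low<N 0) t))
        (height-τ B θ n′) ok₁ inv
    swapped (suc i) {F} {B} p ch cl t ok₁ ok₂ inv =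
      step (high<N p) (corner-after p ch) (bump₁-Bump _ _)
        (isHeight {θ} {B ∘ τ (n′ ∸ suc i) ∘ τ (n′ + suc i)} (total-τ {θ} {B ∘ τ (n′ ∸ suc i)} _ (high<N p) t₁))
        (height-τ (B ∘ τ (n′ ∸ suc i)) θ (n′ + suc i)) (ok₂ (s≤s z≤n))
        (step (low<N (suc i)) cl (bump₁-Bump _ F) (isHeight {θ} {B ∘ τ (n′ ∸ suc i)} t₁)
          (height-τ B θ (n′ ∸ suc i)) ok₁ inv)
      where
      t₁ : Total θ (B ∘ τ (n′ ∸ suc i))
      t₁ = total-τ {θ} {B} (n′ ∸ suc i) (low<N (suc i)) t

  point-low : ∀ {i} (F : ℕ → ℕ) → i ≤ n′ → suc (F (low i)) + k + low i + i ≡ suc (F (low i)) + m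
  point-low {i} F p = lin 5 (λ a b c d e → a ⊕ b ≈ c ⇒ ς d ⊕ e ⊕ ς a ⊕ b ≈ ς d ⊕ ς (c ⊕ e)) 11 101 _ _ _ _ _
    (m∸n+n≡m p)

  point-high₁ : ∀ {i F} → 0 < i → i ≤ n′ → Balanced F → suc (bump₁ (n′ ∸ i) F (high i)) + i ≡ suc (F (low i))
  point-high₁ {i} {F} 0<i p bal =
    lin 4 (λ a b c d → a ≈ b ⇒ b ⊕ c ≈ d ⇒ ς a ⊕ c ≈ ς d) 1011 10101 _ _ _ _ (bump₁-other (n′ ∸ i) F (high i)
      (λ e → lin 3 (λ a b c → ς (a ⊕ b) ≈ ς c ⇒ c ≼ a ⇒ κ 0 ≺ b ⇒ ↯) 111 0 _ _ _ e (m∸n≤m n′ i) 0<i)) (bal i p)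

  point-high₂ : ∀ {i F} → 0 < i → i ≤ n′ → Balanced F →
    suc (bump₁ (n′ ∸ i) F (high i)) + k + high i ≡ suc (F (low i)) + m
  point-high₂ {i} {F} 0<i p bal = lin 5 (λ a b c d e → ς a ⊕ b ≈ ς c ⇒ ς a ⊕ d ⊕ ς (e ⊕ b) ≈ ς c ⊕ ς (e ⊕ d)) 11
    101 (bump₁ (n′ ∸ i) F (Frontiers.high n′ i)) i _ k n′ (point-high₁ {i} {F} 0<i p bal)

  module Lower (θ α β K : ℕ) (ga gb : ℕ → ℕ) (ch : LowerBound.IsChain N k θ α β K ga gb)
    (mk : ∀ r → r < K → Mark (ga (suc r)) (gb (suc r))) where
    open LowerBound N k θ α β K ga gb

    Ok : (ℕ → ℕ) → ℕ → (ℕ → ℕ) → (ℕ → ℕ) → Set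
    Ok F y h h′ = α ≤ F θ × (h′ (suc y) ≡ h (suc y) ⊎
      (∀ r → r < K → ga (suc r) ≡ suc (F (suc y)) → gb (suc r) ≡ suc (F (suc y)) + k + suc y → ⊥))

    open Letter θ Delayed Ok
      (λ y<N c b ih off ok → delayed-step ch y<N c b ih off (proj₁ ok) (proj₂ ok))

    -- A deleted letter leaves the heights unchanged, and a kept letter sits at corners that are not
    -- marked, hence are not chain points: the two alternatives of `Ok`.
    lower-run : ∀ Q {F B} S → (∀ p → S p ≡ true → marked (label F Q p) ≡ false) → Admissible F Q → Balanced F →
      Total θ B → α ≤ F θ → Delayed F (height B θ) → Delayed (run F Q) (height (B ∘ actN (restrict Q S)) θ)
    lower-run []      S avoid adm bal t αF del = del
    lower-run (i ∷ Q) {F} {B} S avoid (ch , cl , adm) bal t αF del with S Fin.zero in eq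
    ... | false = lower-run Q {bump (toℕ i) F} {B} (S ∘ Fin.suc) (λ p → avoid (Fin.suc p)) adm
      (balanced-bump (toℕ i) (letter≤ i) bal) t
          (≤-trans αF (bump-≤ (toℕ i) F θ))
          (keep (toℕ i) {F} {B} (letter≤ i) ch cl t (αF , inj₁ refl) (λ _ → ≤-trans αF (bump₁-≤ _ F θ) , inj₁
            refl) del)
    ... | true = lower-run Q {bump (toℕ i) F} {B ∘ sw (toℕ i)} (S ∘ Fin.suc) (λ p → avoid (Fin.suc p)) adm
      (balanced-bump (toℕ i) (letter≤ i) bal)
          (total-sw {θ} {B} (toℕ i) (letter≤ i) t) (≤-trans αF (bump-≤ (toℕ i) F θ))
          (swapped (toℕ i) {F} {B} (letter≤ i) ch cl t
            (αF , inj₂ (λ r r<K e₁ e₂ → unmarked (mark-at-low i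
              (subst₂ Mark e₁ e₂ (mk r r<K)) (point-low F (letter≤ i)))))
            (λ 0<i → ≤-trans αF (bump₁-≤ _ F θ) , inj₂ (λ r r<K e₁ e₂ → unmarked (mark-at-high i
              (subst₂ Mark e₁ e₂ (mk r r<K)) (point-high₁ 0<i (letter≤ i) bal) (point-high₂ 0<i (letter≤ i)
                bal))))
            del)
      where
      unmarked : U i (suc (F (low (toℕ i)))) ≡ true → ⊥
      unmarked u with trans (sym u) (avoid Fin.zero eq)
      ... | ()

  module Upper (θ α β : ℕ) (tip : β ≡ α + k + θ) where
    open UpperBound N k θ α β (suc k) Mark public

    Ok : (ℕ → ℕ) → ℕ → (ℕ → ℕ) → (ℕ → ℕ) → Set
    Ok F y h h′ = (h′ (suc y) ≡ h (suc y) × Mark (suc (F (suc y))) (suc (F (suc y)) + k + suc y)) ⊎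
      (h′ (suc y) ≡ suc (h′ y) ⊎ h′ (suc (suc y)) ≡ h′ (suc y))

    open Letter θ Explained Ok (explained-step tip refl) public

  consS : ∀ {l} → Bool → (Fin l → Bool) → Fin (suc l) → Bool
  consS b S Fin.zero    = b
  consS b S (Fin.suc p) = S p

  -- One subword has to serve all thresholds, so θ is quantified after `S`. The equation for `stat`
  -- says that every kept letter lengthens the element, which later gives reducedness.
  Greedy : (F B : ℕ → ℕ) (Q : Word n) → Set
  Greedy F B Q = Σ (Fin (length Q) → Bool) λ S →
    (∀ p → S p ≡ true → marked (label F Q p) ≡ false) ×
    stat (B ∘ actN (restrict Q S)) ≡ length (restrict Q S) + length (restrict Q S) + stat B ×
    (∀ θ α β (tip : β ≡ α + k + θ) → Total θ B → Upper.Explained θ α β tip F (height B θ) →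
      Upper.Explained θ α β tip (run F Q) (height (B ∘ actN (restrict Q S)) θ))

  -- A marked letter is dropped and supplies the marks at its corners. An unmarked one is kept
  -- exactly at an ascent, so in either case the labels are left in descending order at its
  -- boundaries, the low one by antisymmetry.
  greedy : ∀ Q {F B} → Signed B → Admissible F Q → Balanced F → Greedy F B Q
  greedy []      s adm bal = (λ ()) , (λ ()) , refl , (λ θ α β tip t ex → ex)
  greedy (i ∷ Q) {F} {B} s (ch , cl , adm) bal = decide (U i (suc (F (low (toℕ i))))) refl
    where
    i≤ = letter≤ i
    skipped : (∀ θ α β (tip : β ≡ α + k + θ) → Total θ B → Upper.Explained θ α β tip F (height B θ) →
      Upper.Explained θ α β tip (bump (toℕ i) F) (height B θ)) → Greedy F B (i ∷ Q)
    skipped stp with greedy Q {bump (toℕ i) F} {B} s adm (balanced-bump (toℕ i) i≤ bal)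
    ... | S , avoid , len , ex = consS false S , (λ { Fin.zero () ; (Fin.suc p) → avoid p }) , len ,
          (λ θ α β tip t e → ex θ α β tip t (stp θ α β tip t e))
    decide : ∀ b → U i (suc (F (low (toℕ i)))) ≡ b → Greedy F B (i ∷ Q)
    decide true u = skipped (λ θ α β tip t →
      Upper.keep θ α β tip (toℕ i) {F} {B} i≤ ch cl t
        (inj₁ (refl , low-mark i _ u refl (point-low F i≤)))
        (λ 0<i → inj₁ (refl , high-mark i _ u (point-high₁ 0<i i≤ bal) (point-high₂ 0<i i≤ bal))))
    decide false u with B (n′ + toℕ i) <? B (suc (n′ + toℕ i))
    ... | no na = skipped (λ θ α β tip t →
      Upper.keep θ α β tip (toℕ i) {F} {B} i≤ ch cl t
        (inj₂ (height-sorted B θ _ desc-low)) (λ _ → inj₂ (height-sorted B θ _ (≮⇒≥ na))))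
      where
      desc-low : B (suc (n′ ∸ toℕ i)) ≤ B (n′ ∸ toℕ i)
      desc-low = lin 5 (λ a b c d e → a ≼ b ⇒ ς (c ⊕ a) ≈ ς d ⊕ ς d ⇒ ς (e ⊕ b) ≈ ς d ⊕ ς d ⇒ e ≼ c) 110011 0 _
        _ _ _ _ (≮⇒≥ na) (mirror s (n′ ∸ toℕ i) (suc (n′ + toℕ i))
        (lin 3 (λ a b c → a ⊕ b ≈ c ⇒ ς (a ⊕ ς (c ⊕ b)) ≈ ς c ⊕ ς c) 11 101 _ _ _ (m∸n+n≡m i≤)))
        (mirror s (suc (n′ ∸ toℕ i)) (n′ + toℕ i) (lin 3 (λ a b c → a ⊕ b ≈ c ⇒ ς (ς a ⊕ (c ⊕ b)) ≈ ς c ⊕ ς c)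
        11 101 (n′ ∸ toℕ i) (toℕ i) _ (m∸n+n≡m i≤)))
    ... | yes a with greedy Q {bump (toℕ i) F} {B ∘ sw (toℕ i)} (signed-sw (toℕ i) i≤ s) adm
      (balanced-bump (toℕ i) i≤ bal)
    ...   | S , avoid , len , ex = consS true S , (λ { Fin.zero _ → u ; (Fin.suc p) → avoid p })
          , longer len (stat-ascent s (toℕ i) i≤ a)
          , (λ θ α β tip t e → ex θ α β tip (total-sw {θ} {B} (toℕ i) i≤ t)
              (Upper.swapped θ α β tip (toℕ i) {F} {B} i≤ ch cl t
                (inj₂ (height-sorted (B ∘ τ (n′ ∸ toℕ i)) θ _
                  (sorted₁ B _ (<⇒≤ (ascent-mirror {B} (mirror s) i≤ a)))))
                (λ 0<i → inj₂ (height-sorted (B ∘ τ (n′ ∸ toℕ i) ∘ τ (n′ + toℕ i)) θ _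
                  (sorted₁ (B ∘ τ (n′ ∸ toℕ i)) _ (asc-high 0<i))))
                e))
      where
      longer : ∀ {x y z} → x ≡ length (restrict Q S) + length (restrict Q S) + y → y ≡ 2 + z →
        x ≡ suc (length (restrict Q S)) + suc (length (restrict Q S)) + z
      longer p q = lin 4 (λ a b c d → a ≈ b ⊕ b ⊕ c ⇒ c ≈ κ 2 ⊕ d ⇒ a ≈ ς b ⊕ ς b ⊕ d) 2022 20202 _ _ _ _ p q
      sorted₁ : ∀ C y → C y ≤ C (suc y) → C (τ y (suc y)) ≤ C (τ y y)
      sorted₁ C y p = subst₂ (λ u v → C u ≤ C v) (sym (τ-snd y)) (sym (τ-fst y)) p
      asc-high : 0 < toℕ i → B (τ (n′ ∸ toℕ i) (n′ + toℕ i)) ≤ B (τ (n′ ∸ toℕ i) (suc (n′ + toℕ i)))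
      asc-high 0<i = subst₂ (λ u v → B u ≤ B v) (sym (τ-above _ _ f)) (sym (τ-above _ _ (m<n⇒m<1+n f))) (<⇒≤ a)
        where
        f : suc (n′ ∸ toℕ i) < n′ + toℕ i
        f = lin 3 (λ a b c → a ⊕ b ≈ c ⇒ κ 0 ≺ b ⇒ ς a ≺ c ⊕ b) 121 0 _ _ _ (m∸n+n≡m i≤) 0<i

-- Reversal of the array by a subword, in terms of chains

module Setting (n′ k : ℕ) (c : Word (suc n′)) (c↭ : c ↭ allFin (suc n′)) where
  open SignedArrays n′
  open Frontiers n′

  m : ℕ
  m = n + k

  -- With 3m the initial staircase lies at 3m - n ≥ 2m or beyond, hence past the first endpoint of
  -- every crossing read in the polygon 0 , ... , 2m - 1.
  base : ℕ
  base = m + m + m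

  n≤base : n ≤ base
  n≤base = ≤-trans (m≤m+n n k) (m≤n+m m (m + m))

  open Start base n≤base c (count-coxeter c↭) public

  Q : Word n
  Q = concat (replicate m c)

module Subwords (n′ k : ℕ) (U : Fin (suc n′) → ℕ → Bool) (c : Word (suc n′)) (c↭ : c ↭ allFin (suc n′)) where
  open SignedArrays n′
  open Frontiers n′
  open Evolution n′ k U hiding (m)
  open Setting n′ k c c↭

  -- By `start-mirror` the final point over N - θ is (β , α + 2m), the initial point (α , β) over θ
  -- with its ends exchanged in the universal cover. This is what closes a chain up to a crossing.
  final : ∀ θ x → 0 < θ → θ < N → θ + x ≡ N → run start Q x ≡ start θ + k + θ
  final θ x p q e = lin 6 (λ a b c d e f → a ≈ ς (b ⊕ c) ⊕ d ⇒ e ⊕ f ≈ d ⊕ ς b ⇒ a ≈ e ⊕ c ⊕ f) 1101 10011 _ _ _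
    _ (Frontiers.Start.start n′ (Setting.base n′ k c c↭) (Setting.n≤base n′ k c c↭) c
    (Frontiers.count-coxeter n′ c↭) θ) θ
    (run-start m x (lin 3 (λ a b c → a ≺ ς (b ⊕ ς b) ⇒ a ⊕ c ≈ ς (b ⊕ ς b) ⇒ κ 0 ≺ c) 2202 0 _ _ _ q e)
    (lin 3 (λ a b c → κ 0 ≺ a ⇒ a ⊕ b ≈ ς (c ⊕ ς c) ⇒ b ≺ ς (c ⊕ ς c)) 2022 0 _ _ _ p e))
    (start-mirror θ x p q e)

  -- In a reversed array the first x = N - θ sites hold only labels ≥ θ, so the height at x is x. At
  -- the final point `Delayed` with r = k + 1 would then say x + k + 1 ≤ x + k.
  not-reversed : ∀ {S} → (∀ p → S p ≡ true → marked (label start Q p) ≡ false) →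
    Reversed (actN (restrict Q S)) → ∀ {θ α β ga gb} → 0 < θ → θ < N → start θ ≡ α →
    LowerBound.IsChain N k θ α β (suc k) ga gb → (∀ r → r < suc k → Mark (ga (suc r)) (gb (suc r))) →
    ga (suc k) ≤ β → gb (suc k) ≤ α + N + k + k → ⊥
  not-reversed {S} avoid rev {θ} {α} {β} {ga} {gb} 0<θ θ<N sθ ch mk p q =
    lin 8 (λ a b c d e f g h → a ⊕ ς b ⊕ c ≼ d ⊕ b ⊕ e ⇒ d ≈ f ⊕ b ⊕ g ⇒ c ≈ h ⊕ b ⊕ g ⇒ f ≈ h ⇒ a ≈ e ⇒ ↯)
      101100110 0 _ _ _ _ _ _ _ _ (del x (suc k) (lin 3 (λ a b c → a ⊕ b ≈ ς (c ⊕ ς c) ⇒ b ≺ ς (c ⊕ ς c) ⇒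
      κ 0 ≺ a) 2022 0 _ _ _ x+θ θ<N) (lin 3 (λ a b c → a ⊕ b ≈ ς (c ⊕ ς c) ⇒ κ 0 ≺ b ⇒ a ≺ ς (c ⊕ ς c)) 222 0 _
      _ _ x+θ 0<θ) ≤-refl (lin 7 (λ a b c d e f g → a ≼ b ⇒ c ≈ d ⊕ e ⊕ f ⇒ b ≈ g ⊕ e ⊕ f ⇒ d ≈ g ⇒ a ≼ c)
      11001101 0 _ _ _ _ _ _ _ p fin tip sθ) (lin 8 (λ a b c d e f g h → a ≼ b ⊕ ς (c ⊕ ς c) ⊕ d ⊕ d ⇒
      e ≈ f ⊕ d ⊕ g ⇒ f ≈ b ⇒ h ⊕ g ≈ ς (c ⊕ ς c) ⇒ a ≼ e ⊕ d ⊕ h) 11010101 0 _ _ _ _ _ _ _ _ q fin sθ x+θ)) fin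
      tip sθ (height-full {B} {θ} x (λ y y<x → lin 5 (λ a b c d e → ς (a ⊕ b) ≈ ς c ⊕ ς c ⇒ b ≺ d ⇒
      d ⊕ e ≈ ς (c ⊕ ς c) ⇒ e ≼ a) 101011 0 _ _ _ _ _
      (rev y (lin 4 (λ a b c d → a ≺ b ⇒ b ⊕ c ≈ ς (d ⊕ ς d) ⇒ a ≺ ς d ⊕ ς d) 2022 0 _ _ _ _ y<x x+θ)) y<x x+θ))
    where
    open LowerBound N k θ α β (suc k) ga gb
    tip = IsChain.tip ch
    B = actN (restrict Q S)
    x = N ∸ θ
    x+θ : N ∸ θ + θ ≡ N
    x+θ = m∸n+n≡m (<⇒≤ θ<N)
    fin : run start Q x ≡ start θ + k + θ
    fin = final θ x 0<θ θ<N (trans (+-comm θ x) x+θ)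
    del : Delayed (run start Q) (height B θ)
    del = Lower.lower-run θ α β (suc k) ga gb ch mk Q {start} {λ y → y} S avoid (start-admissible m)
      start-balanced
      (total-id (<⇒≤ θ<N)) (≤-reflexive (sym sθ))
      (delayed-initial ch start-staircase sθ 0<θ θ<N (height-id θ))

  ChainAt : ℕ → Set
  ChainAt θ = UpperBound.Chain N k θ (start θ) (start θ + k + θ) (suc k) Mark (suc k)
    (start θ + k + θ) (start θ + N + k + k)

  ReversedSubword : Set
  ReversedSubword = Σ (Fin (length Q) → Bool) λ S → (∀ p → S p ≡ true → marked (label start Q p) ≡ false) ×
    Reversed (actN (restrict Q S)) × IsReduced (restrict Q S)

  -- A height at N - θ that falls short of N - θ, even by one, leaves just the room that `Explained`
  -- needs for r = k + 1 and s = 0, and so produces a forbidden chain.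
  greedy⇒reversed : Greedy start (λ y → y) Q → (∀ θ → 0 < θ → θ < N → ¬ ChainAt θ) → ReversedSubword
  greedy⇒reversed result none = S , avoid , rev
      , reduced (restrict Q S)
        (sym (trans len (trans (cong (length (restrict Q S) + length (restrict Q S) +_) stat-id)
        (+-identityʳ _))))
    where
    S = proj₁ result
    avoid = proj₁ (proj₂ result)
    len = proj₁ (proj₂ (proj₂ result))
    B = actN (restrict Q S)
    full : ∀ θ x → 0 < θ → θ < N → θ + x ≡ N → x ≤ height B θ x
    full θ x 0<θ θ<N e = ≮⇒≥
      (λ lt → none θ 0<θ θ<N (subst₂ (UpperBound.Chain N k θ α (α + k + θ) (suc k) Mark (suc k))
        fin (trans (cong (λ z → z + k + x) fin) (lin 5 (λ a b c d e → a ⊕ b ≈ ς (c ⊕ ς c) ⇒ d ⊕ e ⊕ a ⊕ e ⊕ b ≈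
          d ⊕ ς (c ⊕ ς c) ⊕ e ⊕ e) 22 202 θ x _ α k e))
        (ex x (suc k) 0 (lin 3 (λ a b c → a ⊕ b ≈ ς (c ⊕ ς c) ⇒ a ≺ ς (c ⊕ ς c) ⇒ κ 0 ≺ b) 2022 0 _ _ _ e θ<N)
          (lin 3 (λ a b c → a ⊕ b ≈ ς (c ⊕ ς c) ⇒ κ 0 ≺ a ⇒ b ≺ ς (c ⊕ ς c)) 222 0 _ _ _ e 0<θ)
          (+-identityʳ (suc k))
          (lin 4 (λ a b c d → a ≈ b ⊕ c ⊕ d ⇒ a ⊕ κ 0 ≼ b ⊕ c ⊕ d) 11 0 _ α k θ fin)
            (lin 6 (λ a b c d e f → a ≈ b ⊕ c ⊕ d ⇒ d ⊕ e ≈ ς (f ⊕ ς f) ⇒ a ⊕ c ⊕ e ⊕ κ 0 ≼ b ⊕ ς (f ⊕ ς f) ⊕ c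
            ⊕ c) 2022 0 _ _ _ _ _ _ fin e) (lin 6 (λ a b c d e f → a ≈ b ⊕ c ⊕ d ⇒ e ≺ f ⇒ e ⊕ ς c ⊕ (b ⊕ c ⊕ d)
            ≼ a ⊕ c ⊕ f) 1011 0 _ α _ θ _ _ fin lt))))
      where
      α = start θ
      fin : run start Q x ≡ α + k + θ
      fin = final θ x 0<θ θ<N e
      ex : Upper.Explained θ α (α + k + θ) refl (run start Q) (height B θ)
      ex = proj₂ (proj₂ (proj₂ result)) θ α (α + k + θ) refl (total-id (<⇒≤ θ<N))
        (Upper.explained-initial θ α (α + k + θ) refl start-staircase refl refl 0<θ θ<N (height-id θ))
    -- A full height at boundary y + 1 bounds the label at site y from below by N - 1 - y. For the
    -- last site this would be θ = 0, where the bound is trivial.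
    big : ∀ y → y < N → N ≤ suc (B y + y)
    big y p with suc y <? N
    ... | yes q = lin 4 (λ a b c d → a ≼ b ⇒ a ⊕ ς c ≈ ς (d ⊕ ς d) ⇒ d ⊕ ς d ≺ ς (b ⊕ c)) 2202 0 _ _ _ _
      (height-full⁻¹ B (N ∸ suc y) y (full (N ∸ suc y) (suc y) (lin 3 (λ a b c → a ⊕ ς b ≈ ς (c ⊕ ς c) ⇒
      ς b ≺ ς (c ⊕ ς c) ⇒ κ 0 ≺ a) 2022 0 _ _ _ (m∸n+n≡m p) q) (lin 3 (λ a b c → a ⊕ ς b ≈ ς (c ⊕ ς c) ⇒
      a ≺ ς (c ⊕ ς c)) 22 0 _ _ _ (m∸n+n≡m p)) (m∸n+n≡m p))) (m∸n+n≡m p)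
    ... | no q  = lin 3 (λ a b c → a ⊕ ς a ≺ ς b ⇒ a ⊕ ς a ≺ ς (c ⊕ b)) 11 0 _ _ _ (≮⇒≥ q)
    -- The lower bounds at a site and at its mirror add up to the known sum, so both are equalities.
    rev : Reversed B
    rev y p = lin 5 (λ a b c d e → ς (a ⊕ ς a) ≼ ς (b ⊕ c) ⇒ ς (a ⊕ ς a) ≼ ς (d ⊕ e) ⇒ ς (b ⊕ d) ≈ ς a ⊕ ς a ⇒
      e ⊕ ς c ≈ ς a ⊕ ς a ⇒ ς (b ⊕ c) ≈ ς a ⊕ ς a) 101011 1000001 _ _ _ _ _ (big y p)
      (big (N ∸ suc y) (lin 3 (λ a b c → a ⊕ ς b ≈ ς c ⊕ ς c ⇒ a ≺ ς (c ⊕ ς c)) 22 0 _ _ _ (m∸n+n≡m p)))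
      (mirror (signed-actN (restrict Q S)) y (N ∸ suc y) (lin 3 (λ a b c → a ⊕ ς b ≈ ς c ⊕ ς c ⇒ ς (b ⊕ a) ≈ ς c
      ⊕ ς c) 22 202 _ _ _ (m∸n+n≡m p))) (m∸n+n≡m p)

  greedy-reversed : (∀ θ → 0 < θ → θ < N → ¬ ChainAt θ) → ReversedSubword
  greedy-reversed = greedy⇒reversed (greedy Q signed-id (start-admissible m) start-balanced)

-- The longest element as a Coxeter power, and its sorting word

restrict-length : ∀ {A : Set} (Q : List A) S → length (restrict Q S) ≤ length Q
restrict-length []      S = z≤n
restrict-length (a ∷ Q) S with S Fin.zero
... | true  = s≤s (restrict-length Q (S ∘ Fin.suc))
... | false = m≤n⇒m≤1+n (restrict-length Q (S ∘ Fin.suc))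

restrict-full : ∀ {A : Set} (Q : List A) S → length Q ≤ length (restrict Q S) → restrict Q S ≡ Q
restrict-full []      S p = refl
restrict-full (a ∷ Q) S p with S Fin.zero
... | true  = cong (a ∷_) (restrict-full Q (S ∘ Fin.suc) (s≤s⁻¹ p))
... | false = ⊥-elim (<⇒≱ p (restrict-length Q (S ∘ Fin.suc)))

length-power : ∀ {A : Set} t (c : List A) → length (concat (replicate t c)) ≡ t * length c
length-power zero    c = refl
length-power (suc t) c = trans (length-++ c) (cong (length c +_) (length-power t c))

module LongestElement (n′ : ℕ) (c : Word (suc n′)) (c↭ : c ↭ allFin (suc n′)) where
  open SignedArrays n′

  length-c : length c ≡ n
  length-c = trans (↭-length c↭) (ListP.length-tabulate (λ i → i))

  power : ℕ → Word n
  power t = concat (replicate t c)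

  private
    module R = Subwords n′ 0 (λ _ _ → false) c c↭
    module E = Evolution n′ 0 (λ _ _ → false)

    unmarked : ∀ {a b} → ¬ E.Mark a b
    unmarked (E.low-mark i y () _ _)
    unmarked (E.high-mark i y () _ _)

    no-chain : ∀ θ → 0 < θ → θ < n + n → ¬ R.ChainAt θ
    no-chain θ _ _ (UpperBound.snoc a b _ _ mk _ _ _) = unmarked mk

    long : ∀ v → Reversed (actN v) → n * n ≤ length v
    long v rev = lin 4 (λ a b c d → a ≼ b ⊕ b ⊕ c ⇒ a ≈ d ⊕ d ⇒ c ≈ κ 0 ⇒ d ≼ b) 110012 0 _ _ _ _
      (stat-actN≤ v signed-id) (stat-reversed rev) stat-id

    full : R.ReversedSubword → Reversed (actN (power (n + 0))) × IsReduced (power (n + 0))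
    full (S , _ , rev , red) = subst (λ v → Reversed (actN v) × IsReduced v)
      (restrict-full (power (n + 0)) S (≤-trans (≤-reflexive len) (long (restrict (power (n + 0)) S) rev)))
        (rev , red)
      where
      len : length (power (n + 0)) ≡ n * n
      len = trans (length-power (n + 0) c) (cong₂ _*_ (+-identityʳ n) length-c)

  -- The criterion with k = 0 and no marks: there are no chains, so the greedy subword of cⁿ
  -- reverses the array. Reversing takes at least n² letters, the length of cⁿ, so nothing was
  -- omitted.
  power-reversed×reduced : Reversed (actN (power n)) × IsReduced (power n)
  power-reversed×reduced = subst (λ t → Reversed (actN (power t)) × IsReduced (power t)) (+-identityʳ n)
    (full (R.greedy-reversed no-chain))

  power-reversed : Reversed (actN (power n))
  power-reversed = proj₁ power-reversed×reduced

  power-reduced : IsReduced (power n)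
  power-reduced = proj₂ power-reversed×reduced

  from : ℕ → ℕ → List ℕ
  from s zero    = []
  from s (suc l) = s ∷ from (suc s) l

  from-++ : ∀ s l l′ → from s (l + l′) ≡ from s l ++ from (s + l) l′
  from-++ s zero    l′ = cong (λ z → from z l′) (sym (+-identityʳ s))
  from-++ s (suc l) l′ = cong (s ∷_) (trans (from-++ (suc s) l l′) (cong (λ z → from (suc s) l ++ from z l′)
    (sym (+-suc s l))))

  from-linked : ∀ s l → Linked _<_ (from s l)
  from-linked s zero          = []
  from-linked s (suc zero)    = [-]
  from-linked s (suc (suc l)) = ≤-refl ∷ from-linked (suc s) (suc l)

  -- No increasing sequence of the same length starting at s or later precedes the run of
  -- consecutive numbers, so being lexicographically at most that run forces equality.
  lex-first : ∀ s l ps → Linked _<_ ps → (∀ {x xs} → ps ≡ x ∷ xs → s ≤ x) → length ps ≡ l → LexLeq ps (from s l)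
    → ps ≡ from s l
  lex-first s zero    []       lk lo len lx = refl
  lex-first s (suc l) (x ∷ ps) lk lo len (lex-< p) = ⊥-elim (<⇒≱ p (lo refl))
  lex-first s (suc l) (x ∷ ps) lk lo len (lex-≡ lx) = cong (x ∷_)
    (lex-first (suc x) l ps (tail lk) (λ e → head lk e) (suc-injective len) lx)
    where
    tail : ∀ {x ps} → Linked _<_ (x ∷ ps) → Linked _<_ ps
    tail [-]       = []
    tail (p ∷ lk)  = lk
    head : ∀ {x ps y ys} → Linked _<_ (x ∷ ps) → ps ≡ y ∷ ys → suc x ≤ y
    head (p ∷ lk) refl = p

  map-nth : ∀ {A : Set} (f : ℕ → Maybe A) s (xs : List A) → (∀ j → j < length xs → f (s + j) ≡ nth xs j) →
    map f (from s (length xs)) ≡ map just xs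
  map-nth f s []       eq = refl
  map-nth f s (x ∷ xs) eq = cong₂ _∷_ (trans (cong f (sym (+-identityʳ s))) (eq 0 (s≤s z≤n)))
    (map-nth f (suc s) xs (λ j p → trans (cong f (sym (+-suc s j))) (eq (suc j) (s≤s p))))

  infLetter-period : ∀ {A : Set} (xs : List A) t j → j < length xs → infLetter xs (t * length xs + j) ≡ nth xs j
  infLetter-period (x ∷ xs) t j p = cong (nth (x ∷ xs))
    (trans (cong (_% length (x ∷ xs)) (+-comm (t * length (x ∷ xs)) j))
      (trans ([m+kn]%n≡m%n j t (length (x ∷ xs))) (m<n⇒m%n≡m p)))

  map-infLetter : ∀ {A : Set} (xs : List A) s t → map (infLetter xs) (from (s * length xs) (t * length xs)) ≡
    map just (concat (replicate t xs))
  map-infLetter xs s zero    = refl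
  map-infLetter xs s (suc t) = begin
    map f (from (s * l) (l + t * l))                        ≡⟨ cong (map f) (from-++ (s * l) l (t * l)) ⟩
    map f (from (s * l) l ++ from (s * l + l) (t * l))      ≡⟨ map-++ f (from (s * l) l) _ ⟩
    map f (from (s * l) l) ++ map f (from (s * l + l) (t * l)) ≡⟨ cong₂ _++_
      (map-nth f (s * l) xs (infLetter-period xs s))
        (trans (cong (λ z → map f (from z (t * l))) (+-comm (s * l) l)) (map-infLetter xs (suc s) t)) ⟩
    map just xs ++ map just (concat (replicate t xs))       ≡⟨ map-++ just xs _ ⟨
    map just (xs ++ concat (replicate t xs))                ∎
    where
    open ≡-Reasoning
    f = infLetter xs
    l = length xs

  sorting-word : ∀ w∘ → IsLongest w∘ → ∀ ps w → IsLexFirstReduced c w∘ ps w → w ≡ power n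
  sorting-word w∘ lw ps w ((lk , letters) , (el , red) , first) = ListP.map-injective just-injective
    (trans (sym letters) (trans (cong (map (infLetter c)) ps≡) (map-infLetter c 0 n)))
    where
    el-power : elem (power n) ≡ w∘
    el-power with longest w∘ lw
    ... | u , eu , rev = trans (reversed-unique (power n) u power-reversed rev) eu
    L = n * length c
    len-ps : length ps ≡ L
    len-ps = begin
      length ps                     ≡⟨ length-map (infLetter c) ps ⟨
      length (map (infLetter c) ps) ≡⟨ cong length letters ⟩
      length (map just w)           ≡⟨ length-map just w ⟩
      length w                      ≡⟨ ≤-antisym (red (power n) (trans el-power (sym el)))
        (power-reduced w (trans el (sym el-power))) ⟩
      length (power n)              ≡⟨ length-power n c ⟩
      L                             ∎
      where open ≡-Reasoning
    ps≡ : ps ≡ from 0 L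
    ps≡ = lex-first 0 L ps lk (λ _ → z≤n) len-ps
      (first (from 0 L) (power n) (from-linked 0 L , map-infLetter c 0 n) (el-power , power-reduced))

-- Segments of the polygon and residues

rot-< : ∀ {m a} → a < m → rot m a ≡ a + m
rot-< {m} {a} p with a <ᵇ m | <⇒<ᵇ p
... | true | _ = refl

rot-≥ : ∀ {m a} → m ≤ a → rot m a ≡ a ∸ m
rot-≥ {m} {a} p with a <ᵇ m | <ᵇ⇒< a m
... | true  | q = ⊥-elim (<⇒≱ (q _) p)
... | false | _ = refl

mkSeg-≤ : ∀ {a b} → a ≤ b → mkSeg a b ≡ (a , b)
mkSeg-≤ {a} {b} p with a ≤ᵇ b | ≤⇒≤ᵇ p
... | true | _ = refl

mkSeg-> : ∀ {a b} → b < a → mkSeg a b ≡ (b , a)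
mkSeg-> {a} {b} p with a ≤ᵇ b | ≤ᵇ⇒≤ a b
... | true  | q = ⊥-elim (<⇒≱ p (q _))
... | false | _ = refl

mkSeg-comm : ∀ a b → mkSeg a b ≡ mkSeg b a
mkSeg-comm a b with <-cmp a b
... | tri< p _ _    = trans (mkSeg-≤ (<⇒≤ p)) (sym (mkSeg-> p))
... | tri≈ _ refl _ = refl
... | tri> _ _ p    = trans (mkSeg-> p) (sym (mkSeg-≤ (<⇒≤ p)))

∸-unique : ∀ a b c → a + b ≡ c → c ∸ b ≡ a
∸-unique a b c refl = m+n∸n≡m a b

SymPair-≡ : ∀ {m k} (u v : SymPair m k) → proj₁ u ≡ proj₁ v → u ≡ v
SymPair-≡ (d , (p₁ , p₂) , (q₁ , q₂) , r) (.d , (p₁′ , p₂′) , (q₁′ , q₂′) , r′) refl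
  rewrite ≤-irrelevant p₁ p₁′ | ≤-irrelevant p₂ p₂′ | ≤-irrelevant q₁ q₁′ | ≤-irrelevant q₂ q₂′
  = cong (λ z → d , (p₁′ , p₂′) , (q₁′ , q₂′) , z) (irr r r′)
  where
  irr : ∀ {a b c d} (x y : SegLeq (a , b) (c , d)) → x ≡ y
  irr (inj₁ x) (inj₁ y) = cong inj₁ (≤-irrelevant x y)
  irr (inj₁ x) (inj₂ (refl , _)) = ⊥-elim (<-irrefl refl x)
  irr (inj₂ (refl , _)) (inj₁ y) = ⊥-elim (<-irrefl refl y)
  irr (inj₂ (x , x′)) (inj₂ (y , y′)) = cong inj₂ (cong₂ _,_ (≡-irrelevant x y) (≤-irrelevant x′ y′))

residue : ∀ M .{{_ : NonZero M}} a z → a < z → z < a + M →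
  let w = (a / M) * M in z ≡ z % M + w ⊎ z ≡ z % M + (M + w)
residue M a z p q = go (<-cmp (z / M) (a / M)) (<-cmp (z / M) (suc (a / M)))
  where
  az = m≡m%n+[m/n]*n a M
  zz = m≡m%n+[m/n]*n z M
  go : Tri (z / M < a / M) (z / M ≡ a / M) (a / M < z / M) →
    Tri (z / M < suc (a / M)) (z / M ≡ suc (a / M)) (suc (a / M) < z / M) →
    z ≡ z % M + (a / M) * M ⊎ z ≡ z % M + (M + (a / M) * M)
  go (tri< l _ _) _ = ⊥-elim (lin 7 (λ a b c d e f g → a ⊕ b ≼ c ⇒ d ≈ e ⊕ c ⇒ f ≈ g ⊕ b ⇒ d ≺ f ⇒ g ≺ a ⇒ ↯)
    1100111 0 _ _ _ _ _ _ _ before az zz p (m%n<n z M))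
    where
    before : M + (z / M) * M ≤ (a / M) * M
    before = *-monoˡ-≤ M l
  go (tri≈ _ e _) _ = inj₁ (trans zz (cong (λ t → z % M + t * M) e))
  go (tri> _ _ g) (tri< l _ _) = ⊥-elim (<-irrefl refl (≤-trans g (s≤s⁻¹ l)))
  go (tri> _ _ g) (tri≈ _ e _) = inj₂ (trans zz (cong (λ t → z % M + t * M) e))
  go (tri> _ _ g) (tri> _ _ l) = ⊥-elim (lin 7 (λ a b c d e f g → a ⊕ (a ⊕ b) ≼ c ⇒ d ≈ e ⊕ b ⇒ f ≈ g ⊕ c ⇒
    f ≺ d ⊕ a ⇒ e ≺ a ⇒ ↯) 1011011 0 _ _ _ _ _ _ _ after az zz q (m%n<n a M))
    where
    after : M + (M + (a / M) * M) ≤ (z / M) * M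
    after = *-monoˡ-≤ M l

-- Reduction modulo M cuts the cyclic order at a multiple of M. The points beyond the cut form a
-- final segment of a′ , b , b′, so four of the eight cases are consistent, and in each the two
-- pairs still alternate.
cross-mkSeg : ∀ M .{{_ : NonZero M}} a a′ b b′ → a < a′ → a′ < b → b < b′ → b′ < a + M →
  Cross (mkSeg (a % M) (b % M)) (mkSeg (a′ % M) (b′ % M))
cross-mkSeg M a a′ b b′ p q r s =
  go (residue M a a′ p (lin 5 (λ a b c d e → a ≺ b ⇒ b ≺ c ⇒ c ≺ d ⊕ e ⇒ a ≺ d ⊕ e) 1111 0 _ _ _ a M q r s))
    (residue M a b (<-trans p q) (<-trans r s))
     (residue M a b′ (<-trans (<-trans p q) r) s)
  where
  w = (a / M) * M
  ea = m≡m%n+[m/n]*n a M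
  xb = m%n<n b M
  xb′ = m%n<n b′ M
  on : ∀ {d e x y} → d ≡ x → e ≡ y → Cross x y → Cross d e
  on refl refl cr = cr
  go : a′ ≡ a′ % M + w ⊎ a′ ≡ a′ % M + (M + w) → b ≡ b % M + w ⊎ b ≡ b % M + (M + w) →
    b′ ≡ b′ % M + w ⊎ b′ ≡ b′ % M + (M + w) → Cross (mkSeg (a % M) (b % M)) (mkSeg (a′ % M) (b′ % M))
  go (inj₁ x) (inj₁ y) (inj₁ z) = on (mkSeg-≤ {a % M} {b % M} (lin 6 (λ a b c d e f → a ≈ b ⊕ c ⇒ d ≈ e ⊕ c ⇒
    d ≺ f ⇒ f ≺ a ⇒ e ≼ b) 110111 0 _ _ _ _ _ _ y ea p q)) (mkSeg-≤ {a′ % M} {b′ % M}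
    (lin 6 (λ a b c d e f → a ≈ b ⊕ c ⇒ d ≈ e ⊕ c ⇒ a ≺ f ⇒ f ≺ d ⇒ b ≼ e) 1001111 0 _ _ _ _ _ _ x z q r))
    (inj₁ (lin 5 (λ a b c d e → a ≈ b ⊕ c ⇒ d ≈ e ⊕ c ⇒ d ≺ a ⇒ e ≺ b) 11011 0 _ _ _ _ _ x ea p , lin 5
      (λ a b c d e → a ≈ b ⊕ c ⇒ d ≈ e ⊕ c ⇒ a ≺ d ⇒ b ≺ e) 100111 0 _ _ _ _ _ x y q , lin 5
      (λ a b c d e → a ≈ b ⊕ c ⇒ d ≈ e ⊕ c ⇒ a ≺ d ⇒ b ≺ e) 100111 0 _ _ _ _ _ y z r))
  go (inj₁ x) (inj₁ y) (inj₂ z) = on (mkSeg-≤ {a % M} {b % M} (lin 6 (λ a b c d e f → a ≈ b ⊕ c ⇒ d ≈ e ⊕ c ⇒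
    d ≺ f ⇒ f ≺ a ⇒ e ≼ b) 110111 0 _ _ _ _ _ _ y ea p q)) (mkSeg-> {a′ % M} {b′ % M}
    (lin 7 (λ a b c d e f g → a ≈ b ⊕ c ⇒ d ≈ e ⊕ (f ⊕ c) ⇒ g ≺ a ⇒ d ≺ g ⊕ f ⇒ e ≺ b) 110111 0 _ _ _ _ _ _ _ x
    z p s))
    (inj₂ (lin 6 (λ a b c d e f → a ≈ b ⊕ (c ⊕ d) ⇒ e ≈ f ⊕ d ⇒ a ≺ e ⊕ c ⇒ b ≺ f) 100111 0 _ _ _ _ _ _ z ea s ,
      lin 5 (λ a b c d e → a ≈ b ⊕ c ⇒ d ≈ e ⊕ c ⇒ d ≺ a ⇒ e ≺ b) 11011 0 _ _ _ _ _ x ea p , lin 5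
      (λ a b c d e → a ≈ b ⊕ c ⇒ d ≈ e ⊕ c ⇒ a ≺ d ⇒ b ≺ e) 100111 0 _ _ _ _ _ x y q))
  go (inj₁ x) (inj₂ y) (inj₂ z) = on (mkSeg-> {a % M} {b % M} (lin 7 (λ a b c d e f g → a ≈ b ⊕ (c ⊕ d) ⇒
    e ≈ f ⊕ d ⇒ a ≺ g ⇒ g ≺ e ⊕ c ⇒ b ≺ f) 1001111 0 _ _ _ _ _ _ _ y ea r s)) (mkSeg-> {a′ % M} {b′ % M}
    (lin 7 (λ a b c d e f g → a ≈ b ⊕ c ⇒ d ≈ e ⊕ (f ⊕ c) ⇒ g ≺ a ⇒ d ≺ g ⊕ f ⇒ e ≺ b) 110111 0 _ _ _ _ _ _ _ x
    z p s))
    (inj₁ (lin 6 (λ a b c d e f → a ≈ b ⊕ (c ⊕ d) ⇒ e ≈ f ⊕ (c ⊕ d) ⇒ a ≺ e ⇒ b ≺ f) 100111 0 _ _ M w _ _ y z r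
      , lin 6 (λ a b c d e f → a ≈ b ⊕ (c ⊕ d) ⇒ e ≈ f ⊕ d ⇒ a ≺ e ⊕ c ⇒ b ≺ f) 100111 0 _ _ _ _ _ _ z ea s ,
      lin 5 (λ a b c d e → a ≈ b ⊕ c ⇒ d ≈ e ⊕ c ⇒ d ≺ a ⇒ e ≺ b) 11011 0 _ _ _ _ _ x ea p))
  go (inj₂ x) (inj₂ y) (inj₂ z) = on (mkSeg-> {a % M} {b % M} (lin 7 (λ a b c d e f g → a ≈ b ⊕ (c ⊕ d) ⇒
    e ≈ f ⊕ d ⇒ a ≺ g ⇒ g ≺ e ⊕ c ⇒ b ≺ f) 1001111 0 _ _ _ _ _ _ _ y ea r s)) (mkSeg-≤ {a′ % M} {b′ % M}
    (lin 7 (λ a b c d e f g → a ≈ b ⊕ (c ⊕ d) ⇒ e ≈ f ⊕ (c ⊕ d) ⇒ a ≺ g ⇒ g ≺ e ⇒ b ≼ f) 1001111 0 _ _ M w _ _ _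
    x z q r))
    (inj₂ (lin 6 (λ a b c d e f → a ≈ b ⊕ (c ⊕ d) ⇒ e ≈ f ⊕ (c ⊕ d) ⇒ a ≺ e ⇒ b ≺ f) 100111 0 _ _ M w _ _ x y q
      , lin 6 (λ a b c d e f → a ≈ b ⊕ (c ⊕ d) ⇒ e ≈ f ⊕ (c ⊕ d) ⇒ a ≺ e ⇒ b ≺ f) 100111 0 _ _ M w _ _ y z r ,
      lin 6 (λ a b c d e f → a ≈ b ⊕ (c ⊕ d) ⇒ e ≈ f ⊕ d ⇒ a ≺ e ⊕ c ⇒ b ≺ f) 100111 0 _ _ _ _ _ _ z ea s))
  go (inj₁ x) (inj₂ y) (inj₁ z) = ⊥-elim (lin 6 (λ a b c d e f → a ≈ b ⊕ (c ⊕ d) ⇒ e ≈ f ⊕ d ⇒ a ≺ e ⇒ f ≺ c ⇒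
    ↯) 100111 0 _ (b % M) _ _ _ _ y z r xb′)
  go (inj₂ x) (inj₁ y) _        = ⊥-elim (lin 6 (λ a b c d e f → a ≈ b ⊕ (c ⊕ d) ⇒ e ≈ f ⊕ d ⇒ a ≺ e ⇒ f ≺ c ⇒
    ↯) 100111 0 _ (a′ % M) _ _ _ _ x y q xb)
  go (inj₂ x) (inj₂ y) (inj₁ z) = ⊥-elim (lin 6 (λ a b c d e f → a ≈ b ⊕ (c ⊕ d) ⇒ e ≈ f ⊕ d ⇒ a ≺ e ⇒ f ≺ c ⇒
    ↯) 100111 0 _ (b % M) _ _ _ _ y z r xb′)

same-residue : ∀ M .{{_ : NonZero M}} o y z → o < y → y ≤ M + o → o < z → z ≤ M + o → y % M ≡ z % M → y ≡ z
same-residue M o y z p q r s e = go (<-cmp (y / M) (z / M))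
  where
  ey = m≡m%n+[m/n]*n y M
  ez = m≡m%n+[m/n]*n z M
  go : Tri (y / M < z / M) (y / M ≡ z / M) (z / M < y / M) → y ≡ z
  go (tri< l _ _) = ⊥-elim (lin 8 (λ a b c d e f g h → a ≈ b ⊕ c ⇒ d ≈ e ⊕ f ⇒ b ≈ e ⇒ g ≺ a ⇒ d ≼ h ⊕ g ⇒
    h ⊕ c ≼ f ⇒ ↯) 11001111 0 _ _ _ _ _ _ _ _ ey ez e p s far)
    where
    far : M + (y / M) * M ≤ (z / M) * M
    far = *-monoˡ-≤ M l
  go (tri≈ _ d _) = trans ey (trans (cong₂ (λ u v → u + v * M) e d) (sym ez))
  go (tri> _ _ l) = ⊥-elim (lin 8 (λ a b c d e f g h → a ≈ b ⊕ c ⇒ d ≈ e ⊕ f ⇒ b ≈ e ⇒ g ≺ d ⇒ a ≼ h ⊕ g ⇒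
    h ⊕ f ≼ c ⇒ ↯) 100110111 0 _ _ _ _ _ _ _ _ ey ez e r q far)
    where
    far : M + (z / M) * M ≤ (y / M) * M
    far = *-monoˡ-≤ M l

%-shift : ∀ M .{{_ : NonZero M}} s q → s < M → (s + q * M) % M ≡ s
%-shift M s q p = trans ([m+kn]%n≡m%n s q M) (m<n⇒m%n≡m p)

with-residue : ∀ M .{{_ : NonZero M}} o s → s < M → Σ ℕ λ y → o < y × y ≤ M + o × y % M ≡ s
with-residue M o s p with o % M <? s
... | yes q = s + (o / M) * M , lin 4 (λ a b c d → a ≺ b ⇒ c ≈ a ⊕ d ⇒ c ≺ b ⊕ d) 1011 0 _ _ _ _ q
  (m≡m%n+[m/n]*n o M) , lin 5 (λ a b c d e → a ≺ b ⇒ c ≈ d ⊕ e ⇒ a ⊕ e ≼ b ⊕ c) 1101 0 _ _ _ _ _ p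
  (m≡m%n+[m/n]*n o M) , %-shift M s (o / M) p
... | no q = s + suc (o / M) * M , above , below , %-shift M s (suc (o / M)) p
  where
  above : o < s + (M + (o / M) * M)
  above = lin 5 (λ a b c d e → a ≈ b ⊕ c ⇒ b ≺ d ⇒ a ≺ e ⊕ (d ⊕ c)) 111 0 _ _ _ _ s (m≡m%n+[m/n]*n o M)
    (m%n<n o M)
  below : s + (M + (o / M) * M) ≤ M + o
  below = lin 5 (λ a b c d e → a ≈ b ⊕ c ⇒ d ≼ b ⇒ d ⊕ (e ⊕ c) ≼ e ⊕ a) 1011 0 _ _ _ _ _ (m≡m%n+[m/n]*n o M)
    (≮⇒≥ q)

-- Symmetric pairs as a letter and a residue modulo m

module Pairs (n′ k : ℕ) where

  n m : ℕ
  n = suc n′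
  m = n + k

  -- The pair with parameters (i , s): its short diagonal starts at s modulo m
  -- and has m - i sides on its short side.
  seg : ℕ → ℕ → Seg
  seg i s with s <? i
  ... | yes _ = s , s + (m ∸ i)
  ... | no _  = s ∸ i , s + m

  SegShape : ℕ → ℕ → Set
  SegShape i s =
    (s < i × seg i s ≡ (s , s + (m ∸ i))) ⊎ (i ≤ s × seg i s ≡ (s ∸ i , s + m))

  seg-cases : ∀ i s → SegShape i s
  seg-cases i s with s <? i
  ... | yes p = inj₁ (p , refl)
  ... | no p  = inj₂ (≮⇒≥ p , refl)

  ∸≡ : ∀ {i} → i ≤ n′ → m ∸ i + i ≡ m
  ∸≡ {i} p = m∸n+n≡m {m} {i} (lin 3 (λ a b c → a ≼ b ⇒ a ≼ ς (b ⊕ c)) 11 0 _ _ _ p)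

  sym-short : ∀ {i s} → i ≤ n′ → s < i → symSeg m (s , s + (m ∸ i)) ≡ (s + m , s + (m ∸ i) + m)
  sym-short {i} {s} p q = trans (cong₂ mkSeg (rot-< {m} {s} (lin 4 (λ a b c d → a ≼ b ⇒ c ≺ a ⇒ c ≺ ς (b ⊕ d))
    111 0 _ _ _ _ p q)) (rot-< {m} {s + (m ∸ i)} (lin 5 (λ a b c d e → a ⊕ b ≈ ς (c ⊕ d) ⇒ e ≺ b ⇒
    e ⊕ a ≺ ς (c ⊕ d)) 111 0 _ _ n′ k _ (∸≡ p) q)))
    (mkSeg-≤ (+-monoˡ-≤ m (m≤m+n s (m ∸ i))))

  sym-long : ∀ {i s} → i ≤ n′ → i ≤ s → s < m → symSeg m (s ∸ i , s + m) ≡ (s , s ∸ i + m)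
  sym-long {i} {s} p q r = trans (cong₂ mkSeg (rot-< {m} {s ∸ i} (≤-<-trans (m∸n≤m s i) r))
      (trans (rot-≥ {m} {s + m} (m≤n+m m s)) (m+n∸n≡m s m)))
    (mkSeg-> {s ∸ i + m} {s} (lin 5 (λ a b c d e → a ⊕ b ≈ c ⇒ b ≼ d ⇒ c ≺ a ⊕ ς (d ⊕ e)) 1011 0 _ _ _ _ _
      (m∸n+n≡m q) p))

  pair : (i : Fin n) (s : ℕ) → s < m → SymPair m k
  pair i s s<m = seg (toℕ i) s , ok (seg-cases (toℕ i) s)
    where
    i≤ : toℕ i ≤ n′
    i≤ = s≤s⁻¹ (toℕ<n i)
    ok : SegShape (toℕ i) s →
      let d = seg (toℕ i) s in IsSeg m d × Relevant m k d × SegLeq d (symSeg m d)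
    ok (inj₁ (p , e)) rewrite e | sym-short i≤ p =
      (lin 5 (λ a b c d e → a ⊕ b ≈ ς (c ⊕ d) ⇒ b ≼ c ⇒ e ≺ e ⊕ a) 1011 0 _ _ _ _ _ (∸≡ i≤) i≤ , lin 5
        (λ a b c d e → a ⊕ b ≈ ς (c ⊕ d) ⇒ e ≺ b ⇒ e ⊕ a ≺ ς (c ⊕ d ⊕ ς (c ⊕ d ⊕ κ 0))) 211 0 _ _ n′ k _ (∸≡ i≤)
        p) ,
      (lin 5 (λ a b c d e → a ≈ b ⇒ b ⊕ c ≈ ς (d ⊕ e) ⇒ c ≼ d ⇒ e ⊕ κ 1 ≼ a) 101011 0 _ _ _ _ _
        (m+n∸m≡n s (m ∸ toℕ i)) (∸≡ i≤) i≤ ,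
       lin 4 (λ a b c d → a ≈ ς (b ⊕ c) ⊕ d ⇒ c ⊕ κ 1 ≼ a) 101 0 _ n′ _ (toℕ i)
         (∸-unique (m + toℕ i) (s + (m ∸ toℕ i) ∸ s) (2 * m) (lin 5 (λ a b c d e → a ≈ b ⇒ b ⊕ c ≈ ς (d ⊕ e) ⇒
         ς (d ⊕ e) ⊕ c ⊕ a ≈ 2 ⊛ (ς (d ⊕ e))) 1011 10101 _ _ _ n′ k (m+n∸m≡n s (m ∸ toℕ i)) (∸≡ i≤)))) ,
      inj₁ (m<m+n s (s≤s z≤n))
    ok (inj₂ (p , e)) rewrite e | sym-long i≤ p s<m =
      (lin 5 (λ a b c d e → a ⊕ b ≈ c ⇒ a ≺ c ⊕ ς (d ⊕ e)) 11 0 _ _ _ n′ k (m∸n+n≡m p) , lin 3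
        (λ a b c → a ≺ ς (b ⊕ c) ⇒ a ⊕ ς (b ⊕ c) ≺ ς (b ⊕ c ⊕ ς (b ⊕ c ⊕ κ 0))) 11 0 _ n′ k s<m) ,
      (lin 4 (λ a b c d → a ≈ ς (b ⊕ c) ⊕ d ⇒ c ⊕ κ 1 ≼ a) 101 0 _ n′ _ (toℕ i) len , lin 5
        (λ a b c d e → a ≈ b ⇒ b ⊕ c ≈ ς (d ⊕ e) ⇒ c ≼ d ⇒ e ⊕ κ 1 ≼ a) 101011 0 _ _ _ _ _
        (∸-unique (m ∸ toℕ i) (s + m ∸ (s ∸ toℕ i)) (2 * m) (lin 5 (λ a b c d e → a ≈ ς (b ⊕ c) ⊕ d ⇒
        e ⊕ d ≈ ς (b ⊕ c) ⇒ e ⊕ a ≈ 2 ⊛ (ς (b ⊕ c))) 1011 10101 _ n′ k _ _ len (∸≡ i≤))) (∸≡ i≤) i≤) ,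
      least (toℕ i ≟ 0)
      where
      len : s + m ∸ (s ∸ toℕ i) ≡ m + toℕ i
      len = ∸-unique (m + toℕ i) (s ∸ toℕ i) (s + m) (lin 5 (λ a b c d e → a ⊕ b ≈ c ⇒ ς (d ⊕ e) ⊕ b ⊕ a ≈ c ⊕ ς
        (d ⊕ e)) 11 101 (s ∸ toℕ i) (toℕ i) _ n′ k (m∸n+n≡m p))
      -- The orbit has two members starting at s - i and s. They start alike only for i = 0, the
      -- diameter, which equals its own image.
      least : _ → SegLeq (s ∸ toℕ i , s + m) (s , s ∸ toℕ i + m)
      least (yes z) = inj₂ (lin 3 (λ a b c → a ⊕ b ≈ c ⇒ b ≈ κ 0 ⇒ a ≈ c) 1001 10011 _ _ _ (m∸n+n≡m p) z , lin 5
        (λ a b c d e → a ⊕ b ≈ c ⇒ b ≈ κ 0 ⇒ c ⊕ ς (d ⊕ e) ≼ a ⊕ ς (d ⊕ e)) 10011 0 _ _ _ n′ k (m∸n+n≡m p) z)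
      least (no z)  = inj₁ (lin 3 (λ a b c → a ⊕ b ≈ c ⇒ κ 0 ≺ b ⇒ a ≺ c) 111 0 _ _ _ (m∸n+n≡m p) (n≢0⇒n>0 z))

  pair-seg : ∀ {i j s t} p q → toℕ i ≡ toℕ j → s ≡ t → pair i s p ≡ pair j t q
  pair-seg {i} {j} {s} p q e refl with toℕ-injective e
  ... | refl = cong (pair i s) (≤-irrelevant p q)

  seg-injective : ∀ i j s t → i ≤ n′ → j ≤ n′ → seg i s ≡ seg j t → i ≡ j × s ≡ t
  seg-injective i j s t i≤ j≤ e = go (seg-cases i s) (seg-cases j t)
    where
    go : SegShape i s →
         SegShape j t → i ≡ j × s ≡ t
    go (inj₁ (p , x)) (inj₁ (q , y)) = lin 8 (λ a b c d e f g h → a ≈ b ⇒ a ⊕ c ≈ b ⊕ d ⇒ c ⊕ e ≈ ς (f ⊕ g) ⇒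
      d ⊕ h ≈ ς (f ⊕ g) ⇒ e ≈ h) 11001101 100110011 _ _ _ _ _ n′ k _ e₁ e₂ (∸≡ i≤) (∸≡ j≤) , e₁
      where
      eq = trans (sym x) (trans e y)
      e₁ : s ≡ t
      e₁ = cong proj₁ eq
      e₂ : s + (m ∸ i) ≡ t + (m ∸ j)
      e₂ = cong proj₂ eq
    go (inj₁ (p , x)) (inj₂ (q , y)) = ⊥-elim (lin 6 (λ a b c d e f → a ⊕ b ≈ c ⊕ ς (d ⊕ e) ⇒ b ⊕ f ≈ ς (d ⊕ e)
      ⇒ a ≺ f ⇒ ↯) 10011 0 _ _ _ n′ k _ e₂ (∸≡ i≤) p)
      where
      e₂ : s + (m ∸ i) ≡ t + m
      e₂ = cong proj₂ (trans (sym x) (trans e y))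
    go (inj₂ (p , x)) (inj₁ (q , y)) = ⊥-elim (lin 6 (λ a b c d e f → a ⊕ ς (b ⊕ c) ≈ d ⊕ e ⇒ e ⊕ f ≈ ς (b ⊕ c)
      ⇒ d ≺ f ⇒ ↯) 1011 0 _ n′ k _ _ _ e₂ (∸≡ j≤) q)
      where
      e₂ : s + m ≡ t + (m ∸ j)
      e₂ = cong proj₂ (trans (sym x) (trans e y))
    go (inj₂ (p , x)) (inj₂ (q , y)) = lin 8 (λ a b c d e f g h → a ≈ b ⇒ c ⊕ ς (d ⊕ e) ≈ f ⊕ ς (d ⊕ e) ⇒
      a ⊕ g ≈ c ⇒ b ⊕ h ≈ f ⇒ g ≈ h) 100101101 11010011 _ _ _ n′ k _ _ _ e₁ e₂ (m∸n+n≡m p) (m∸n+n≡m q) , lin 4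
      (λ a b c d → a ⊕ ς (b ⊕ c) ≈ d ⊕ ς (b ⊕ c) ⇒ a ≈ d) 11 101 _ n′ k _ e₂
      where
      eq = trans (sym x) (trans e y)
      e₁ : s ∸ i ≡ t ∸ j
      e₁ = cong proj₁ eq
      e₂ : s + m ≡ t + m
      e₂ = cong proj₂ eq

  pair-injective : ∀ {i j s t} p q → pair i s p ≡ pair j t q → i ≡ j × s ≡ t
  pair-injective {i} {j} {s} {t} p q e
    with seg-injective (toℕ i) (toℕ j) s t (s≤s⁻¹ (toℕ<n i)) (s≤s⁻¹ (toℕ<n j)) (cong proj₁ e)
  ... | e₁ , e₂ = toℕ-injective e₁ , e₂

  -- Let [a , b] be least in its orbit. If b < m it is the short member; if a < m ≤ b, leastness
  -- makes it the long member or a diameter; and m ≤ a is impossible, since the half-turn would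
  -- start earlier. Relevance is what bounds the letter.
  pair-surjective : ∀ (v : SymPair m k) → Σ (Fin n) λ i → Σ ℕ λ s → Σ (s < m) λ p → pair i s p ≡ v
  pair-surjective v@((a , b) , (a<b , b<2m) , (r₁ , r₂) , least) = go (b <? m) (a <? m)
    where
    found : ∀ i s → i ≤ n′ → s < m → seg i s ≡ (a , b) → Σ (Fin n) λ i → Σ ℕ λ s → Σ (s < m) λ p → pair i s p ≡
      v
    found i s p q e = fromℕ< (s≤s p) , s , q
      , SymPair-≡ {m} {k} _ v (trans (cong (λ z → seg z s) (toℕ-fromℕ< (s≤s p))) e)
    go : Dec (b < m) → Dec (a < m) → Σ (Fin n) λ i → Σ ℕ λ s → Σ (s < m) λ p → pair i s p ≡ v
    go (yes p) _ = found i a i≤ (<-trans a<b p) (shape (seg-cases i a))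
      where
      d = b ∸ a
      d+a : b ∸ a + a ≡ b
      d+a = m∸n+n≡m (<⇒≤ a<b)
      i = m ∸ d
      i+d : m ∸ d + d ≡ m
      i+d = m∸n+n≡m {m} {d} (lin 5 (λ a b c d e → a ⊕ b ≈ c ⇒ c ≺ ς (d ⊕ e) ⇒ a ≼ ς (d ⊕ e)) 111 0 _ _ _ n′ k
        d+a p)
      i≤ : i ≤ n′
      i≤ = lin 4 (λ a b c d → a ⊕ b ≈ ς (c ⊕ d) ⇒ d ⊕ κ 1 ≼ b ⇒ a ≼ c) 111 0 _ _ _ _ i+d r₁
      shape : SegShape i a → seg i a ≡ (a , b)
      shape (inj₁ (_ , e)) = trans e
        (cong (a ,_) (lin 7 (λ a b c d e f g → a ⊕ b ≈ ς (c ⊕ d) ⇒ b ⊕ e ≈ ς (c ⊕ d) ⇒ e ⊕ f ≈ g ⇒ f ⊕ a ≈ g)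
        110011 1001101 (m ∸ i) i n′ k d a _ (∸≡ i≤) i+d d+a))
      shape (inj₂ (q , _)) = ⊥-elim (lin 6 (λ a b c d e f → a ≼ b ⇒ a ⊕ c ≈ ς (d ⊕ e) ⇒ c ⊕ b ≈ f ⇒
        f ≺ ς (d ⊕ e) ⇒ ↯) 110011 0 _ _ _ n′ k _ q i+d d+a p)
    go (no p) (no q) = ⊥-elim (low (subst (SegLeq (a , b)) sy least))
      where
      sy : symSeg m (a , b) ≡ (a ∸ m , b ∸ m)
      sy = trans (cong₂ mkSeg (rot-≥ {m} {a} (≮⇒≥ q)) (rot-≥ {m} {b} (≮⇒≥ p))) (mkSeg-≤ (∸-monoˡ-≤ m (<⇒≤ a<b)))
      low : SegLeq (a , b) (a ∸ m , b ∸ m) → ⊥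
      low (inj₁ x)       = lin 4 (λ a b c d → a ≺ b ⇒ b ⊕ ς (c ⊕ d) ≈ a ⇒ ↯) 101 0 _ _ n′ k x (m∸n+n≡m (≮⇒≥ q))
      low (inj₂ (x , _)) = lin 4 (λ a b c d → a ≈ b ⇒ b ⊕ ς (c ⊕ d) ≈ a ⇒ ↯) 101 0 _ _ n′ k x (m∸n+n≡m (≮⇒≥ q))
    go (no p) (yes q) = found i s i≤ (lin 4 (λ a b c d → a ⊕ ς (b ⊕ c) ≈ d ⇒ d ≺ 2 ⊛ (ς (b ⊕ c)) ⇒
      a ≺ ς (b ⊕ c)) 111 0 _ n′ k _ s+m b<2m) (shape (seg-cases i s))
      where
      s = b ∸ m
      s+m : b ∸ m + m ≡ b
      s+m = m∸n+n≡m (≮⇒≥ p)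
      sy : symSeg m (a , b) ≡ (b ∸ m , a + m)
      sy = trans (cong₂ mkSeg (rot-< {m} {a} q) (rot-≥ {m} {b} (≮⇒≥ p)))
        (mkSeg-> {a + m} {b ∸ m} (lin 5 (λ a b c d e → a ⊕ ς (b ⊕ c) ≈ d ⇒ d ≺ 2 ⊛ (ς (b ⊕ c)) ⇒
        a ≺ e ⊕ ς (b ⊕ c)) 111 0 _ n′ k _ _ s+m b<2m))
      low : SegLeq (a , b) (b ∸ m , a + m) → a ≤ s
      low (inj₁ x)       = <⇒≤ x
      low (inj₂ (x , _)) = ≤-reflexive x
      a≤s : a ≤ s
      a≤s = low (subst (SegLeq (a , b)) sy least)
      i = s ∸ a
      i+a : s ∸ a + a ≡ s
      i+a = m∸n+n≡m a≤s
      d+a : b ∸ a + a ≡ b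
      d+a = m∸n+n≡m (<⇒≤ a<b)
      i≤ : i ≤ n′
      i≤ = lin 8 (λ a b c d e f g h → a ⊕ κ 1 ≼ b ⇒ b ⊕ c ≈ 2 ⊛ (ς (d ⊕ a)) ⇒ c ⊕ e ≈ f ⇒ g ⊕ ς (d ⊕ a) ≈ f ⇒
        h ⊕ e ≈ g ⇒ h ≼ d) 1011001011 0 _ _ _ _ _ _ _ _ r₂
        (m∸n+n≡m {2 * m} {b ∸ a} (lin 5 (λ a b c d e → a ⊕ b ≈ c ⇒ c ≺ 2 ⊛ (ς (d ⊕ e)) ⇒ a ≼ 2 ⊛ (ς (d ⊕ e)))
        222 0 _ _ _ n′ k d+a b<2m)) d+a s+m i+a
      shape : SegShape i s → seg i s ≡ (a , b)
      shape (inj₁ (x , _)) = ⊥-elim (lin 3 (λ a b c → a ≺ b ⇒ b ⊕ c ≈ a ⇒ ↯) 101 0 _ _ _ x i+a)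
      shape (inj₂ (x , e)) = trans e (cong₂ _,_ (lin 4 (λ a b c d → a ⊕ b ≈ c ⇒ b ⊕ d ≈ c ⇒ a ≈ d) 1101 10011 _
        _ _ _ (m∸n+n≡m x) i+a) s+m)

-- Crossings as periodic sequences of endpoints

insert : Seg → List Seg → List Seg
insert d []      = d ∷ []
insert d (x ∷ l) with proj₁ d <? proj₁ x
... | yes _ = d ∷ x ∷ l
... | no _  = x ∷ insert d l

insert-length : ∀ d l → length (insert d l) ≡ suc (length l)
insert-length d []      = refl
insert-length d (x ∷ l) with proj₁ d <? proj₁ x
... | yes _ = refl
... | no _  = cong suc (insert-length d l)

insert-All : ∀ {P : Seg → Set} {d l} → P d → All P l → All P (insert d l)
insert-All pd []       = pd ∷ []
insert-All {d = d} {l = x ∷ l} pd (px ∷ pl) with proj₁ d <? proj₁ x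
... | yes _ = pd ∷ px ∷ pl
... | no _  = px ∷ insert-All pd pl

sort : List Seg → List Seg
sort = foldr insert []

sort-length : ∀ l → length (sort l) ≡ length l
sort-length []      = refl
sort-length (d ∷ l) = trans (insert-length d (sort l)) (cong suc (sort-length l))

sort-All : ∀ {P : Seg → Set} {l} → All P l → All P (sort l)
sort-All []        = []
sort-All (pd ∷ pl) = insert-All pd (sort-All pl)

-- The union of k+1 pairwise crossing diagonals of an M-gon, read cyclically in
-- the universal cover: dropping the first diagonal [a , b] of the list and
-- appending [b , a + M] starts the same crossing one endpoint later.
module Cyclic (M : ℕ) where

  Interlaced : Seg → Seg → Set
  Interlaced (a , b) (a′ , b′) = a < a′ × a′ < b × b < b′ × b′ < a + M

  Bounded : Seg → Set
  Bounded (a , b) = a < b × b < M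

  Proper : Seg → Set
  Proper (a , b) = a < b × b < a + M

  orient : ∀ d x → Bounded d → Bounded x → Cross d x → proj₁ d < proj₁ x → Interlaced d x
  orient d x (_ , _) (_ , q) (inj₁ (u , v , w)) p = u , v , w , <-≤-trans q (m≤n+m M _)
  orient d x _ _ (inj₂ (u , _)) p = ⊥-elim (<-asym u p)

  orient′ : ∀ d x → Bounded d → Bounded x → Cross d x → ¬ (proj₁ d < proj₁ x) → Interlaced x d
  orient′ d x _ _ (inj₁ (u , _)) p = ⊥-elim (p u)
  orient′ d x (_ , q) _ (inj₂ (u , v , w)) p = u , v , w , <-≤-trans q (m≤n+m M _)

  insert-sorted : ∀ {d l} → Bounded d → All Bounded l → All (Cross d) l → AllPairs Interlaced l →
    AllPairs Interlaced (insert d l)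
  insert-sorted bd [] [] [] = [] ∷ []
  insert-sorted {d} {x ∷ l} bd (bx ∷ bl) (cx ∷ cl) (ix ∷ il) with proj₁ d <? proj₁ x
  ... | yes p = (orient d x bd bx cx p ∷ rest l bl cl ix) ∷ ix ∷ il
    where
    rest : ∀ l → All Bounded l → All (Cross d) l → All (Interlaced x) l → All (Interlaced d) l
    rest [] [] [] [] = []
    rest (z ∷ l) (bz ∷ bl) (cz ∷ cl) (iz ∷ il) = orient d z bd bz cz (<-trans p (proj₁ iz)) ∷ rest l bl cl il
  ... | no p = insert-All (orient′ d x bd bx cx p) ix ∷ insert-sorted bd bl cl il

  sort-sorted : ∀ {l} → All Bounded l → AllPairs Cross l → AllPairs Interlaced (sort l)
  sort-sorted [] [] = []
  sort-sorted (bd ∷ bl) (cd ∷ cl) = insert-sorted bd (sort-All bl) (sort-All cd) (sort-sorted bl cl)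

  glide : Seg → Seg
  glide (a , b) = b , a + M

  shift : List Seg → List Seg
  shift []      = []
  shift (d ∷ l) = l ++ glide d ∷ []

  shifts : ℕ → List Seg → List Seg
  shifts zero    l = l
  shifts (suc j) l = shifts j (shift l)

  shifts-+ : ∀ i j l → shifts (i + j) l ≡ shifts j (shifts i l)
  shifts-+ zero    j l = refl
  shifts-+ (suc i) j l = shifts-+ i j (shift l)

  shifts-++ : ∀ xs ys → shifts (length xs) (xs ++ ys) ≡ ys ++ map glide xs
  shifts-++ []       ys = sym (++-identityʳ ys)
  shifts-++ (x ∷ xs) ys = trans (cong (shifts (length xs)) (++-assoc xs ys (glide x ∷ [])))
    (trans (shifts-++ xs (ys ++ glide x ∷ [])) (++-assoc ys (glide x ∷ []) (map glide xs)))

  shifts-all : ∀ l → shifts (length l) l ≡ map glide l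
  shifts-all l = trans (cong (shifts (length l)) (sym (++-identityʳ l))) (shifts-++ l [])

  record Crossing (P : Seg → Set) (K : ℕ) (l : List Seg) : Set where
    field
      size       : length l ≡ K
      proper     : All Proper l
      interlaced : AllPairs Interlaced l
      members    : All P l

  -- The condition a < a′ < b < b′ < a + M is cyclic: rotated to a′ < b < b′ < a + M < a′ + M, it
  -- says that (a′ , b′) is interlaced with the glide of (a , b).
  crossing-shift : ∀ {P K l} → (∀ {d} → P d → P (glide d)) → Crossing P K l → Crossing P K (shift l)
  crossing-shift {l = []} gl cr = cr
  crossing-shift {l = (a , b) ∷ l} gl record { size = sz ; proper = (p , q) ∷ pr ; interlaced = ix ∷ il ;
    members = mx ∷ ms } = record
    { size       = trans (length-++ l) (trans (+-comm (length l) 1) sz)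
    ; proper     = AllP.++⁺ pr ((q , +-monoˡ-< M p) ∷ [])
    ; interlaced = AllPairsP.++⁺ il ([] ∷ [])
      (All.map (λ { (u , v , w , z) → (v , w , z , +-monoˡ-< M u) ∷ [] }) ix)
    ; members    = AllP.++⁺ ms (gl mx ∷ [])
    }

  crossing-shifts : ∀ {P K l} → (∀ {d} → P d → P (glide d)) → ∀ j → Crossing P K l → Crossing P K (shifts j l)
  crossing-shifts gl zero    cr = cr
  crossing-shifts gl (suc j) cr = crossing-shifts gl j (crossing-shift gl cr)

  head : List Seg → Seg
  -- A placeholder: a crossing has k + 1 members and is never empty.
  head []      = 0 , 0
  head (d ∷ _) = d

  record Endpoints (P : Seg → Set) (k : ℕ) (e : ℕ → ℕ) : Set where
    field
      increasing : ∀ j → e j < e (suc j)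
      period     : ∀ j → e (j + suc k + suc k) ≡ e j + M
      diagonal   : ∀ j → P (e j , e (j + suc k))

  -- After k + 1 shifts every diagonal has been replaced by its glide. So the head then starts at
  -- the far end of the present head, and after 2k + 2 shifts at its near end plus M.
  endpoints : ∀ {P k l} → (∀ {d} → P d → P (glide d)) → Crossing P (suc k) l →
    Endpoints P k (λ j → proj₁ (head (shifts j l)))
  endpoints {P} {k} {l} gl cr = record
    { increasing = λ j → subst (λ z → proj₁ (head (shifts j l)) < proj₁ (head z))
        (sym (trans (cong (λ z → shifts z l) (+-comm 1 j)) (shifts-+ j 1 l)))
        (step (crossing-shifts gl j cr))
    ; period = λ j → trans (cong proj₁ (half (j + suc k))) (cong proj₂ (half j))
    ; diagonal = λ j → subst (λ z → P (proj₁ (head (shifts j l)) , z)) (sym (cong proj₁ (half j)))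
      (first (crossing-shifts gl j cr))
    }
    where
    step : ∀ {l} → Crossing P (suc k) l → proj₁ (head l) < proj₁ (head (shift l))
    step {[]} record { size = () }
    step {d ∷ []} record { proper = (p , _) ∷ _ } = p
    step {d ∷ x ∷ l} record { interlaced = ((p , _) ∷ _) ∷ _ } = p
    first : ∀ {l} → Crossing P (suc k) l → P (proj₁ (head l) , proj₂ (head l))
    first {[]} record { size = () }
    first {d ∷ l} record { members = p ∷ _ } = p
    head-glide : ∀ {l} → Crossing P (suc k) l → head (map glide l) ≡ glide (head l)
    head-glide {[]} record { size = () }
    head-glide {d ∷ l} _ = refl
    half : ∀ j → head (shifts (j + suc k) l) ≡ glide (head (shifts j l))
    half j = trans (cong head (trans (shifts-+ j (suc k) l)
        (trans (cong (λ z → shifts z (shifts j l)) (sym (Crossing.size crⱼ))) (shifts-all (shifts j l)))))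
      (head-glide crⱼ)
      where
      crⱼ = crossing-shifts gl j cr

  module Search (P : Seg → Set) (k N : ℕ) (M≡ : M ≡ N + k + k) (e : ℕ → ℕ) (ends : Endpoints P k e)
    (F : ℕ → ℕ) (st : Staircase N F) (early : ∀ x → 0 < x → x < N → e 0 ≤ F x) where
    open Endpoints ends

    growth : ∀ j d → e j + d ≤ e (j + d)
    growth j zero    = ≤-reflexive (trans (+-identityʳ (e j)) (cong e (sym (+-identityʳ j))))
    growth j (suc d) = subst (λ z → e j + suc d ≤ e z) (sym (+-suc j d))
      (lin 4 (λ a b c d → a ⊕ b ≼ c ⇒ c ≺ d ⇒ a ⊕ ς b ≼ d) 111 0 _ _ _ _ (growth j d) (increasing (j + d)))

    locate : ∀ j a → e 0 ≤ a → a < e (suc j) → Σ ℕ λ i → e i ≤ a × a < e (suc i)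
    locate zero    a p q = 0 , p , q
    locate (suc j) a p q with e (suc j) ≤? a
    ... | yes r = suc j , r , q
    ... | no r  = locate j a p (≰⇒> r)

    -- Exactly the k + 1 endpoints e (j + 1) , ... , e (j + k + 1) lie in (α , β], where (α , β) is
    -- the staircase point over θ. They become the first ends of a chain starting at that point.
    record Window : Set where
      field
        θ j   : ℕ
        0<θ   : 0 < θ
        θ<N   : θ < N
        a-low : e j ≤ F θ
        a-up  : F θ < e (suc j)
        b-low : e (j + suc k) ≤ F θ + k + θ
        b-up  : F θ + k + θ < e (suc j + suc k)

    -- Along the staircase the number of endpoints in the half-open interval
    -- from F x to F x + k + x changes by at most one per step, from at most
    -- k + 1 to at least k + 1.
    walk : ∀ d x j → 0 < x → suc (x + d) ≡ N → e j ≤ F x → F x < e (suc j) → F x + k + x < e (suc j + suc k) →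
      Window
    walk d x j 0<x eq p q r with e (j + suc k) ≤? F x + k + x
    ... | yes s = record { θ = x ; j = j ; 0<θ = 0<x ; θ<N = lin 3 (λ a b c → ς (a ⊕ b) ≈ c ⇒ a ≺ c) 11 0 _ _ _
      eq ; a-low = p ; a-up = q ; b-low = s ; b-up = r }
    walk zero x j 0<x eq p q r | no s =
      ⊥-elim (lin 8 (λ a b c d e f g h → a ⊕ b ⊕ c ≺ d ⇒ d ⊕ ς b ≼ e ⇒ e ≈ f ⊕ g ⇒ f ≼ a ⇒ ς (c ⊕ κ 0) ≈ h ⇒
        g ≈ h ⊕ b ⊕ b ⇒ ↯) 110111001 0 _ _ _ _ _ _ _ _ (≰⇒> s) (growth (j + suc k) (suc k)) (period j) p eq M≡)
    walk (suc d) x j 0<x eq p q r | no s with e j ≤? F (suc x)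
    ... | yes t = walk d (suc x) j (s≤s z≤n) (lin 3 (λ a b c → ς (a ⊕ ς b) ≈ c ⇒ ς (ς a ⊕ b) ≈ c) 11 101 _ _ _
      eq) t
          (≤-<-trans (Staircase.down st x 0<x (lin 3 (λ a b c → ς (a ⊕ ς b) ≈ c ⇒ ς a ≺ c) 11 0 _ _ _ eq)) q)
          (lin 6 (λ a b c d e f → a ⊕ b ⊕ c ≺ d ⇒ d ≺ e ⇒ f ≼ a ⇒ f ⊕ b ⊕ ς c ≺ e) 1111 0 _ _ _ _ _ _ (≰⇒> s)
            (increasing (j + suc k)) (Staircase.down st x 0<x (lin 3 (λ a b c → ς (a ⊕ ς b) ≈ c ⇒ ς a ≺ c) 11 0
            _ _ _ eq)))
    walk (suc d) x zero 0<x eq p q r | no s | no t = ⊥-elim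
      (t (early (suc x) (s≤s z≤n) (lin 3 (λ a b c → ς (a ⊕ ς b) ≈ c ⇒ ς a ≺ c) 11 0 _ _ _ eq)))
    walk (suc d) x (suc j) 0<x eq p q r | no s | no t = walk d (suc x) j (s≤s z≤n)
      (lin 3 (λ a b c → ς (a ⊕ ς b) ≈ c ⇒ ς (ς a ⊕ b) ≈ c) 11 101 _ _ _ eq)
      (lin 4 (λ a b c d → a ≺ b ⇒ b ≼ c ⇒ c ≼ ς d ⇒ a ≼ d) 1111 0 _ _ _ _ (increasing j) p
        (Staircase.gentle st x 0<x (lin 3 (λ a b c → ς (a ⊕ ς b) ≈ c ⇒ ς a ≺ c) 11 0 _ _ _ eq))) (≰⇒> t)
      (lin 6 (λ a b c d e f → a ⊕ b ⊕ c ≺ d ⇒ e ≺ f ⇒ f ≼ a ⇒ e ⊕ b ⊕ ς c ≺ d) 1111 0 _ _ _ _ _ _ (≰⇒> s)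
        (≰⇒> t) p)

    -- Endpoints are distinct integers. Over boundary 1 the interval has length k + 1 and so holds
    -- at most k + 1 of them. Over boundary N - 1 its complement in the period N + 2k has length k +
    -- 1, so the interval holds at least k + 1 of the 2k + 2.
    window : 1 < N → Window
    window 1<N with locate (F 1) (F 1) (early 1 (s≤s z≤n) 1<N) (≤-trans (m≤n+m (suc (F 1)) (e 0))
      (growth 0 (suc (F 1))))
    ... | j , p , q = walk (N ∸ 2) 1 j (s≤s z≤n) (trans (+-comm 2 (N ∸ 2)) (m∸n+n≡m 1<N)) p q
          (lin 4 (λ a b c d → a ≺ b ⇒ b ⊕ ς c ≼ d ⇒ a ⊕ c ⊕ κ 1 ≺ d) 111 0 _ _ _ _ q (growth (suc j) (suc k)))

-- Marked chains in the universal cover versus crossings in the polygon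

module ChainPoints (N k θ α β K : ℕ) (Mark : ℕ → ℕ → Set) where
  open UpperBound N k θ α β K Mark

  -- Index 0 is the topmost point, so the indices run against the order of the chain.
  point : ∀ {r a b} → Chain r a b → Fin r → ℕ × ℕ
  point (snoc a b _ _ _ _ _ ch) Fin.zero    = suc a , suc b
  point (snoc a b _ _ _ _ _ ch) (Fin.suc p) = point ch p

  point-mark : ∀ {r a b} (ch : Chain r a b) p → Mark (proj₁ (point ch p)) (proj₂ (point ch p))
  point-mark (snoc a b _ _ mk _ _ ch) Fin.zero    = mk
  point-mark (snoc a b _ _ mk _ _ ch) (Fin.suc p) = point-mark ch p

  point-≤ : ∀ {r a b} (ch : Chain r a b) p → proj₁ (point ch p) ≤ a × proj₂ (point ch p) ≤ b
  point-≤ (snoc a b s t _ _ _ ch) Fin.zero    = s , t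
  point-≤ (snoc a b s t _ _ _ ch) (Fin.suc p) with point-≤ ch p
  ... | u , v = ≤-trans u (≤-trans (n≤1+n a) s) , ≤-trans v (≤-trans (n≤1+n b) t)

  point-> : ∀ {r a b} (ch : Chain r a b) p → α < proj₁ (point ch p) × β < proj₂ (point ch p)
  point-> (snoc a b _ _ _ u v ch) Fin.zero    = s≤s u , s≤s v
  point-> (snoc a b _ _ _ u v ch) (Fin.suc p) = point-> ch p

  point-mono : ∀ {r a b} (ch : Chain r a b) p q → p Fin.< q →
    proj₁ (point ch q) < proj₁ (point ch p) × proj₂ (point ch q) < proj₂ (point ch p)
  point-mono (snoc a b _ _ _ _ _ ch) Fin.zero    (Fin.suc q) l with point-≤ ch q
  ... | u , v = s≤s u , s≤s v
  point-mono (snoc a b _ _ _ _ _ ch) (Fin.suc p) (Fin.suc q) l = point-mono ch p q (s≤s⁻¹ l)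

Cross-sym : ∀ x y → Cross x y → Cross y x
Cross-sym x y (inj₁ p) = inj₂ p
Cross-sym x y (inj₂ p) = inj₁ p

module Faces (n′ k : ℕ) (c : Word (suc n′)) (c↭ : c ↭ allFin (suc n′)) (T : SymPair (suc n′ + k) k → Bool) where
  open Pairs n′ k
  open SignedArrays n′ using (actN; Reversed)
  open Frontiers n′ using (N; label)
  open Setting n′ k c c↭ hiding (m)
  open Cyclic (2 * m)

  -- The set of pairs unrolled to the universal cover: adding m to the frontier value is the
  -- half-turn, under which a pair is invariant.
  U : Fin n → ℕ → Bool
  U i y = T (pair i (y % m) (m%n<n y m))

  open Evolution n′ k U using (Mark; low-mark; high-mark; marked)
  module Sub = Subwords n′ k U c c↭

  U-mod : ∀ i {y z} → y % m ≡ z % m → U i y ≡ U i z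
  U-mod i e = cong T (pair-seg {i} {i} _ _ refl e)

  U-period : ∀ i y → U i (y + m) ≡ U i y
  U-period i y = U-mod i {y + m} {y} ([m+n]%n≡m%n y m)

  mark-glide : ∀ {a b} → Mark a b → Mark b (a + 2 * m)
  mark-glide {a} (low-mark i y u e₁ e₂)  = high-mark i (y + m) (trans (U-period i y) u) e₂
    (lin 4 (λ a b c d → a ≈ b ⇒ a ⊕ 2 ⊛ (ς (c ⊕ d)) ≈ b ⊕ ς (c ⊕ d) ⊕ ς (c ⊕ d)) 11 101 _ _ n′ k e₁)
  mark-glide {a} (high-mark i y u e₁ e₂) = low-mark i (y + m) (trans (U-period i y) u) e₂
    (lin 5 (λ a b c d e → a ⊕ b ≈ c ⇒ a ⊕ 2 ⊛ (ς (d ⊕ e)) ⊕ b ≈ c ⊕ ς (d ⊕ e) ⊕ ς (d ⊕ e)) 11 101 a (toℕ i) _ n′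
    k e₁)

  MarkedSeg : Seg → Set
  MarkedSeg (a , b) = Mark a b

  in-union⇒mark : ∀ d → InUnion m k T d → Bounded d × MarkedSeg d
  in-union⇒mark d (v , tv , which) with pair-surjective v
  ... | i , s , s<m , refl = go (seg-cases (toℕ i) s) which
    where
    i≤ : toℕ i ≤ n′
    i≤ = s≤s⁻¹ (toℕ<n i)
    u : U i s ≡ true
    u = trans (cong T (pair-seg {i} {i} _ _ refl (m<n⇒m%n≡m s<m))) tv
    go : SegShape (toℕ i) s →
      seg (toℕ i) s ≡ d ⊎ symSeg m (seg (toℕ i) s) ≡ d → Bounded d × MarkedSeg d
    go (inj₁ (p , e)) (inj₁ e′) = subst (λ z → Bounded z × MarkedSeg z) (trans (sym e) e′)
      ((lin 5 (λ a b c d e → a ⊕ b ≈ ς (c ⊕ d) ⇒ b ≼ c ⇒ e ≺ e ⊕ a) 1011 0 _ _ _ _ _ (∸≡ i≤) i≤ , lin 5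
        (λ a b c d e → a ⊕ b ≈ ς (c ⊕ d) ⇒ e ≺ b ⇒ e ⊕ a ≺ 2 ⊛ (ς (c ⊕ d))) 211 0 _ _ n′ k _ (∸≡ i≤) p) ,
        low-mark i s u refl (lin 5 (λ a b c d e → a ⊕ b ≈ ς (c ⊕ d) ⇒ e ⊕ a ⊕ b ≈ e ⊕ ς (c ⊕ d)) 11 101 _ _ n′ k
        _ (∸≡ i≤)))
    go (inj₁ (p , e)) (inj₂ e′) = subst (λ z → Bounded z × MarkedSeg z) (trans (sym (sym-short i≤ p))
      (trans (cong (symSeg m) (sym e)) e′))
      ((lin 5 (λ a b c d e → a ⊕ b ≈ ς (c ⊕ d) ⇒ b ≼ c ⇒ e ⊕ ς (c ⊕ d) ≺ e ⊕ a ⊕ ς (c ⊕ d)) 1011 0 _ _ _ _ _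
        (∸≡ i≤) i≤ , lin 5 (λ a b c d e → a ⊕ b ≈ ς (c ⊕ d) ⇒ e ≺ b ⇒ e ⊕ a ⊕ ς (c ⊕ d) ≺ 2 ⊛ (ς (c ⊕ d))) 111 0
        _ _ n′ k _ (∸≡ i≤) p) , low-mark i (s + m) (trans (U-period i s) u) refl
        (lin 5 (λ a b c d e → a ⊕ b ≈ ς (c ⊕ d) ⇒ e ⊕ a ⊕ ς (c ⊕ d) ⊕ b ≈ e ⊕ ς (c ⊕ d) ⊕ ς (c ⊕ d)) 11 101 _ _
        n′ k _ (∸≡ i≤)))
    go (inj₂ (p , e)) (inj₁ e′) = subst (λ z → Bounded z × MarkedSeg z) (trans (sym e) e′)
      ((lin 5 (λ a b c d e → a ⊕ b ≈ c ⇒ a ≺ c ⊕ ς (d ⊕ e)) 11 0 _ _ _ n′ k (m∸n+n≡m p) , lin 3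
        (λ a b c → a ≺ ς (b ⊕ c) ⇒ a ⊕ ς (b ⊕ c) ≺ 2 ⊛ (ς (b ⊕ c))) 11 0 _ n′ k s<m) , high-mark i s u
        (m∸n+n≡m p) refl)
    go (inj₂ (p , e)) (inj₂ e′) = subst (λ z → Bounded z × MarkedSeg z) (trans (sym (sym-long i≤ p s<m))
      (trans (cong (symSeg m) (sym e)) e′))
      ((lin 5 (λ a b c d e → a ⊕ b ≈ c ⇒ b ≼ d ⇒ c ≺ a ⊕ ς (d ⊕ e)) 1011 0 _ _ _ _ _ (m∸n+n≡m p) i≤ , lin 5
        (λ a b c d e → a ⊕ b ≈ c ⇒ c ≺ ς (d ⊕ e) ⇒ a ⊕ ς (d ⊕ e) ≺ 2 ⊛ (ς (d ⊕ e))) 111 0 _ _ _ n′ k (m∸n+n≡m p)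
        s<m) , low-mark i s u refl (lin 5 (λ a b c d e → a ⊕ b ≈ c ⇒ a ⊕ ς (d ⊕ e) ⊕ b ≈ c ⊕ ς (d ⊕ e)) 11 101
        (s ∸ toℕ i) (toℕ i) _ n′ k (m∸n+n≡m p)))

  -- The residue of y modulo m selects the pair. Whether its residue modulo 2m lies below m then
  -- decides which of the two members the diagonal is.
  low⇒in-union : ∀ i y b → U i y ≡ true → b + toℕ i ≡ y + m → InUnion m k T (mkSeg (y % (2 * m)) (b % (2 * m)))
  low⇒in-union i y b u e = pair i s (m%n<n y m) , u , go (r <? m) (seg-cases (toℕ i) s)
    where
    i≤ : toℕ i ≤ n′
    i≤ = s≤s⁻¹ (toℕ<n i)
    s = y % m
    r = y % (2 * m)
    q = y / (2 * m)
    y≡ : y ≡ r + q * (2 * m)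
    y≡ = m≡m%n+[m/n]*n y (2 * m)
    s≡ : s ≡ r % m
    s≡ = trans (cong (_% m) (trans y≡ (cong (r +_) (sym (*-assoc q 2 m))))) ([m+kn]%n≡m%n r (q * 2) m)
    r< : r < 2 * m
    r< = m%n<n y (2 * m)
    b-residue : ∀ x t → x < 2 * m → b ≡ x + t * (2 * m) → b % (2 * m) ≡ x
    b-residue x t p e = trans (cong (_% (2 * m)) e) (%-shift (2 * m) x t p)
    go : Dec (r < m) → SegShape (toℕ i) s →
      seg (toℕ i) s ≡ mkSeg r (b % (2 * m)) ⊎ symSeg m (seg (toℕ i) s) ≡ mkSeg r (b % (2 * m))
    go (yes r<m) cases = short cases
      where
      s≡r : s ≡ r
      s≡r = trans s≡ (m<n⇒m%n≡m r<m)
      target : mkSeg r (b % (2 * m)) ≡ (s , s + (m ∸ toℕ i))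
      target = trans (cong (mkSeg r) (b-residue (r + (m ∸ toℕ i)) q
        (lin 5 (λ a b c d e → a ≺ ς (b ⊕ c) ⇒ d ⊕ e ≈ ς (b ⊕ c) ⇒ a ⊕ d ≺ 2 ⊛ (ς (b ⊕ c))) 1011 0 _ n′ k _ _ r<m
        (∸≡ i≤)) (lin 8 (λ a b c d e f g h → a ⊕ b ≈ c ⊕ ς (d ⊕ e) ⇒ c ≈ f ⊕ g ⇒ h ⊕ b ≈ ς (d ⊕ e) ⇒ a ≈ f ⊕ h ⊕
        g) 101101 1010011 _ _ _ n′ k r (q * (2 * Pairs.m n′ k)) _ e y≡ (∸≡ i≤))))
        (trans (mkSeg-≤ (m≤m+n r (m ∸ toℕ i))) (cong (λ z → z , z + (m ∸ toℕ i)) (sym s≡r)))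
      short : SegShape (toℕ i) s →
        seg (toℕ i) s ≡ mkSeg r (b % (2 * m)) ⊎ symSeg m (seg (toℕ i) s) ≡ mkSeg r (b % (2 * m))
      short (inj₁ (p , e′)) = inj₁ (trans e′ (sym target))
      short (inj₂ (p , e′)) = inj₂ (trans (trans (cong (symSeg m) e′) (sym-long i≤ p (m%n<n y m)))
        (trans (cong (s ,_) end) (sym target)))
        where
        end : s ∸ toℕ i + m ≡ s + (m ∸ toℕ i)
        end = lin 6 (λ a b c d e f → a ⊕ b ≈ c ⇒ d ⊕ b ≈ ς (e ⊕ f) ⇒ a ⊕ ς (e ⊕ f) ≈ c ⊕ d) 1101 10011 _ _ _ _
          n′ k (m∸n+n≡m p) (∸≡ i≤)
    go (no r≮m) cases = long cases
      where
      s+m≡r : s + m ≡ r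
      s+m≡r = trans (cong (_+ m) (trans s≡ (trans (cong (_% m) (sym (m∸n+n≡m (≮⇒≥ r≮m))))
        (trans ([m+n]%n≡m%n (r ∸ m) m)
          (m<n⇒m%n≡m {m} {r ∸ m} (lin 4 (λ a b c d → a ⊕ ς (b ⊕ c) ≈ d ⇒ d ≺ 2 ⊛ (ς (b ⊕ c)) ⇒ a ≺ ς (b ⊕ c))
          111 0 _ n′ k _ (m∸n+n≡m (≮⇒≥ r≮m)) r<)))))) (m∸n+n≡m (≮⇒≥ r≮m))
      long : SegShape (toℕ i) s →
        seg (toℕ i) s ≡ mkSeg r (b % (2 * m)) ⊎ symSeg m (seg (toℕ i) s) ≡ mkSeg r (b % (2 * m))
      long (inj₁ (p , e′)) = inj₂ (trans (trans (cong (symSeg m) e′) (sym-short i≤ p)) (sym target))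
        where
        target : mkSeg r (b % (2 * m)) ≡ (s + m , s + (m ∸ toℕ i) + m)
        target = trans (cong (mkSeg r) (b-residue (r + (m ∸ toℕ i)) q
          (lin 6 (λ a b c d e f → a ⊕ ς (b ⊕ c) ≈ d ⇒ a ≺ e ⇒ f ⊕ e ≈ ς (b ⊕ c) ⇒ d ⊕ f ≺ 2 ⊛ (ς (b ⊕ c)))
          101011 0 _ n′ k _ _ _ s+m≡r p (∸≡ i≤)) (lin 8 (λ a b c d e f g h → a ⊕ b ≈ c ⊕ ς (d ⊕ e) ⇒ c ≈ f ⊕ g ⇒
          h ⊕ b ≈ ς (d ⊕ e) ⇒ a ≈ f ⊕ h ⊕ g) 101101 1010011 _ _ _ n′ k r (q * (2 * Pairs.m n′ k)) _ e y≡
          (∸≡ i≤))))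
          (trans (mkSeg-≤ (m≤m+n r (m ∸ toℕ i)))
            (cong₂ _,_ (sym s+m≡r) (lin 5 (λ a b c d e → a ⊕ ς (b ⊕ c) ≈ d ⇒ d ⊕ e ≈ a ⊕ e ⊕ ς (b ⊕ c)) 101 11 _
            n′ k _ _ s+m≡r)))
      long (inj₂ (p , e′)) = inj₁ (trans e′ (sym target))
        where
        b≡ : b ≡ s ∸ toℕ i + (2 * m + q * (2 * m))
        b≡ = lin 9 (λ a b c d e f g h i → a ⊕ b ≈ c ⊕ ς (d ⊕ e) ⇒ c ≈ f ⊕ g ⇒ h ⊕ ς (d ⊕ e) ≈ f ⇒ i ⊕ b ≈ h ⇒
          a ≈ i ⊕ (2 ⊛ (ς (d ⊕ e)) ⊕ g)) 10110101 101001011 _ _ _ n′ k _ _ _ _ e y≡ s+m≡r (m∸n+n≡m p)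
        target : mkSeg r (b % (2 * m)) ≡ (s ∸ toℕ i , s + m)
        target = trans (cong (mkSeg r) (b-residue (s ∸ toℕ i) (suc q)
          (lin 6 (λ a b c d e f → a ⊕ b ≈ c ⇒ c ⊕ ς (d ⊕ e) ≈ f ⇒ f ≺ 2 ⊛ (ς (d ⊕ e)) ⇒ a ≺ 2 ⊛ (ς (d ⊕ e)))
          10111 0 _ _ _ n′ k _ (m∸n+n≡m p) s+m≡r r<) b≡))
          (trans (mkSeg-> {r} {s ∸ toℕ i} (lin 6 (λ a b c d e f → a ⊕ b ≈ c ⇒ c ⊕ ς (d ⊕ e) ≈ f ⇒ a ≺ f) 1011 0
            _ _ _ n′ k _ (m∸n+n≡m p) s+m≡r)) (cong (s ∸ toℕ i ,_) (sym s+m≡r)))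

  mark⇒in-union : ∀ {a b} → Mark a b → InUnion m k T (mkSeg (a % (2 * m)) (b % (2 * m)))
  mark⇒in-union {a} {b} (low-mark i y u refl e₂) = low⇒in-union i a b u e₂
  mark⇒in-union {a} {b} (high-mark i y u e₁ e₂) = subst (InUnion m k T)
    (trans (cong (mkSeg (b % (2 * m))) ([m+n]%n≡m%n a (2 * m))) (mkSeg-comm (b % (2 * m)) (a % (2 * m))))
    (low⇒in-union i b (a + 2 * m) (trans (cong (U i) e₂) (trans (U-period i y) u))
      (lin 6 (λ a b c d e f → a ⊕ b ≈ c ⇒ d ≈ c ⊕ ς (e ⊕ f) ⇒ a ⊕ 2 ⊛ (ς (e ⊕ f)) ⊕ b ≈ d ⊕ ς (e ⊕ f)) 1101
      10011 a (toℕ i) _ _ n′ k e₁ e₂))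

  reduce : ℕ × ℕ → Seg
  reduce (a , b) = mkSeg (a % (2 * m)) (b % (2 * m))

  chain⇒crossing : ∀ θ → Sub.ChainAt θ → HasCrossing m k T
  chain⇒crossing θ ch = reduce ∘ pt , (λ p → mark⇒in-union (point-mark ch p)) , λ p q → crosses p q
    (<-cmp (toℕ p) (toℕ q))
    where
    open ChainPoints N k θ (start θ) (start θ + k + θ) (suc k) Mark
    pt = point ch
    -- All first ends exceed α and all second ends are at most α + 2m, so any two chain points fit
    -- into one turn of the polygon.
    within : ∀ {a b s} → b ≤ s + N + k + k → s < a → b < a + 2 * m
    within p q = lin 5 (λ a b c d e → a ≼ b ⊕ ς (c ⊕ ς c) ⊕ d ⊕ d ⇒ b ≺ e ⇒ a ≺ e ⊕ 2 ⊛ (ς (c ⊕ d))) 222 0 _ _ _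
      _ _ p q
    cross-< : ∀ p q → p Fin.< q → Cross (reduce (pt q)) (reduce (pt p))
    cross-< p q l = cross-mkSeg (2 * m) (proj₁ (pt q)) (proj₁ (pt p)) (proj₂ (pt q)) (proj₂ (pt p))
      (proj₁ (point-mono ch p q l))
      (≤-<-trans (proj₁ (point-≤ ch p)) (proj₂ (point-> ch q)))
      (proj₂ (point-mono ch p q l))
      (within (proj₂ (point-≤ ch p)) (proj₁ (point-> ch q)))
    crosses : ∀ p q → Tri (toℕ p < toℕ q) (toℕ p ≡ toℕ q) (toℕ q < toℕ p) → p ≢ q → Cross (reduce (pt p))
      (reduce (pt q))
    crosses p q (tri< l _ _) p≢q = Cross-sym (reduce (pt q)) (reduce (pt p)) (cross-< p q l)
    crosses p q (tri≈ _ e _) p≢q = ⊥-elim (p≢q (toℕ-injective e))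
    crosses p q (tri> _ _ l) p≢q = cross-< q p l

  crossing⇒endpoints : HasCrossing m k T → Σ (ℕ → ℕ) λ e → Endpoints MarkedSeg k e × e 0 < 2 * m
  crossing⇒endpoints (ds , inU , cr) = _ , endpoints {MarkedSeg} {k} {l} mark-glide crossing , first l
    (Crossing.size crossing) bounded
    where
    l = sort (tabulate ds)
    bounded : All Bounded l
    bounded = sort-All (AllP.tabulate⁺ (λ i → proj₁ (in-union⇒mark (ds i) (inU i))))
    crossing : Crossing MarkedSeg (suc k) l
    crossing = record
      { size       = trans (sort-length (tabulate ds)) (ListP.length-tabulate ds)
      ; proper     = All.map (λ { (p , q) → p , <-≤-trans q (m≤n+m _ _) }) bounded
      ; interlaced = sort-sorted (AllP.tabulate⁺ (λ i → proj₁ (in-union⇒mark (ds i) (inU i))))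
          (AllPairsP.tabulate⁺ (λ {i} {j} → cr i j))
      ; members    = sort-All (AllP.tabulate⁺ (λ i → proj₂ (in-union⇒mark (ds i) (inU i))))
      }
    first : ∀ l → length l ≡ suc k → All Bounded l → proj₁ (head l) < 2 * m
    first (d ∷ l) _ ((p , q) ∷ _) = <-trans p q

  module _ {e : ℕ → ℕ} (ends : Endpoints MarkedSeg k e) (e₀ : e 0 < 2 * m) where
    open Endpoints ends

    private
      perimeter : 2 * m ≡ N + k + k
      perimeter = lin 2 (λ a b → 2 ⊛ (ς (a ⊕ b)) ≈ ς (a ⊕ ς a) ⊕ b ⊕ b) 1 1 n′ k

      beyond : ∀ x → 0 < x → x < N → m + m + m ≤ start x + n
      beyond = start-≥

      early : ∀ x → 0 < x → x < N → e 0 ≤ start x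
      early x p q = lin 4 (λ a b c d → ς (a ⊕ b) ⊕ ς (a ⊕ b) ⊕ ς (a ⊕ b) ≼ c ⊕ ς a ⇒ d ≺ 2 ⊛ (ς (a ⊕ b)) ⇒
        d ≼ c) 111 0 _ _ _ _ (beyond x p q) e₀

    open Search MarkedSeg k N perimeter e ends start start-staircase early

    -- The upper bounds of the window let the chain leave (α , β). Its last point is (e (j + k + 1)
    -- , e j + 2m) by periodicity, and the lower bounds place it below (β , α + 2m).
    window⇒⊥ : ∀ {S} → (∀ p → S p ≡ true → marked (label start Q p) ≡ false) → Reversed (actN (restrict Q S)) →
      Window → ⊥
    window⇒⊥ {S} avoid rev record { θ = θ ; j = j ; 0<θ = 0<θ ; θ<N = θ<N ; a-low = a-low ; a-up = a-up ; b-low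
      = b-low ; b-up = b-up } =
      Sub.not-reversed {S} avoid rev {θ} {start θ} {start θ + k + θ} {ga} {gb} 0<θ θ<N refl
        (record { tip = refl ; start₁ = refl ; start₂ = refl ; inc₁ = inc₁ ; inc₂ = inc₂ })
        (λ r _ → diagonal (suc j + r))
        (subst (λ z → e z ≤ start θ + k + θ) (+-suc j k) b-low)
        (subst (_≤ start θ + N + k + k) (sym last) (lin 4 (λ a b c d → a ≼ b ⇒ a ⊕ 2 ⊛ (ς (c ⊕ d)) ≼ b ⊕ ς
          (c ⊕ ς c) ⊕ d ⊕ d) 11 0 _ _ _ _ a-low))
      where
      ga gb : ℕ → ℕ
      ga zero    = start θ
      ga (suc r) = e (suc j + r)
      gb zero    = start θ + k + θ
      gb (suc r) = e (suc j + r + suc k)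
      inc₁ : ∀ r → r < suc k → ga r < ga (suc r)
      inc₁ zero    _ = subst (λ z → start θ < e (suc z)) (sym (+-identityʳ j)) a-up
      inc₁ (suc r) _ = subst (λ z → e (suc j + r) < e z) (sym (+-suc (suc j) r)) (increasing (suc j + r))
      inc₂ : ∀ r → r < suc k → gb r < gb (suc r)
      inc₂ zero    _ = subst (λ z → start θ + k + θ < e (suc z + suc k)) (sym (+-identityʳ j)) b-up
      inc₂ (suc r) _ = subst (λ z → e (suc j + r + suc k) < e (z + suc k)) (sym (+-suc (suc j) r))
        (increasing (suc j + r + suc k))
      last : e (suc j + k + suc k) ≡ e j + 2 * m
      last = trans (cong (λ z → e (z + suc k)) (sym (+-suc j k))) (period j)

    endpoints⇒⊥ : ∀ {S} → (∀ p → S p ≡ true → marked (label start Q p) ≡ false) → Reversed (actN (restrict Q S))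
      → ⊥
    endpoints⇒⊥ {S} avoid rev = window⇒⊥ {S} avoid rev (window (s≤s (≤-trans (s≤s z≤n) (m≤n+m n n′))))

-- The isomorphism of complexes

module Isomorphism (n′ k : ℕ) (c : Word (suc n′)) (c↭ : c ↭ allFin (suc n′)) where
  open Pairs n′ k
  open SignedArrays n′ using (actN; Reversed; elem⇒actN; longest; reversed-unique)
  open Frontiers n′ using (label; low; count; count-power; count-coxeter; label-range; label-injective;
    label-surjective)
  open Setting n′ k c c↭ hiding (m)

  -- A bijection, because each letter occurs m times and its occurrences carry m consecutive
  -- frontier values, hence every residue modulo m once.
  to : Fin (length Q) → SymPair m k
  to p = pair (proj₁ (label start Q p)) (proj₂ (label start Q p) % m) (m%n<n (proj₂ (label start Q p)) m)

  count-Q : ∀ (i : Fin n) → count (toℕ i) Q ≡ m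
  count-Q i = count-power (toℕ i) c m (count-coxeter c↭ (toℕ i) (s≤s⁻¹ (toℕ<n i)))

  to-injective : ∀ {p q} → to p ≡ to q → p ≡ q
  to-injective {p} {q} e = label-injective Q start p q
      (go (label start Q p) (label start Q q) (label-range Q start p) (label-range Q start q)
        (pair-injective {proj₁ (label start Q p)} {proj₁ (label start Q q)} {proj₂ (label start Q p) % m}
        {proj₂ (label start Q q) % m} _ _ e))
    where
    go : ∀ x y → let (i , a) = x in let (j , b) = y in
      start (low (toℕ i)) < a × a ≤ count (toℕ i) Q + start (low (toℕ i)) →
      start (low (toℕ j)) < b × b ≤ count (toℕ j) Q + start (low (toℕ j)) →
      i ≡ j × a % m ≡ b % m → x ≡ y
    go (i , a) (.i , b) (p₁ , p₂) (q₁ , q₂) (refl , e) rewrite count-Q i =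
      cong (i ,_) (same-residue m (start (low (toℕ i))) a b p₁ p₂ q₁ q₂ e)

  to-surjective : ∀ v → Σ (Fin (length Q)) λ p → to p ≡ v
  to-surjective v = build (pair-surjective v)
    where
    build : (Σ (Fin n) λ i → Σ ℕ λ s → Σ (s < m) λ q → pair i s q ≡ v) → Σ (Fin (length Q)) λ p → to p ≡ v
    build (i , s , s<m , e) = position (with-residue m (start (low (toℕ i))) s s<m)
      where
      position : (Σ ℕ λ y → start (low (toℕ i)) < y × y ≤ m + start (low (toℕ i)) × y % m ≡ s) → Σ
        (Fin (length Q)) λ p → to p ≡ v
      position (y , lo , hi , r) = proj₁ found , trans (pair-seg {proj₁ (label start Q (proj₁ found))} {i} _ s<m
          (cong (toℕ ∘ proj₁) (proj₂ found)) (trans (cong (λ z → proj₂ z % m) (proj₂ found)) r)) e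
        where
        found : Σ (Fin (length Q)) λ p → label start Q p ≡ (i , y)
        found = label-surjective Q start i y lo (subst (λ z → y ≤ z + start (low (toℕ i))) (sym (count-Q i)) hi)

  vertices : Fin (length Q) ↔ SymPair m k
  vertices = ⤖⇒↔ (mk⤖ (to-injective , λ v → proj₁ (to-surjective v) , λ { refl → proj₂ (to-surjective v) }))

  isomorphism : ∀ w∘ → IsLongest w∘ → SubwordComplex Q w∘ ≅ SymComplex m k
  isomorphism w∘ lw = vertices , λ T → mk⇔ (face⇒ T) (face⇐ T)
    where
    long = longest w∘ lw
    u = proj₁ long
    eu = proj₁ (proj₂ long)
    rev = proj₂ (proj₂ long)
    face⇒ : ∀ T → SComplex.Face (SubwordComplex Q w∘) (T ∘ to) → ¬ HasCrossing m k T
    face⇒ T (S , avoid , el , _) cr = contra (crossing⇒endpoints cr)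
      where
      open Faces n′ k c c↭ T
      contra : (Σ (ℕ → ℕ) λ e → Cyclic.Endpoints (2 * m) MarkedSeg k e × e 0 < 2 * m) → ⊥
      contra (e , ends , e₀) = endpoints⇒⊥ ends e₀ {S} avoid
        (λ y p → trans (cong (λ z → suc (z + y)) (elem⇒actN (restrict Q S) u (trans el (sym eu)) y p))
          (rev y p))
    face⇐ : ∀ T → ¬ HasCrossing m k T → SComplex.Face (SubwordComplex Q w∘) (T ∘ to)
    face⇐ T nc = build (Sub.greedy-reversed (λ θ _ _ ch → nc (chain⇒crossing θ ch)))
      where
      open Faces n′ k c c↭ T
      build : Sub.ReversedSubword → SComplex.Face (SubwordComplex Q w∘) (T ∘ to)
      build (S , avoid , rev′ , red) = S , avoid , trans (reversed-unique (restrict Q S) u rev′ rev) eu , red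

power-+ : ∀ {A : Set} s t (c : List A) → concat (replicate s c) ++ concat (replicate t c) ≡ concat
  (replicate (s + t) c)
power-+ zero    t c = refl
power-+ (suc s) t c = trans (ListP.++-assoc c _ _) (cong (c ++_) (power-+ s t c))

multicluster≅symmetric : ∀ k m n → 0 < n → m ≡ n + k →
  ∀ (c : Word n) → c ↭ allFin n → ∀ (w∘ : Elem n) → IsLongest w∘ →
  ∀ (ps : List ℕ) (w : Word n) → IsLexFirstReduced c w∘ ps w →
  SubwordComplex (cPowThen k c w) w∘ ≅ SymComplex m k
multicluster≅symmetric k .(suc n′ + k) (suc n′) _ refl c c↭ w∘ lw ps w first =
  subst (λ Q → SubwordComplex Q w∘ ≅ SymComplex (suc n′ + k) k) (sym word) (Isomorphism.isomorphism n′ k c c↭ w∘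
    lw)
  where
  word : cPowThen k c w ≡ concat (replicate (suc n′ + k) c)
  word = trans (cong (concat (replicate k c) ++_) (LongestElement.sorting-word n′ c c↭ w∘ lw ps w first))
    (trans (power-+ k (suc n′) c) (cong (λ t → concat (replicate t c)) (+-comm k (suc n′))))

theorem2p10 : ∀ (k m : ℕ) → k + 1 ≤ m →
    ∀ (c : Word (m ∸ k)) → c ↭ allFin (m ∸ k) →
    ∀ (w∘ : Elem (m ∸ k)) → IsLongest w∘ →
    ∀ (ps : List ℕ) (w : Word (m ∸ k)) → IsLexFirstReduced c w∘ ps w →
    SubwordComplex (cPowThen k c w) w∘ ≅ SymComplex m k
theorem2p10 k m p = multicluster≅symmetric k m (m ∸ k) (m<n⇒0<n∸m k<m) (sym (m∸n+n≡m (<⇒≤ k<m)))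
  where
  k<m : k < m
  k<m = subst (_≤ m) (+-comm k 1) p
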